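{- On finite structures, $\mathrm{FO}(k\text{ - }\mathrm{Res}) = \mathrm{EFP}$ for all $k\ge 3$. That is, for every $k\ge 3$, a class of finite relational structures is definable by a sentence of $\mathrm{FO}(k\text{ - }\mathrm{Res})$ if and only if it is definable by a sentence of existential least fixed-point logic $\mathrm{EFP}$.
   Context: All structures are finite and relational. EFP: let $\mathrm{posLFP}$ be the set of $\mathrm{LFP}$-formulas in negation normal form (negation only in front of input atoms), in which each fixed-point variable is bound only once, and which use no greatest fixed points. $\mathrm{EFP}_0$ consists of the formulas of $\mathrm{posLFP}$ all of whose quantifiers are existential. The stratum $\mathrm{EFP}_{\ell+1}$ is the closure under disjunction, conjunction and existential quantification of formulas of the form $[\mathbf{lfp}\, R\bar x.\,\exists\bar y\,\varphi(R,\bar x,\bar y)](\bar x)$ where $\varphi(R,\bar x,\bar y)$ is obtained from a quantifier-free formula, which may contain positive and negative occurrences of additional relations $S_1,\dots,S_m$ (while fixed-point recursion never goes through negation, i.e. $R$ occurs only positively), by substituting these relations by formulas from $\mathrm{EFP}_\ell$. Then $\mathrm{EFP}=\bigcup_{\ell\ge 0}\mathrm{EFP}_\ell$. (This logic is equivalent to Stratified Datalog.) Resolution: a propositional CNF-formula $\psi$ is encoded as a structure over the vocabulary $\{C,V,P,N\}$ whose universe consists of the clauses and variables of $\psi$, where the unary predicates $C,V$ identify clauses and variables, and $Pvc$ (respectively $Nvc$) holds iff variable $v$ occurs positively (respectively negatively) in clause $c$. For $k\ge 1$, $k\text{ - }\mathrm{Res}$ denotes resolution restricted to clauses of size at most $k$,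 and also the class of structures encoding CNF-formulas from which the empty clause can be derived by resolution using only clauses of size at most $k$. Interpretations: for vocabularies $\sigma$ and $\tau=\{S_1,\dots,S_\ell\}$ and a logic $L$, a $d$-dimensional $L[\sigma,\tau]$-interpretation with parameters $\vec z$ is a tuple $I(\vec z)=(\varphi_\delta,\varphi_\approx,\varphi_{S_1},\dots,\varphi_{S_\ell})$ of $L[\sigma]$-formulas with free variables $\vec z$ plus one $d$-tuple of variables for $\varphi_\delta$, two for $\varphi_\approx$, and $\mathrm{arity}(S_i)$ many for $\varphi_{S_i}$. Given a $\sigma$-structure $\mathfrak A$ and values $\vec a$ for $\vec z$, let $\mathfrak B$ be the structure with universe $\{\vec b\in A^d : \mathfrak A\models\varphi_\delta(\vec b,\vec a)\}$ and relations $S_i$ defined by $\varphi_{S_i}$; if $\varphi_\approx$ defines a congruence $\mathcal E$ on $\mathfrak B$, then $I(\mathfrak A,\vec a):=\mathfrak B/\mathcal E$, otherwise $I(\mathfrak A,\vec a)$ is undefined. Lindström extension: for a class $\mathcal K$ of $\tau$-structures, $\mathrm{FO}(\mathcal Q_{\mathcal K})$ is obtained by closing first-order logic under the additional rule that for every $\mathrm{FO}(\mathcal Q_{\mathcal K})[\sigma,\tau]$-interpretation $I(\vec z)$, $\mathcal Q_{\mathcal K}I(\vec z)$ is a formula, with $(\mathfrak A,\vec a)\models \mathcal Q_{\mathcal K}I(\vec z)$ iff $I(\mathfrak A,\vec a)$ is defined and belongs to $\mathcal K$. $\mathrm{FO}(k\text{ - }\mathrm{Res})$ is this extension for $\mathcal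 K = k\text{ - }\mathrm{Res}$. -}

module Defs where

open import Data.Bool.Base using (Bool; true; false; T)
open import Data.Empty using (⊥)
open import Data.Fin.Base using (Fin; zero; suc)
open import Data.Fin.Subset using (Subset; _∈_; _∪_; _-_; ∣_∣) renaming (⊥ to ∅)
open import Data.List.Base as List using (List; []; _∷_)
open import Data.Nat.Base using (ℕ; suc; _+_; _*_; _≤_; NonZero)
open import Data.Product.Base using (Σ-syntax; ∃-syntax; _×_; _,_; proj₁)
open import Data.Sign.Base using (Sign; opposite) renaming (+ to pos; - to neg)
open import Data.Sum.Base using (_⊎_; inj₁; inj₂)
open import Data.Unit.Base using (⊤)
open import Data.Vec.Base using (Vec; []; _∷_; _++_; concat; lookup; map)
open import Data.Vec.Relation.Binary.Pointwise.Inductive using (Pointwise)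
open import Function.Bundles using (_⇔_; _↔_; Inverse)
open import Function.Definitions using (Congruent; Bijective)
open import Level using (Level; 0ℓ)
open import Relation.Binary.Core using (Rel)
open import Relation.Binary.PropositionalEquality.Core using (_≡_)
open import Relation.Binary.Structures using (IsEquivalence)
open import Relation.Nullary.Negation.Core using (¬_)
open import Relation.Unary using (Pred)

private
  variable
    p : Level
    n r ℓ : ℕ
    s : Sign

-- A finite relational vocabulary is given by the list of the arities of its
-- relation symbols; the symbols themselves are the positions in the list.

Vocabulary : Set
Vocabulary = List ℕ

private
  variable
    σ τ Γ : Vocabulary

Symbol : Vocabulary → Set
Symbol σ = Fin (List.length σ)

arity : (σ : Vocabulary) → Symbol σ → ℕ
arity = List.lookup

Relations : Vocabulary → Set → Set
Relations σ U = (R : Symbol σ) → Vec U (arity σ R) → Bool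

-- As usual in finite model theory, universes are nonempty.  Up to isomorphism
-- every finite structure has universe {0, …, size - 1}.

record Structure (σ : Vocabulary) : Set where
  field
    size        : ℕ
    .{{nonZero}} : NonZero size
    rel         : Relations σ (Fin size)

open Structure public using (size; rel)

∣_∣ₛ : Structure σ → Set
∣ A ∣ₛ = Fin (size A)

Class : (σ : Vocabulary) (p : Level) → Set (Level.suc p)
Class σ p = Pred (Structure σ) p

-- Variables are de Bruijn indices: the first-order variables of a formula with
-- n free variables are the elements of Fin n, and a tuple of values for them is
-- a vector of length n.  A quantifier binds variable 0; a binder of a tuple of
-- length r binds the variables 0, …, r - 1.

values : {U : Set} → Vec U n → Vec (Fin n) r → Vec U r
values v xs = map (lookup v) xs

-- The least fixed point of a monotone operator F on r-ary relations, as the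
-- intersection of all relations X with F(X) ⊆ X.

lfpOf : {U : Set} → ((Vec U r → Bool) → Vec U r → Set) → Vec U r → Set
lfpOf F a = ∀ X → (∀ x → F X x → T (X x)) → T (X a)

-- Γ lists the arities of the free fixed-point variables.  These occur only
-- positively, and negation is applied to input atoms and equalities only.  That
-- every fixed-point variable is bound once is automatic without names.

data PosLFP (σ : Vocabulary) (Γ : List ℕ) (n : ℕ) : Set where
  atom  : (R : Symbol σ) → Vec (Fin n) (arity σ R) → PosLFP σ Γ n
  ¬atom : (R : Symbol σ) → Vec (Fin n) (arity σ R) → PosLFP σ Γ n
  _≐_   : Fin n → Fin n → PosLFP σ Γ n
  _≐̸_   : Fin n → Fin n → PosLFP σ Γ n
  fpvar : (X : Symbol Γ) → Vec (Fin n) (arity Γ X) → PosLFP σ Γ n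
  _∧_   : PosLFP σ Γ n → PosLFP σ Γ n → PosLFP σ Γ n
  _∨_   : PosLFP σ Γ n → PosLFP σ Γ n → PosLFP σ Γ n
  ∃∙_   : PosLFP σ Γ (suc n) → PosLFP σ Γ n
  ∀∙_   : PosLFP σ Γ (suc n) → PosLFP σ Γ n
  lfp   : (r : ℕ) → PosLFP σ (r ∷ Γ) (r + n) → Vec (Fin n) r → PosLFP σ Γ n

Existential : PosLFP σ Γ n → Set
Existential (atom R xs)  = ⊤
Existential (¬atom R xs) = ⊤
Existential (x ≐ y)      = ⊤
Existential (x ≐̸ y)      = ⊤
Existential (fpvar X xs) = ⊤
Existential (φ ∧ ψ)      = Existential φ × Existential ψ
Existential (φ ∨ ψ)      = Existential φ × Existential ψ
Existential (∃∙ φ)       = Existential φ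
Existential (∀∙ φ)       = ⊥
Existential (lfp r φ xs) = Existential φ

extend : {U : Set} → (Vec U r → Bool) → Relations Γ U → Relations (r ∷ Γ) U
extend X ρ zero    = X
extend X ρ (suc Y) = ρ Y

satLFP : (A : Structure σ) → PosLFP σ Γ n → Relations Γ ∣ A ∣ₛ → Vec ∣ A ∣ₛ n → Set
satLFP A (atom R xs)  ρ v = T (rel A R (values v xs))
satLFP A (¬atom R xs) ρ v = ¬ T (rel A R (values v xs))
satLFP A (x ≐ y)      ρ v = lookup v x ≡ lookup v y
satLFP A (x ≐̸ y)      ρ v = ¬ (lookup v x ≡ lookup v y)
satLFP A (fpvar X xs) ρ v = T (ρ X (values v xs))
satLFP A (φ ∧ ψ)      ρ v = satLFP A φ ρ v × satLFP A ψ ρ v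
satLFP A (φ ∨ ψ)      ρ v = satLFP A φ ρ v ⊎ satLFP A ψ ρ v
satLFP A (∃∙ φ)       ρ v = ∃[ a ] satLFP A φ ρ (a ∷ v)
satLFP A (∀∙ φ)       ρ v = ∀ a → satLFP A φ ρ (a ∷ v)
satLFP A (lfp r φ xs) ρ v =
  lfpOf (λ X a → satLFP A φ (extend X ρ) (a ++ v)) (values v xs)

-- Quantifier-free formulas over the input vocabulary σ, additional relations τ
-- and one r-ary recursion variable.  The sign is the polarity at which the
-- formula is used; in a formula of sign pos, the recursion variable occurs only
-- under an even number of negations.

data QF (σ τ : Vocabulary) (r : ℕ) (n : ℕ) : Sign → Set where
  atom : (R : Symbol σ) → Vec (Fin n) (arity σ R) → QF σ τ r n s
  _≐_  : Fin n → Fin n → QF σ τ r n s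
  add  : (S : Symbol τ) → Vec (Fin n) (arity τ S) → QF σ τ r n s
  rec  : Vec (Fin n) r → QF σ τ r n pos
  ¬∙_  : QF σ τ r n (opposite s) → QF σ τ r n s
  _∧_  : QF σ τ r n s → QF σ τ r n s → QF σ τ r n s
  _∨_  : QF σ τ r n s → QF σ τ r n s → QF σ τ r n s

satQF : (A : Structure σ) → QF σ τ r n s →
        ((S : Symbol τ) → Vec ∣ A ∣ₛ (arity τ S) → Set) →
        (Vec ∣ A ∣ₛ r → Bool) → Vec ∣ A ∣ₛ n → Set
satQF A (atom R xs) I X v = T (rel A R (values v xs))
satQF A (x ≐ y)     I X v = lookup v x ≡ lookup v y
satQF A (add S xs)  I X v = I S (values v xs)
satQF A (rec xs)    I X v = T (X (values v xs))
satQF A (¬∙ φ)      I X v = ¬ satQF A φ I X v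
satQF A (φ ∧ ψ)     I X v = satQF A φ I X v × satQF A ψ I X v
satQF A (φ ∨ ψ)     I X v = satQF A φ I X v ⊎ satQF A ψ I X v

-- EFP σ ℓ n: the formulas of the stratum ℓ with n free first-order variables.
-- In  lfp r m τ φ ψ xs  the tuple x̄ has length r, the tuple ȳ length m, and ψ S
-- is the formula of the previous stratum substituted for S in φ(R, x̄, ȳ).  The
-- fixed-point formula has no variables besides x̄, and these are instantiated by
-- the variables xs of the context.

data EFP (σ : Vocabulary) : ℕ → ℕ → Set where
  base : (φ : PosLFP σ [] n) → Existential φ → EFP σ 0 n
  _∧_  : EFP σ (suc ℓ) n → EFP σ (suc ℓ) n → EFP σ (suc ℓ) n
  _∨_  : EFP σ (suc ℓ) n → EFP σ (suc ℓ) n → EFP σ (suc ℓ) n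
  ∃∙_  : EFP σ (suc ℓ) (suc n) → EFP σ (suc ℓ) n
  lfp  : (r m : ℕ) (τ : Vocabulary) → QF σ τ r (r + m) pos →
         ((S : Symbol τ) → EFP σ ℓ (arity τ S)) →
         Vec (Fin n) r → EFP σ (suc ℓ) n

satEFP : (A : Structure σ) → EFP σ ℓ n → Vec ∣ A ∣ₛ n → Set
satEFP A (base φ _) v = satLFP A φ (λ ()) v
satEFP A (φ ∧ ψ)    v = satEFP A φ v × satEFP A ψ v
satEFP A (φ ∨ ψ)    v = satEFP A φ v ⊎ satEFP A ψ v
satEFP A (∃∙ φ)     v = ∃[ a ] satEFP A φ (a ∷ v)
satEFP A (lfp r m τ φ ψ xs) v =
  lfpOf (λ X a → Σ[ b ∈ Vec ∣ A ∣ₛ m ] satQF A φ (λ S → satEFP A (ψ S)) X (a ++ b))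
        (values v xs)

EFP-Definable : Class σ p → Set p
EFP-Definable {σ} 𝒞 =
  ∃[ ℓ ] Σ[ φ ∈ EFP σ ℓ 0 ] (∀ A → 𝒞 A ⇔ satEFP A φ [])

-- L n is the set of formulas of the logic L[σ] with n free variables.  The
-- parameters are the last n variables of each formula.

record Interpretation (L : ℕ → Set) (τ : Vocabulary) (n : ℕ) : Set where
  inductive
  no-eta-equality
  pattern
  constructor interpretation
  field
    dim : ℕ
    δ   : L (dim + n)
    ≈   : L (dim + (dim + n))
    φ   : (S : Symbol τ) → L (arity τ S * dim + n)

-- A τ-structure 𝔅 with a binary relation on its universe, as defined by an
-- interpretation before the quotient is taken.

record PreStructure (τ : Vocabulary) : Set₁ where
  field
    Carrier : Set
    _∼_     : Rel Carrier 0ℓ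
    holds   : (S : Symbol τ) → Vec Carrier (arity τ S) → Set

record IsCongruence (B : PreStructure τ) : Set where
  open PreStructure B
  field
    isEquivalence : IsEquivalence _∼_
    compatible    : ∀ S {us vs} → Pointwise _∼_ us vs → holds S us → holds S vs

-- 𝔅/∼ is isomorphic to D.  The isomorphism is a bijection from the setoid
-- (Carrier , ∼) to the universe of D.

record QuotientIso (B : PreStructure τ) (D : Structure τ) : Set where
  open PreStructure B
  field
    to        : Carrier → ∣ D ∣ₛ
    cong      : Congruent _∼_ _≡_ to
    bijective : Bijective _∼_ _≡_ to
    preserves : ∀ S us → holds S us ⇔ T (rel D S (map to us))

QuotientIn : Pred (Structure τ) 0ℓ → PreStructure τ → Set
QuotientIn 𝒦 B = IsCongruence B × ∃[ D ] (QuotientIso B D × 𝒦 D)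

-- The syntax of FO(𝒬_𝒦) depends only on the vocabulary τ of 𝒦.

data FOQ (τ σ : Vocabulary) (n : ℕ) : Set where
  atom : (R : Symbol σ) → Vec (Fin n) (arity σ R) → FOQ τ σ n
  _≐_  : Fin n → Fin n → FOQ τ σ n
  ¬∙_  : FOQ τ σ n → FOQ τ σ n
  _∧_  : FOQ τ σ n → FOQ τ σ n → FOQ τ σ n
  _∨_  : FOQ τ σ n → FOQ τ σ n → FOQ τ σ n
  ∃∙_  : FOQ τ σ (suc n) → FOQ τ σ n
  ∀∙_  : FOQ τ σ (suc n) → FOQ τ σ n
  𝒬    : Interpretation (FOQ τ σ) τ n → FOQ τ σ n

satFOQ : Pred (Structure τ) 0ℓ → (A : Structure σ) → FOQ τ σ n → Vec ∣ A ∣ₛ n → Set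
satFOQ 𝒦 A (atom R xs) v = T (rel A R (values v xs))
satFOQ 𝒦 A (x ≐ y)     v = lookup v x ≡ lookup v y
satFOQ 𝒦 A (¬∙ φ)      v = ¬ satFOQ 𝒦 A φ v
satFOQ 𝒦 A (φ ∧ ψ)     v = satFOQ 𝒦 A φ v × satFOQ 𝒦 A ψ v
satFOQ 𝒦 A (φ ∨ ψ)     v = satFOQ 𝒦 A φ v ⊎ satFOQ 𝒦 A ψ v
satFOQ 𝒦 A (∃∙ φ)      v = ∃[ a ] satFOQ 𝒦 A φ (a ∷ v)
satFOQ 𝒦 A (∀∙ φ)      v = ∀ a → satFOQ 𝒦 A φ (a ∷ v)
satFOQ 𝒦 A (𝒬 (interpretation d δ ≈ φ)) v = QuotientIn 𝒦 record
  { Carrier = Σ[ b ∈ Vec ∣ A ∣ₛ d ] satFOQ 𝒦 A δ (b ++ v)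
  ; _∼_     = λ (b , _) (b′ , _) → satFOQ 𝒦 A ≈ (b ++ (b′ ++ v))
  ; holds   = λ S bs → satFOQ 𝒦 A (φ S) (concat (map proj₁ bs) ++ v)
  }

FOQ-Definable : Pred (Structure τ) 0ℓ → Class σ p → Set p
FOQ-Definable {τ} {σ} 𝒦 𝒞 =
  Σ[ φ ∈ FOQ τ σ 0 ] (∀ A → 𝒞 A ⇔ satFOQ 𝒦 A φ [])

-- A clause is a set of literals, given by the set of the variables occurring
-- positively and the set of the variables occurring negatively.

record Clause (vars : ℕ) : Set where
  constructor clause
  field
    positive negative : Subset vars

open Clause public

width : ∀ {vars} → Clause vars → ℕ
width c = ∣ positive c ∣ + ∣ negative c ∣

□ : ∀ {vars} → Clause vars
□ = clause ∅ ∅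

-- (c ∖ {x}) ∪ (d ∖ {¬x})

resolvent : ∀ {vars} → Fin vars → Clause vars → Clause vars → Clause vars
resolvent x c d = clause ((positive c - x) ∪ positive d)
                         (negative c ∪ (negative d - x))

record CNF : Set where
  field
    #vars    : ℕ
    #clauses : ℕ
    clauseAt : Fin #clauses → Clause #vars

open CNF public

-- Derivable k ψ c: the clause c has a resolution derivation from ψ in which all
-- clauses have size at most k.

data Derivable (k : ℕ) (ψ : CNF) : Clause (#vars ψ) → Set where
  axiom   : ∀ i → width (clauseAt ψ i) ≤ k → Derivable k ψ (clauseAt ψ i)
  resolve : ∀ {c d} x → x ∈ positive c → x ∈ negative d →
            Derivable k ψ c → Derivable k ψ d →
            width (resolvent x c d) ≤ k → Derivable k ψ (resolvent x c d)

CNFVoc : Vocabulary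
CNFVoc = 1 ∷ 1 ∷ 2 ∷ 2 ∷ []

pattern C = zero
pattern V = suc zero
pattern P = suc (suc zero)
pattern N = suc (suc (suc zero))

encoding : (ψ : CNF) → Relations CNFVoc (Fin (#clauses ψ) ⊎ Fin (#vars ψ))
encoding ψ C (inj₁ c ∷ [])          = true
encoding ψ C (inj₂ v ∷ [])          = false
encoding ψ V (inj₁ c ∷ [])          = false
encoding ψ V (inj₂ v ∷ [])          = true
encoding ψ P (inj₂ v ∷ inj₁ c ∷ []) = lookup (positive (clauseAt ψ c)) v
encoding ψ P (_ ∷ _ ∷ [])           = false
encoding ψ N (inj₂ v ∷ inj₁ c ∷ []) = lookup (negative (clauseAt ψ c)) v
encoding ψ N (_ ∷ _ ∷ [])           = false

record Encodes (D : Structure CNFVoc) (ψ : CNF) : Set where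
  field
    universe  : (Fin (#clauses ψ) ⊎ Fin (#vars ψ)) ↔ ∣ D ∣ₛ
    relations : ∀ R es → rel D R (map (Inverse.to universe) es) ≡ encoding ψ R es

_-Res : ℕ → Pred (Structure CNFVoc) 0ℓ
(k -Res) D = ∃[ ψ ] (Encodes D ψ × Derivable k ψ □)

{-# OPTIONS --safe #-}

-- Both logics have the power of first-order logic with Horn closures, the closures
-- of definable sets under definable rules x ← y , z.  The classes of the queries
-- definable in either logic are closed under this operation, and every class with
-- such closure properties contains the queries of both logics.
--
-- In EFP negation costs a stratum and a Horn closure is a single fixed point.  In
-- FO(k-Res) a Horn closure is the refutation, by unit resolution, of a Horn formula
-- with clauses of size at most 3, which needs two elements to tell variables from
-- clauses; over one element the closure consists of the facts only.
--
-- Conversely, k-Res on an interpreted structure is a Horn closure because a clause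
-- of size at most k is a tuple of bounded length.  A formula of EFP with nested fixed
-- points becomes a Horn closure on nodes that record a state and an assignment, the
-- recursive calls being further rules.
module Submission where

open import Defs
open import Data.Bool.Base using (Bool; true; false; T)
open import Data.Bool.Properties using (T?)
open import Data.Empty using (⊥; ⊥-elim)
open import Data.Fin.Base as Fin using (Fin; zero; suc; _↑ˡ_; _↑ʳ_)
import Data.Fin.Properties as Fin
open import Data.Fin.Subset using (Subset; _∈_; _∪_; _─_; _-_; ⁅_⁆; ∣_∣) renaming (⊥ to ∅)
open import Data.Fin.Subset.Properties
open import Data.List.Base as List using (List; []; _∷_)
import Data.List.Properties as List
open import Data.List.Membership.Propositional using (find; lose) renaming (_∈_ to _∈ˡ_)
open import Data.List.Membership.Propositional.Properties
  using (∈-allFin; ∈-∃++; ∈-++⁺ˡ; ∈-++⁺ʳ; ∈-++⁻; ∈-cartesianProductWith⁺; ∈-cartesianProduct⁺)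
open import Data.List.Relation.Unary.Any as Any using (Any; here; there)
open import Data.Nat.Base as ℕ using (ℕ; zero; suc; _+_; _*_; _≤_; z≤n; s≤s; NonZero)
import Data.Nat.Properties as ℕ
open import Data.Product.Base using (Σ; Σ-syntax; ∃; ∃-syntax; _×_; _,_; proj₁; proj₂)
open import Data.Product.Function.NonDependent.Propositional using () renaming (_×-⇔_ to ×-⇔)
open import Data.Product.Properties using (≡-dec)
open import Data.Sign.Base using (Sign) renaming (+ to pos; - to neg)
open import Data.Sum.Base using (_⊎_; inj₁; inj₂)
open import Data.Sum.Function.Propositional using () renaming (_⊎-⇔_ to ⊎-⇔)
open import Data.Sum.Properties using (inj₁-injective; inj₂-injective)
open import Data.Unit.Base using (⊤; tt)
open import Data.Vec.Base using (Vec; []; _∷_; _++_; concat; lookup; map; replicate; take; drop; allFin; tabulate;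
         here; there)
import Data.Vec.Properties as Vec
open import Data.Vec.Relation.Binary.Pointwise.Inductive as Pointwise using (Pointwise; []; _∷_)
open import Function.Base using (_∘_; id; case_of_)
open import Function.Bundles using (_⇔_; mk⇔; Equivalence; Inverse; mk↔ₛ′)
open import Function.Construct.Composition using (_⇔-∘_)
open import Function.Construct.Identity using (⇔-id)
open import Function.Construct.Symmetry using (⇔-sym)
open import Function.Related.TypeIsomorphisms using () renaming (¬-cong-⇔ to ¬-⇔)
open import Level using (Level)
open import Relation.Binary.Definitions using (DecidableEquality)
open import Relation.Binary.PropositionalEquality
  using (_≡_; _≢_; refl; sym; trans; cong; cong₂; subst; module ≡-Reasoning)
open import Relation.Binary.Structures using (IsEquivalence)
open import Relation.Nullary.Decidable as Dec
  using (Dec; yes; no; ⌊_⌋; toWitness; fromWitness; _×-dec_; _⊎-dec_; ¬?)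
open import Relation.Nullary.Negation.Core using (¬_; contradiction)
open Equivalence using (to; from)

-- Rules with exactly two premises suit both sides: a resolvent has two parents, and the clause {x ,
-- ¬y , ¬z} of such a rule has three literals, which is where the bound on k comes from. One
-- obstacle is that the fixed points of stratum 0 nest freely, with first-order parameters and calls
-- of outer fixed-point variables, whereas the closure operation that both logics offer is a single
-- recursion without parameters. Another is that neither logic has constants: the kinds of nodes
-- must be told apart by the equality or inequality of two elements, and over one element this
-- fails, so that this case is carried along separately. Definability is a property of queries, not
-- of formulas. So both inclusions are inductions on the formulas of one logic inside an abstract
-- class of queries, and no syntax is translated into syntax by hand. Least fixed points range over
-- Boolean relations. To compare one with a closure, the closure has to be plugged in as such a
-- relation, and for this reason every definable query comes with a decision procedure.

private
  variable
    p : Level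
    k ℓ m n r : ℕ
    σ τ Γ : Vocabulary
    U W : Set

-- Equivalences, finite types and decidable search

⇔-refl : {X : Set} → X ⇔ X
⇔-refl = ⇔-id _

⇔-trans : {X : Set p} {Y Z : Set} → X ⇔ Y → Y ⇔ Z → X ⇔ Z
⇔-trans e f = f ⇔-∘ e

∃-⇔ : {X : Set} {Y Z : X → Set} → (∀ x → Y x ⇔ Z x) → ∃ Y ⇔ ∃ Z
∃-⇔ e = mk⇔ (λ (x , y) → x , to (e x) y) (λ (x , z) → x , from (e x) z)

≡⇒⇔ : {X Y : Set} → X ≡ Y → X ⇔ Y
≡⇒⇔ refl = ⇔-refl

record Finite (X : Set) : Set where
  field
    elements : List X
    complete : ∀ x → x ∈ˡ elements
    _≟_      : DecidableEquality X

abstract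

  ∃? : {X : Set} → Finite X → {Q : X → Set} → (∀ x → Dec (Q x)) → Dec (∃ Q)
  ∃? 𝒳 Q? with Any.any? Q? (Finite.elements 𝒳)
  ... | yes found = let x , _ , q = find found in yes (x , q)
  ... | no none   = no λ (x , q) → none (lose (Finite.complete 𝒳 x) q)

abstract

  Fin-finite : Finite (Fin n)
  Fin-finite = record { elements = List.allFin _ ; complete = ∈-allFin ; _≟_ = Fin._≟_ }

  ×-finite : {X Y : Set} → Finite X → Finite Y → Finite (X × Y)
  ×-finite 𝒳 𝒴 = record
    { elements = List.cartesianProduct 𝒳.elements 𝒴.elements
    ; complete = λ (x , y) → ∈-cartesianProduct⁺ (𝒳.complete x) (𝒴.complete y)
    ; _≟_      = ≡-dec 𝒳._≟_ 𝒴._≟_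
    }
    where
    module 𝒳 = Finite 𝒳
    module 𝒴 = Finite 𝒴

  Vec-finite : {X : Set} → Finite X → ∀ n → Finite (Vec X n)
  Vec-finite {X} 𝒳 n = record { elements = vecs n ; complete = vecs-complete ; _≟_ = Vec.≡-dec 𝒳._≟_ }
    where
    module 𝒳 = Finite 𝒳
    vecs : ∀ n → List (Vec X n)
    vecs zero    = [] ∷ []
    vecs (suc n) = List.cartesianProductWith _∷_ 𝒳.elements (vecs n)
    vecs-complete : ∀ {n} (xs : Vec X n) → xs ∈ˡ vecs n
    vecs-complete []       = here refl
    vecs-complete (x ∷ xs) = ∈-cartesianProductWith⁺ _∷_ (𝒳.complete x) (vecs-complete xs)

-- Saturation and Horn closures

module _ {X : Set} (𝒳 : Finite X) where
  open Finite 𝒳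

  -- Starting from the empty set, keep adding an element of F Y that has not been
  -- added before.
  saturate : (F : (X → Bool) → X → Set) → (∀ Y x → Dec (F Y x)) →
             (Q : X → Set) → (∀ Y → (∀ x → T (Y x) → Q x) → ∀ x → F Y x → Q x) →
             Σ[ Y ∈ (X → Bool) ] (∀ x → F Y x → T (Y x)) × (∀ x → T (Y x) → Q x)
  saturate F F? Q step =
    -- The list holds every element that has not been added, and its length `n` is the termination
    -- measure. When no element of it lies in `F Y`, the set `Y` is closed, since all other elements
    -- are in `Y` already.
    go (List.length elements) (λ _ → false) (λ _ ()) elements refl (inj₂ ∘ complete)
    where
    _∪ᵇ_ : (X → Bool) → X → X → Bool
    (Y ∪ᵇ x) y = ⌊ T? (Y y) ⊎-dec (y ≟ x) ⌋

    go : ∀ n Y → (∀ x → T (Y x) → Q x) → (L : List X) → List.length L ≡ n →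
         (∀ x → T (Y x) ⊎ x ∈ˡ L) →
         Σ[ Y ∈ (X → Bool) ] (∀ x → F Y x → T (Y x)) × (∀ x → T (Y x) → Q x)
    go n Y Y⊆Q L len cover with Any.any? (F? Y) L
    ... | no none = Y , closed , Y⊆Q
      where
      closed : ∀ x → F Y x → T (Y x)
      closed x f with cover x
      ... | inj₁ x∈Y = x∈Y
      ... | inj₂ x∈L = contradiction (lose x∈L f) none
    ... | yes found with find found
    ... | x , x∈L , f with ∈-∃++ x∈L
    go zero Y Y⊆Q _ len cover | yes _ | x , _ , f | [] , zs , refl = contradiction len λ ()
    go zero Y Y⊆Q _ len cover | yes _ | x , _ , f | _ ∷ _ , zs , refl = contradiction len λ ()
    go (suc n) Y Y⊆Q _ len cover | yes _ | x , _ , f | ys , zs , refl =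
      go n (Y ∪ᵇ x) Y∪x⊆Q (ys List.++ zs) shorter cover′
      where
      Y∪x⊆Q : ∀ y → T ((Y ∪ᵇ x) y) → Q y
      Y∪x⊆Q y t with toWitness t
      ... | inj₁ y∈Y  = Y⊆Q y y∈Y
      ... | inj₂ refl = step Y Y⊆Q x f

      shorter : List.length (ys List.++ zs) ≡ n
      shorter = ℕ.suc-injective (begin
        suc (List.length (ys List.++ zs))           ≡⟨ cong suc (List.length-++ ys) ⟩
        suc (List.length ys + List.length zs)       ≡⟨ ℕ.+-suc _ _ ⟨
        List.length ys + List.length (x ∷ zs)       ≡⟨ List.length-++ ys ⟨
        List.length (ys List.++ x ∷ zs)             ≡⟨ len ⟩
        suc n                                       ∎)
        where open ≡-Reasoning

      cover′ : ∀ y → T ((Y ∪ᵇ x) y) ⊎ y ∈ˡ ys List.++ zs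
      cover′ y with cover y
      ... | inj₁ y∈Y = inj₁ (fromWitness (inj₁ y∈Y))
      ... | inj₂ y∈L with ∈-++⁻ ys y∈L
      ... | inj₁ y∈ys         = inj₂ (∈-++⁺ˡ y∈ys)
      ... | inj₂ (here y≡x)   = inj₁ (fromWitness (inj₂ y≡x))
      ... | inj₂ (there y∈zs) = inj₂ (∈-++⁺ʳ ys y∈zs)

-- R x y z is the Horn rule x ← y , z.
data Horn {X : Set} (F : X → Set) (R : X → X → X → Set) : X → Set where
  fact : ∀ {x} → F x → Horn F R x
  rule : ∀ {x y z} → R x y z → Horn F R y → Horn F R z → Horn F R x

module _ {X Y : Set} {F : X → Set} {R : X → X → X → Set} {G : Y → Set} {S : Y → Y → Y → Set} where

  Horn-map : (f : X → Y) → (∀ x → F x → G (f x)) → (∀ x y z → R x y z → S (f x) (f y) (f z)) →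
             ∀ {x} → Horn F R x → Horn G S (f x)
  Horn-map f f-fact f-rule (fact t)     = fact (f-fact _ t)
  Horn-map f f-fact f-rule (rule t p q) =
    rule (f-rule _ _ _ t) (Horn-map f f-fact f-rule p) (Horn-map f f-fact f-rule q)

module _ {X : Set} (𝒳 : Finite X) {F : X → Set} {R : X → X → X → Set}
         (F? : ∀ x → Dec (F x)) (R? : ∀ x y z → Dec (R x y z)) where

  abstract
    -- Saturation bounded by the closure itself: every element added comes with a derivation, and
    -- the saturated set is closed under the rules, so it is exactly the closure.
    Horn? : ∀ x → Dec (Horn F R x)
    Horn? x with saturate 𝒳 (λ Y x → F x ⊎ ∃[ y ] ∃[ z ] (R x y z × T (Y y) × T (Y z)))
                   (λ Y x → F? x ⊎-dec ∃? 𝒳 λ y → ∃? 𝒳 λ z → R? x y z ×-dec T? (Y y) ×-dec T? (Y z))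
                   (Horn F R)
                   (λ { Y Y⊆H x (inj₁ t) → fact t
                      ; Y Y⊆H x (inj₂ (y , z , t , y∈Y , z∈Y)) → rule t (Y⊆H y y∈Y) (Y⊆H z z∈Y) })
    ... | Y , closed , Y⊆H = Dec.map′ (Y⊆H x) H⊆Y (T? (Y x))
      where
      H⊆Y : ∀ {x} → Horn F R x → T (Y x)
      H⊆Y (fact t)     = closed _ (inj₁ t)
      H⊆Y (rule t p q) = closed _ (inj₂ (_ , _ , t , H⊆Y p , H⊆Y q))

-- Tuples, and structures with one element

point : (A : Structure σ) → ∣ A ∣ₛ
point record { size = n ; nonZero = n≢0 } = go n {{n≢0}}
  where
  go : ∀ n → .{{NonZero n}} → Fin n
  go (suc n) = zero

lookup-extensional : (xs ys : Vec U n) → (∀ i → lookup xs i ≡ lookup ys i) → xs ≡ ys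
lookup-extensional []       []       eq = refl
lookup-extensional (x ∷ xs) (y ∷ ys) eq =
  cong₂ _∷_ (eq zero) (lookup-extensional xs ys (eq ∘ suc))

take-++ : (xs : Vec U m) (ys : Vec U n) → take m (xs ++ ys) ≡ xs
take-++ []       ys = refl
take-++ (x ∷ xs) ys = cong (x ∷_) (take-++ xs ys)

drop-++ : (xs : Vec U m) (ys : Vec U n) → drop m (xs ++ ys) ≡ ys
drop-++ []       ys = refl
drop-++ (x ∷ xs) ys = drop-++ xs ys

values-natural : (xs : Vec (Fin n) m) {U W : Set} (g : U → W) (v : Vec U n) →
                 values (map g v) xs ≡ map g (values v xs)
values-natural xs g v =
  trans (Vec.map-cong (λ i → Vec.lookup-map i g v) xs) (Vec.map-∘ g (lookup v) xs)

-- The two elements are wrapped as tuples of length 1, so that they form a value of the shape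
-- `vec 1 ⊗ vec 1` and can serve directly as a flag in a node.
Many : Structure σ → Set
Many A = Σ[ (a , b) ∈ Vec ∣ A ∣ₛ 1 × Vec ∣ A ∣ₛ 1 ] a ≢ b

one-unique : (A : Structure σ) → ¬ Many A → (x y : Vec ∣ A ∣ₛ n) → x ≡ y
one-unique A one []      []      = refl
one-unique A one (a ∷ x) (b ∷ y) with a Fin.≟ b
... | yes refl = cong (a ∷_) (one-unique A one x y)
... | no a≢b   = contradiction ((a ∷ [] , b ∷ []) , λ { refl → a≢b refl }) one

-- Contexts in blocks

-- Contexts structured into blocks, which replace calculations with de Bruijn
-- indices by functions that are natural in the universe.
infixr 5 _⊗_
infix  6 _^_

data Shape : Set where
  vec : ℕ → Shape
  _⊗_ : Shape → Shape → Shape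
  _^_ : Shape → ℕ → Shape

private
  variable
    s t u : Shape

∥_∥ : Shape → ℕ
∥ vec n ∥ = n
∥ s ⊗ t ∥ = ∥ s ∥ + ∥ t ∥
∥ s ^ k ∥ = k * ∥ s ∥

⟦_⟧ : Shape → Set → Set
⟦ vec n ⟧ U = Vec U n
⟦ s ⊗ t ⟧ U = ⟦ s ⟧ U × ⟦ t ⟧ U
⟦ s ^ k ⟧ U = Vec (⟦ s ⟧ U) k

abstract
  ⟦⟧-finite : Finite U → ∀ s → Finite (⟦ s ⟧ U)
  ⟦⟧-finite 𝒰 (vec n) = Vec-finite 𝒰 n
  ⟦⟧-finite 𝒰 (s ⊗ t) = ×-finite (⟦⟧-finite 𝒰 s) (⟦⟧-finite 𝒰 t)
  ⟦⟧-finite 𝒰 (s ^ k) = Vec-finite (⟦⟧-finite 𝒰 s) k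

smap : ∀ s → (U → W) → ⟦ s ⟧ U → ⟦ s ⟧ W
smap (vec n) g xs      = map g xs
smap (s ⊗ t) g (x , y) = smap s g x , smap t g y
smap (s ^ k) g xs      = map (smap s g) xs

flatten : ∀ s → ⟦ s ⟧ U → Vec U ∥ s ∥
flatten (vec n) xs      = xs
flatten (s ⊗ t) (x , y) = flatten s x ++ flatten t y
flatten (s ^ k) xs      = concat (map (flatten s) xs)

unflatten : ∀ s → Vec U ∥ s ∥ → ⟦ s ⟧ U
unflatten (vec n)     v = v
unflatten (s ⊗ t)     v = unflatten s (take ∥ s ∥ v) , unflatten t (drop ∥ s ∥ v)
unflatten (s ^ zero)  v = []
unflatten (s ^ suc k) v = unflatten s (take ∥ s ∥ v) ∷ unflatten (s ^ k) (drop ∥ s ∥ v)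

unflatten-flatten : ∀ s (x : ⟦ s ⟧ U) → unflatten s (flatten s x) ≡ x
unflatten-flatten (vec n) xs = refl
unflatten-flatten (s ⊗ t) (x , y) = cong₂ _,_
  (trans (cong (unflatten s) (take-++ (flatten s x) _)) (unflatten-flatten s x))
  (trans (cong (unflatten t) (drop-++ (flatten s x) _)) (unflatten-flatten t y))
unflatten-flatten (s ^ zero)  []       = refl
unflatten-flatten (s ^ suc k) (x ∷ xs) = cong₂ _∷_
  (trans (cong (unflatten s) (take-++ (flatten s x) _)) (unflatten-flatten s x))
  (trans (cong (unflatten (s ^ k)) (drop-++ (flatten s x) _)) (unflatten-flatten (s ^ k) xs))

flatten-unflatten : ∀ s (v : Vec U ∥ s ∥) → flatten s (unflatten s v) ≡ v
flatten-unflatten (vec n)     v  = refl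
flatten-unflatten (s ⊗ t)     v  = trans
  (cong₂ _++_ (flatten-unflatten s _) (flatten-unflatten t _)) (Vec.take++drop≡id ∥ s ∥ v)
flatten-unflatten (s ^ zero)  [] = refl
flatten-unflatten (s ^ suc k) v  = trans
  (cong₂ _++_ (flatten-unflatten s _) (flatten-unflatten (s ^ k) _)) (Vec.take++drop≡id ∥ s ∥ v)

map-flatten : ∀ s (g : U → W) x → map g (flatten s x) ≡ flatten s (smap s g x)
map-flatten (vec n) g xs = refl
map-flatten (s ⊗ t) g (x , y) =
  trans (Vec.map-++ g (flatten s x) (flatten t y)) (cong₂ _++_ (map-flatten s g x) (map-flatten t g y))
map-flatten (s ^ zero)  g []       = refl
map-flatten (s ^ suc k) g (x ∷ xs) =
  trans (Vec.map-++ g (flatten s x) _) (cong₂ _++_ (map-flatten s g x) (map-flatten (s ^ k) g xs))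

smap-unflatten : ∀ s (g : U → W) v → smap s g (unflatten s v) ≡ unflatten s (map g v)
smap-unflatten s g v = begin
  smap s g (unflatten s v)                           ≡⟨ unflatten-flatten s _ ⟨
  unflatten s (flatten s (smap s g (unflatten s v))) ≡⟨ cong (unflatten s) (map-flatten s g _) ⟨
  unflatten s (map g (flatten s (unflatten s v)))    ≡⟨ cong (unflatten s ∘ map g) (flatten-unflatten s v) ⟩
  unflatten s (map g v)                              ∎
  where open ≡-Reasoning

-- Classes of definable queries and their closure properties

Query : Vocabulary → ℕ → Set₁
Query σ n = (A : Structure σ) → Vec ∣ A ∣ₛ n → Set

SQuery : Vocabulary → Shape → Set₁
SQuery σ s = (A : Structure σ) → ⟦ s ⟧ ∣ A ∣ₛ → Set

-- Universal quantification and implication are derived from the remaining operations, classically,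
-- with the help of `dec`. Equality is asked for on two fixed variables, and `values-def`, the
-- substitution of variables, gives all other instances.
record FOLogic (σ : Vocabulary) : Set₁ where
  field
    Def : Query σ n → Set
    dec  : {Q : Query σ n} → Def Q → ∀ A v → Dec (Q A v)
    resp : {Q Q′ : Query σ n} → (∀ A v → Q A v ⇔ Q′ A v) → Def Q → Def Q′
    atom-def : ∀ R → Def (λ A v → T (rel A R v))
    ≡-def : Def {2} (λ A v → lookup v zero ≡ lookup v (suc zero))
    values-def : {Q : Query σ n} (xs : Vec (Fin m) n) → Def Q → Def (λ A v → Q A (values v xs))
    ¬-def : {Q : Query σ n} → Def Q → Def (λ A v → ¬ Q A v)
    ×-def : {Q Q′ : Query σ n} → Def Q → Def Q′ → Def (λ A v → Q A v × Q′ A v)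
    ⊎-def : {Q Q′ : Query σ n} → Def Q → Def Q′ → Def (λ A v → Q A v ⊎ Q′ A v)
    ∃-def : {Q : Query σ (suc n)} → Def Q → Def (λ A v → ∃[ a ] Q A (a ∷ v))

  ∃-vec-def : ∀ d {Q : Query σ (d + n)} → Def Q →
              Def (λ A v → Σ[ b ∈ Vec ∣ A ∣ₛ d ] Q A (b ++ v))
  ∃-vec-def zero q = resp (λ A v → mk⇔ ([] ,_) λ { ([] , h) → h }) q
  ∃-vec-def (suc d) q = resp
    (λ A v → mk⇔ (λ (b , a , h) → a ∷ b , h) λ { (a ∷ b , h) → b , a , h })
    (∃-vec-def d (∃-def q))

  record DefS (s : Shape) (Q : SQuery σ s) : Set where
    pattern
    constructor shaped
    field unshaped : Def (λ A v → Q A (unflatten s v))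
  open DefS public

  vecS : {Q : Query σ n} → Def Q → DefS (vec n) Q
  vecS = shaped

  respS : {Q Q′ : SQuery σ s} → (∀ A x → Q A x ⇔ Q′ A x) → DefS s Q → DefS s Q′
  respS e (shaped q) = shaped (resp (λ A v → e A _) q)

  flatS : {Q : Query σ ∥ s ∥} → Def Q → DefS s (λ A x → Q A (flatten s x))
  flatS {s = s} {Q} q = shaped (resp (λ A v → ≡⇒⇔ (cong (Q A) (sym (flatten-unflatten s v)))) q)

  abstract
    decS : {Q : SQuery σ s} → DefS s Q → ∀ A x → Dec (Q A x)
    decS {s} {Q} (shaped q) A x = subst (Dec ∘ Q A) (unflatten-flatten s x) (dec q A (flatten s x))

  -- A map that is natural in the universe can only select positions. Its value at the tuple of all
  -- variables is therefore the list `xs` of variables to substitute, and naturality along the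
  -- assignment `lookup v` shows that the substitution computes `f` everywhere.
  renS : {Q : SQuery σ t} (f : ∀ {U} → ⟦ s ⟧ U → ⟦ t ⟧ U) → (∀ {U W} (g : U → W) x → f (smap s g x) ≡ smap t g (f x)) →
         DefS t Q → DefS s (λ A x → Q A (f x))
  renS {t = t} {s = s} {Q = Q} f natural (shaped q) =
    shaped (resp (λ A v → ≡⇒⇔ (cong (Q A) (eq v))) (values-def xs q))
    where
    open ≡-Reasoning
    xs : Vec (Fin ∥ s ∥) ∥ t ∥
    xs = flatten t (f (unflatten s (allFin _)))
    eq : (v : Vec U ∥ s ∥) → unflatten t (values v xs) ≡ f (unflatten s v)
    eq v = begin
      unflatten t (map (lookup v) xs)
        ≡⟨ cong (unflatten t) (map-flatten t (lookup v) _) ⟩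
      unflatten t (flatten t (smap t (lookup v) (f (unflatten s (allFin _)))))
        ≡⟨ unflatten-flatten t _ ⟩
      smap t (lookup v) (f (unflatten s (allFin _)))
        ≡⟨ natural (lookup v) _ ⟨
      f (smap s (lookup v) (unflatten s (allFin _)))
        ≡⟨ cong f (smap-unflatten s (lookup v) _) ⟩
      f (unflatten s (map (lookup v) (allFin _)))
        ≡⟨ cong (f ∘ unflatten s) (Vec.map-lookup-allFin v) ⟩
      f (unflatten s v) ∎

  ¬S : {Q : SQuery σ s} → DefS s Q → DefS s (λ A x → ¬ Q A x)
  ¬S (shaped q) = shaped (¬-def q)

  infixr 3 _×S_
  infixr 2 _⊎S_ _→S_

  _×S_ : {Q Q′ : SQuery σ s} → DefS s Q → DefS s Q′ → DefS s (λ A x → Q A x × Q′ A x)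
  shaped q ×S shaped q′ = shaped (×-def q q′)

  _⊎S_ : {Q Q′ : SQuery σ s} → DefS s Q → DefS s Q′ → DefS s (λ A x → Q A x ⊎ Q′ A x)
  shaped q ⊎S shaped q′ = shaped (⊎-def q q′)

  _→S_ : {Q Q′ : SQuery σ s} → DefS s Q → DefS s Q′ → DefS s (λ A x → Q A x → Q′ A x)
  q →S q′ = respS
    (λ A x → mk⇔ (λ { (inj₁ ¬q) q → contradiction q ¬q ; (inj₂ q′) _ → q′ })
                 (λ f → case decS q A x of λ { (yes h) → inj₂ (f h) ; (no ¬h) → inj₁ ¬h }))
    (¬S q ⊎S q′)

  ⇔S : {Q Q′ : SQuery σ s} → DefS s Q → DefS s Q′ → DefS s (λ A x → Q A x ⇔ Q′ A x)
  ⇔S q q′ = respS (λ A x → mk⇔ (λ (f , g) → mk⇔ f g) (λ e → to e , from e))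
                  ((q →S q′) ×S (q′ →S q))

  ∃S : ∀ t {Q : SQuery σ (t ⊗ s)} → DefS (t ⊗ s) Q → DefS s (λ A x → ∃[ y ] Q A (y , x))
  ∃S {s} t {Q} (shaped q) = shaped (resp
    (λ A v → mk⇔ (λ (b , h) → unflatten t b , subst (Q A) (eq b v) h)
                 (λ (y , h) → flatten t y ,
                   subst (Q A) (trans (cong (_, _) (sym (unflatten-flatten t y))) (sym (eq (flatten t y) v))) h))
    (∃-vec-def ∥ t ∥ q))
    where
    eq : (b : Vec U ∥ t ∥) (v : Vec U ∥ s ∥) →
         unflatten (t ⊗ s) (b ++ v) ≡ (unflatten t b , unflatten s v)
    eq b v = cong₂ _,_ (cong (unflatten t) (take-++ b v)) (cong (unflatten s) (drop-++ b v))

  ∀S : ∀ t {Q : SQuery σ (t ⊗ s)} → DefS (t ⊗ s) Q → DefS s (λ A x → ∀ y → Q A (y , x))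
  ∀S t q = respS
    (λ A x → mk⇔ (λ ¬∃¬ y → Dec.decidable-stable (decS q A (y , x)) λ ¬h → ¬∃¬ (y , ¬h))
                 (λ f (y , ¬h) → ¬h (f y)))
    (¬S (∃S t (¬S q)))

  ⊥S : DefS s (λ A x → ⊥)
  ⊥S {s} = renS {t = vec 0} (λ _ → []) (λ _ _ → refl) (vecS (resp
    (λ A v → mk⇔ (λ (a , a≢a) → a≢a refl) ⊥-elim)
    (∃-def (values-def (zero ∷ zero ∷ []) (¬-def ≡-def)))))

  ⊤S : DefS s (λ A x → ⊤)
  ⊤S = respS (λ A x → mk⇔ _ (λ _ ())) (¬S ⊥S)

  ∃FinS : ∀ k {Q : Fin k → SQuery σ s} → (∀ i → DefS s (Q i)) → DefS s (λ A x → ∃[ i ] Q i A x)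
  ∃FinS zero q = respS (λ A x → mk⇔ (λ ()) λ ()) ⊥S
  ∃FinS (suc k) q = respS
    (λ A x → mk⇔ (λ { (inj₁ h) → zero , h ; (inj₂ (i , h)) → suc i , h })
                 (λ { (zero , h) → inj₁ h ; (suc i , h) → inj₂ (i , h) }))
    (q zero ⊎S ∃FinS k (q ∘ suc))

  ∀FinS : ∀ k {Q : Fin k → SQuery σ s} → (∀ i → DefS s (Q i)) → DefS s (λ A x → ∀ i → Q i A x)
  ∀FinS zero q = respS (λ A x → mk⇔ (λ _ ()) _) ⊤S
  ∀FinS (suc k) q = respS
    (λ A x → mk⇔ (λ { (h , _) zero → h ; (_ , h) (suc i) → h i }) (λ h → h zero , h ∘ suc))
    (q zero ×S ∀FinS k (q ∘ suc))

  ≡S : ∀ s → DefS (s ⊗ s) (λ A (x , y) → x ≡ y)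
  ≡S s = respS
    (λ A (x , y) → mk⇔
      (λ eq → trans (sym (unflatten-flatten s x))
                    (trans (cong (unflatten s) eq) (unflatten-flatten s y)))
      (cong (flatten s)))
    (renS {t = vec ∥ s ∥ ⊗ vec ∥ s ∥} (λ (x , y) → flatten s x , flatten s y)
          (λ g (x , y) → sym (cong₂ _,_ (map-flatten s g x) (map-flatten s g y)))
          vec-≡S)
    where
    vec-≡S : DefS (vec n ⊗ vec n) (λ A (x , y) → x ≡ y)
    vec-≡S {n} = respS (λ A (x , y) → mk⇔ (lookup-extensional x y) λ { refl i → refl })
      (∀FinS n λ i →
        renS {t = vec 2} (λ (x , y) → lookup x i ∷ lookup y i ∷ [])
             (λ g (x , y) → cong₂ (λ a b → a ∷ b ∷ []) (Vec.lookup-map i g x) (Vec.lookup-map i g y))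
             (vecS ≡-def))

  ManyS : DefS s (λ A _ → Many A)
  ManyS = ∃S (vec 1 ⊗ vec 1) (renS (λ ((a , b) , _) → a , b) (λ _ _ → refl) (¬S (≡S (vec 1))))

  valuesS : (xs : Vec (Fin n) m) {Q : SQuery σ (vec m)} → DefS (vec m) Q →
            DefS (vec n) (λ A v → Q A (values v xs))
  valuesS xs = renS (λ v → values v xs) (values-natural xs)

  ∃₁S : {Q : Query σ (suc n)} → DefS (vec (suc n)) Q → DefS (vec n) (λ A v → ∃[ a ] Q A (a ∷ v))
  ∃₁S q = vecS (∃-def (unshaped q))

  ∀₁S : {Q : Query σ (suc n)} → DefS (vec (suc n)) Q → DefS (vec n) (λ A v → ∀ a → Q A (a ∷ v))
  ∀₁S q = respS
    (λ A v → mk⇔ (λ ¬∃¬ a → Dec.decidable-stable (decS q A (a ∷ v)) λ ¬h → ¬∃¬ (a , ¬h))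
                 (λ f (a , ¬h) → ¬h (f a)))
    (¬S (∃₁S (¬S q)))

record Logic (σ : Vocabulary) : Set₁ where
  field
    foLogic : FOLogic σ
  open FOLogic foLogic public
  field
    Horn-def : {F : Query σ r} {R : Query σ (r + (r + r))} → Def F → Def R →
               Def (λ A → Horn (F A) (λ x y z → R A (x ++ (y ++ z))))

  HornS : {F : SQuery σ s} {R : SQuery σ (s ⊗ (s ⊗ s))} → DefS s F → DefS (s ⊗ (s ⊗ s)) R →
          DefS s (λ A → Horn (F A) (λ x y z → R A (x , y , z)))
  HornS {s} {F} {R} (shaped f) (shaped r) = shaped (resp
    (λ A v → mk⇔
      (Horn-map (unflatten s) (λ _ → id) (λ x y z → subst (R A) (eq x y z)))
      (λ h → subst (Horn _ _) (flatten-unflatten s v)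
        (Horn-map (flatten s)
          (λ x → subst (F A) (sym (unflatten-flatten s x)))
          (λ x y z → subst (R A) (sym (trans (eq _ _ _)
            (cong₂ _,_ (unflatten-flatten s x)
              (cong₂ _,_ (unflatten-flatten s y) (unflatten-flatten s z))))))
          h)))
    (Horn-def f r))
    where
    eq : (x y z : Vec U ∥ s ∥) → unflatten (s ⊗ (s ⊗ s)) (x ++ (y ++ z)) ≡
                                 (unflatten s x , unflatten s y , unflatten s z)
    eq x y z = cong₂ _,_ (cong (unflatten s) (take-++ x _)) (cong₂ _,_
      (cong (unflatten s) (trans (cong (take ∥ s ∥) (drop-++ x _)) (take-++ y z)))
      (cong (unflatten s) (trans (cong (drop ∥ s ∥) (drop-++ x _)) (drop-++ y z))))

  -- `Horn-def` admits no parameters, so they become a component of every node, and a rule connects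
  -- only nodes with the same parameters.
  HornS-with : ∀ s t {F : SQuery σ (s ⊗ t)} {R : SQuery σ ((s ⊗ (s ⊗ s)) ⊗ t)} →
    DefS (s ⊗ t) F → DefS ((s ⊗ (s ⊗ s)) ⊗ t) R →
    DefS (s ⊗ t) (λ A (x , p) → Horn (λ x → F A (x , p)) (λ x y z → R A ((x , y , z) , p)) x)
  HornS-with s t {F} {R} f r = respS
    (λ A (x , p) → mk⇔ forget
      (Horn-map (_, p) (λ _ → id) (λ x y z h → refl , refl , h)))
    (HornS f (
      renS (λ ((x , p) , (y , q) , (z , q′)) → p , q) (λ _ _ → refl) (≡S t) ×S
      renS (λ ((x , p) , (y , q) , (z , q′)) → p , q′) (λ _ _ → refl) (≡S t) ×S
      renS (λ ((x , p) , (y , q) , (z , q′)) → (x , y , z) , p) (λ _ _ → refl) r))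
    where
    forget : ∀ {A} {x : ⟦ s ⟧ ∣ A ∣ₛ} {p} →
             Horn (F A) (λ (x , p) (y , q) (z , q′) → p ≡ q × p ≡ q′ × R A ((x , y , z) , p)) (x , p) →
             Horn (λ x → F A (x , p)) (λ x y z → R A ((x , y , z) , p)) x
    forget (fact h) = fact h
    forget (rule (refl , refl , h) a b) = rule h (forget a) (forget b)

-- Closure properties of EFP

values-allFin : (v : Vec U n) → values v (allFin n) ≡ v
values-allFin = Vec.map-lookup-allFin

values-map : (v : Vec U m) (w : Vec U n) (f : Fin n → Fin m) → (∀ i → lookup v (f i) ≡ lookup w i) →
             (xs : Vec (Fin n) r) → values v (map f xs) ≡ values w xs
values-map v w f eq xs = trans (sym (Vec.map-∘ (lookup v) f xs)) (Vec.map-cong eq xs)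

values-↑ˡ : (v : Vec U m) (w : Vec U n) (xs : Vec (Fin m) r) →
            values (v ++ w) (map (_↑ˡ n) xs) ≡ values v xs
values-↑ˡ {n = n} v w = values-map (v ++ w) v (_↑ˡ n) (Vec.lookup-++ˡ v w)

values-↑ʳ : (v : Vec U m) (w : Vec U n) (xs : Vec (Fin n) r) →
            values (v ++ w) (map (m ↑ʳ_) xs) ≡ values w xs
values-↑ʳ {m = m} v w = values-map (v ++ w) w (m ↑ʳ_) (Vec.lookup-++ʳ v w)

-- An operator that ignores its argument reaches its least fixed point in one step; the decision
-- procedure turns `G` into a Boolean relation to plug in. Such fixed points serve as mere carriers
-- of substitution and negation.
lfpOf-nonrecursive : {F : (Vec U r → Bool) → Vec U r → Set} {G : Vec U r → Set} →
  (∀ a → Dec (G a)) → (∀ X a → F X a ⇔ G a) → ∀ a → G a ⇔ lfpOf F a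
lfpOf-nonrecursive G? e a = mk⇔
  (λ g X closed → closed a (from (e X a) g))
  (λ h → toWitness (h (λ x → ⌊ G? x ⌋) (λ x f → fromWitness (to (e _ x) f))))

EFP-At : ℕ → Query σ n → Set
EFP-At {σ} {n} ℓ Q = Σ[ φ ∈ EFP σ ℓ n ] (∀ A v → Q A v ⇔ satEFP A φ v)

Decidable : Query σ n → Set
Decidable Q = ∀ A v → Dec (Q A v)

substituted₁ : EFP σ ℓ n → (S : Symbol (n ∷ [])) → EFP σ ℓ (arity (n ∷ []) S)
substituted₁ φ zero = φ

-- The constructor `lfp` is the only one that leads from a stratum to the next, and it instantiates
-- its variables by `xs`. A fixed point whose body is just an additional relation thus performs the
-- substitution and raises the stratum by one.
values-EFP : {Q : Query σ n} → Decidable Q → EFP-At ℓ Q → (xs : Vec (Fin m) n) →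
             EFP-At (suc ℓ) (λ A v → Q A (values v xs))
values-EFP {n = n} {Q = Q} Q? (φ , e) xs =
  lfp n 0 (n ∷ []) (add zero (map (_↑ˡ 0) (allFin n))) (substituted₁ φ) xs ,
  λ A v → lfpOf-nonrecursive (Q? A)
    (λ X a → mk⇔
      (λ { ([] , h) → subst (Q A) (eq a) (from (e A _) h) })
      (λ q → [] , to (e A _) (subst (Q A) (sym (eq a)) q)))
    (values v xs)
  where
  eq : (a : Vec U n) → values (a ++ []) (map (_↑ˡ 0) (allFin n)) ≡ a
  eq a = trans (values-↑ˡ a [] (allFin n)) (values-allFin a)

¬-EFP : {Q : Query σ n} → Decidable Q → EFP-At ℓ Q → EFP-At (suc ℓ) (λ A v → ¬ Q A v)
¬-EFP {n = n} {Q = Q} Q? (φ , e) =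
  lfp n 0 (n ∷ []) (¬∙ add zero (map (_↑ˡ 0) (allFin n))) (substituted₁ φ) (allFin n) ,
  λ A v → ⇔-trans (≡⇒⇔ (cong (λ w → ¬ Q A w) (sym (values-allFin v))))
    (lfpOf-nonrecursive (¬? ∘ Q? A)
      (λ X a → mk⇔
        (λ { ([] , ¬h) q → ¬h (to (e A _) (subst (Q A) (sym (eq a)) q)) })
        (λ ¬q → [] , λ h → ¬q (subst (Q A) (eq a) (from (e A _) h))))
      (values v (allFin n)))
  where
  eq : (a : Vec U n) → values (a ++ []) (map (_↑ˡ 0) (allFin n)) ≡ a
  eq a = trans (values-↑ˡ a [] (allFin n)) (values-allFin a)

-- The strata are cumulative only up to equivalence: each step up is a nonrecursive fixed point with
-- the identity substitution.
raise-EFP : {Q : Query σ n} {ℓ′ : ℕ} → Decidable Q → ℓ ℕ.≤′ ℓ′ → EFP-At ℓ Q → EFP-At ℓ′ Q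
raise-EFP Q? ℕ.≤′-refl φ = φ
raise-EFP {Q = Q} Q? (ℕ.≤′-step ℓ≤ℓ′) φ with values-EFP Q? (raise-EFP Q? ℓ≤ℓ′ φ) (allFin _)
... | ψ , e = ψ , λ A v → ⇔-trans (≡⇒⇔ (cong (Q A) (sym (values-allFin v)))) (e A v)

substituted₂ : {a b : ℕ} → EFP σ ℓ a → EFP σ ℓ b → (S : Symbol (a ∷ b ∷ [])) → EFP σ ℓ (arity (a ∷ b ∷ []) S)
substituted₂ φ ψ zero       = φ
substituted₂ φ ψ (suc zero) = ψ

module _ {F : Query σ r} {R : Query σ (r + (r + r))} (F? : Decidable F) (R? : Decidable R)
         (φ : EFP-At ℓ F) (ψ : EFP-At ℓ R) where

  private
    -- R x̄ ← F x̄ ∨ ∃ȳ (R ȳ₁ ∧ R ȳ₂ ∧ R x̄ ȳ₁ ȳ₂) with ȳ = ȳ₁ȳ₂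
    x̄ ȳ₁ ȳ₂ : Vec (Fin (r + (r + r))) r
    x̄  = map (_↑ˡ (r + r)) (allFin r)
    ȳ₁ = map (r ↑ʳ_) (map (_↑ˡ r) (allFin r))
    ȳ₂ = map (r ↑ʳ_) (map (r ↑ʳ_) (allFin r))

    value-x̄ : (a : Vec U r) (b : Vec U (r + r)) → values (a ++ b) x̄ ≡ a
    value-x̄ a b = trans (values-↑ˡ a b _) (values-allFin a)

    value-ȳ₁ : (a y z : Vec U r) → values (a ++ (y ++ z)) ȳ₁ ≡ y
    value-ȳ₁ a y z = trans (values-↑ʳ a (y ++ z) _) (trans (values-↑ˡ y z _) (values-allFin y))

    value-ȳ₂ : (a y z : Vec U r) → values (a ++ (y ++ z)) ȳ₂ ≡ z
    value-ȳ₂ a y z = trans (values-↑ʳ a (y ++ z) _) (trans (values-↑ʳ y z _) (values-allFin z))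

    θ : QF σ (r ∷ (r + (r + r)) ∷ []) r (r + (r + r)) pos
    θ = add zero x̄ ∨ (rec ȳ₁ ∧ (rec ȳ₂ ∧ add (suc zero) (allFin _)))

  Horn-EFP : EFP-At (suc ℓ) (λ A → Horn (F A) (λ x y z → R A (x ++ (y ++ z))))
  Horn-EFP = lfp r (r + r) _ θ (substituted₂ (proj₁ φ) (proj₁ ψ)) (allFin r) , λ A v →
    ⇔-trans (≡⇒⇔ (cong (Horn _ _) (sym (values-allFin v)))) (mk⇔ (⊆lfp A) (lfp⊆ A))
    where
    module _ (A : Structure σ) where
      H? : ∀ a → Dec (Horn (F A) (λ x y z → R A (x ++ (y ++ z))) a)
      H? = Horn? (Vec-finite Fin-finite r) (F? A) (λ x y z → R? A _)

      step : (Vec ∣ A ∣ₛ r → Bool) → Vec ∣ A ∣ₛ r → Set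
      step X a = Σ[ b ∈ Vec ∣ A ∣ₛ (r + r) ]
        satQF A θ (λ S → satEFP A (substituted₂ (proj₁ φ) (proj₁ ψ) S)) X (a ++ b)

      ⊆lfp : ∀ {a} → Horn (F A) (λ x y z → R A (x ++ (y ++ z))) a →
             lfpOf step a
      ⊆lfp (fact {x} f) X closed =
        -- The first disjunct does not mention ȳ, but the quantifier still wants a witness of length
        -- `r + r`.
        closed x ((x ++ x) , inj₁ (to (proj₂ φ A _) (subst (F A) (sym (value-x̄ x _)) f)))
      ⊆lfp (rule {x} {y} {z} t p q) X closed = closed x ((y ++ z) , inj₂
        ( subst (T ∘ X) (sym (value-ȳ₁ x y z)) (⊆lfp p X closed)
        , subst (T ∘ X) (sym (value-ȳ₂ x y z)) (⊆lfp q X closed)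
        , to (proj₂ ψ A _) (subst (R A) (sym (values-allFin _)) t)))

      lfp⊆ : ∀ {a} → lfpOf step a →
             Horn (F A) (λ x y z → R A (x ++ (y ++ z))) a
      lfp⊆ h = toWitness (h (λ a → ⌊ H? a ⌋) λ where
        a (b , inj₁ f) → fromWitness (fact (subst (F A) (value-x̄ a b) (from (proj₂ φ A _) f)))
        a (b , inj₂ (p , q , t)) → fromWitness (closed a (take r b) (drop r b)
          (sym (Vec.take++drop≡id r b)) (toWitness p) (toWitness q)
          (subst (R A) (values-allFin _) (from (proj₂ ψ A _) t))))
        where
        closed : ∀ a y z {b} → b ≡ y ++ z → Horn _ _ (values (a ++ b) ȳ₁) →
                 Horn _ _ (values (a ++ b) ȳ₂) → R A (a ++ b) →
                 Horn (F A) (λ x y z → R A (x ++ (y ++ z))) a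
        closed a y z refl p q t =
          rule t (subst (Horn _ _) (value-ȳ₁ a y z) p) (subst (Horn _ _) (value-ȳ₂ a y z) q)

record EFP-Def (Q : Query σ n) : Set where
  constructor efp-def
  field
    decidable : Decidable Q
    {level}   : ℕ
    formula   : EFP-At level Q

module _ {Q : Query σ m} {Q′ : Query σ n} (Q? : Decidable Q) (Q′? : Decidable Q′) where

  -- The successor matters even if both levels are 0, because conjunction and disjunction of strata
  -- exist only from stratum 1 on.
  atCommonLevel : {ℓ ℓ′ : ℕ} → EFP-At ℓ Q → EFP-At ℓ′ Q′ →
                  EFP-At (suc (ℓ + ℓ′)) Q × EFP-At (suc (ℓ + ℓ′)) Q′
  atCommonLevel φ ψ =
    raise-EFP Q? (ℕ.≤′-step (ℕ.m≤′m+n _ _)) φ , raise-EFP Q′? (ℕ.≤′-step (ℕ.n≤′m+n _ _)) ψ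

EFP-foLogic : FOLogic σ
EFP-foLogic = record
  { Def = EFP-Def
  ; dec = EFP-Def.decidable
  ; resp = λ { e (efp-def Q? (φ , f)) →
      efp-def (λ A v → Dec.map (e A v) (Q? A v)) (φ , λ A v → ⇔-trans (⇔-sym (e A v)) (f A v)) }
  ; atom-def = λ R → efp-def (λ A v → T? _)
      ( base (atom R (allFin _)) tt
      , λ A v → ≡⇒⇔ (cong (T ∘ rel A R) (sym (values-allFin v))))
  ; ≡-def = efp-def (λ A v → _ Fin.≟ _) (base (zero ≐ suc zero) tt , λ A v → ⇔-refl)
  ; values-def = λ { xs (efp-def Q? φ) → efp-def (λ A v → Q? A _) (values-EFP Q? φ xs) }
  ; ¬-def = λ { (efp-def Q? φ) → efp-def (λ A v → ¬? (Q? A v)) (¬-EFP Q? φ) }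
  ; ×-def = λ { (efp-def Q? φ) (efp-def Q′? ψ) →
      let (φ′ , e) , (ψ′ , f) = atCommonLevel Q? Q′? φ ψ
      in efp-def (λ A v → Q? A v ×-dec Q′? A v) (φ′ ∧ ψ′ , λ A v → ×-⇔ (e A v) (f A v)) }
  ; ⊎-def = λ { (efp-def Q? φ) (efp-def Q′? ψ) →
      let (φ′ , e) , (ψ′ , f) = atCommonLevel Q? Q′? φ ψ
      in efp-def (λ A v → Q? A v ⊎-dec Q′? A v) (φ′ ∨ ψ′ , λ A v → ⊎-⇔ (e A v) (f A v)) }
  ; ∃-def = λ { (efp-def Q? φ) →
      let φ′ , e = raise-EFP Q? (ℕ.≤′-step ℕ.≤′-refl) φ
      in efp-def (λ A v → ∃? Fin-finite λ a → Q? A _) (∃∙ φ′ , λ A v → ∃-⇔ λ a → e A _) }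
  }

EFP-logic : Logic σ
EFP-logic = record
  { foLogic = EFP-foLogic
  ; Horn-def = λ { (efp-def F? φ) (efp-def R? ψ) →
      let φ′ , ψ′ = atCommonLevel F? R? φ ψ
      in efp-def (λ A → Horn? (Vec-finite Fin-finite _) (F? A) (λ x y z → R? A _))
                 (Horn-EFP F? R? φ′ ψ′) }
  }

-- Compilation of EFP to Horn rules

module Compilation {σ : Vocabulary} (L : Logic σ) where
  open Logic L

  RQuery : Vocabulary → Shape → Set₁
  RQuery Γ s = (A : Structure σ) → Relations Γ ∣ A ∣ₛ → ⟦ s ⟧ ∣ A ∣ₛ → Set

  -- A query with the relation variables Γ is compiled to Horn rules on nodes,
  -- with additional rules u ← X x , w for the calls of the relation variables X.
  -- In structures with one element nodes cannot carry tags, but there a least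
  -- fixed point is the first stage of its iteration, so that it suffices to know
  -- the query for empty relations.
  record Compiled (Γ : Vocabulary) (s : Shape) (Q : RQuery Γ s) : Set₁ where
    field
      node  : Shape
      Fact  : SQuery σ node
      Rule  : SQuery σ (node ⊗ (node ⊗ node))
      Call  : (X : Symbol Γ) → SQuery σ (node ⊗ (vec (arity Γ X) ⊗ node))
      Start : SQuery σ (s ⊗ node)
      Q₁    : SQuery σ s
      factS  : DefS node Fact
      ruleS  : DefS (node ⊗ (node ⊗ node)) Rule
      callS  : ∀ X → DefS (node ⊗ (vec (arity Γ X) ⊗ node)) (Call X)
      startS : DefS (s ⊗ node) Start
      Q₁S    : DefS s Q₁

    Step : (A : Structure σ) → Relations Γ ∣ A ∣ₛ →
           ⟦ node ⟧ ∣ A ∣ₛ → ⟦ node ⟧ ∣ A ∣ₛ → ⟦ node ⟧ ∣ A ∣ₛ → Set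
    -- A call has a single node as premise, so `w′` is left free; the node `w` itself can always
    -- take its place.
    Step A ρ u w w′ = Rule A (u , w , w′) ⊎ ∃[ X ] ∃[ x ] (T (ρ X x) × Call X A (u , x , w))

    Holds : (A : Structure σ) → Relations Γ ∣ A ∣ₛ → ⟦ node ⟧ ∣ A ∣ₛ → Set
    Holds A ρ = Horn (Fact A) (Step A ρ)

    field
      total    : ∀ A → Many A → ∀ v → ∃[ u ] Start A (v , u)
      correct  : ∀ A → Many A → ∀ ρ v → Q A ρ v ⇔ (∃[ u ] (Start A (v , u) × Holds A ρ u))
      correct₁ : ∀ A → ¬ Many A → ∀ ρ → (∀ X x → ¬ T (ρ X x)) → ∀ v → Q A ρ v ⇔ Q₁ A v

  respC : {Q Q′ : RQuery Γ s} → (∀ A ρ v → Q A ρ v ⇔ Q′ A ρ v) → Compiled Γ s Q → Compiled Γ s Q′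
  respC e c = record
    { Compiled c
    ; correct  = λ A many ρ v → ⇔-trans (⇔-sym (e A ρ v)) (Compiled.correct c A many ρ v)
    ; correct₁ = λ A one ρ ρ-empty v → ⇔-trans (⇔-sym (e A ρ v)) (Compiled.correct₁ c A one ρ ρ-empty v)
    }

  -- Without relation variables no calls remain, and the rules form a plain definable Horn closure.
  -- The case distinction on the number of elements is itself definable. Since functions on the
  -- empty set of symbols are not definitionally equal, `ρ` is whichever one the caller has.
  executeC : {Q : RQuery [] s} → Compiled [] s Q → (ρ : ∀ A → ⟦ s ⟧ ∣ A ∣ₛ → Relations [] ∣ A ∣ₛ) →
             DefS s (λ A v → Q A (ρ A v) v)
  executeC {s} {Q} c ρ = respS
    (λ A v → mk⇔
      (λ { (inj₁ (many , u , st , h)) →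
             from (correct A many (ρ A v) v) (u , st , Horn-map id (λ _ → id) (λ _ _ _ → inj₁) h)
         ; (inj₂ (one , q)) → from (correct₁ A one (ρ A v) (λ ()) v) q })
      (λ q → case decS {s = s} ManyS A v of λ where
        (yes many) → let u , st , h = to (correct A many (ρ A v) v) q in inj₁ (many , u , st ,
          Horn-map id (λ _ → id) (λ { _ _ _ (inj₁ r) → r ; _ _ _ (inj₂ (() , _)) }) h)
        (no one)   → inj₂ (one , to (correct₁ A one (ρ A v) (λ ()) v) q)))
    ((ManyS ×S ∃S node (renS (λ (u , v) → v , u) (λ _ _ → refl) startS ×S
                        renS proj₁ (λ _ _ → refl) (HornS factS ruleS)))
     ⊎S (¬S ManyS ×S Q₁S))
    where open Compiled c

  literalC : {Q : SQuery σ s} → DefS s Q → Compiled Γ s (λ A ρ → Q A)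
  literalC {s} {Q = Q} q = record
    { node = s ; Fact = Q ; Rule = λ _ _ → ⊥ ; Call = λ _ _ _ → ⊥ ; Start = λ A (v , u) → v ≡ u ; Q₁ = Q
    ; factS = q ; ruleS = ⊥S ; callS = λ _ → ⊥S ; startS = ≡S s ; Q₁S = q
    ; total    = λ A _ v → v , refl
    ; correct  = λ A _ ρ v → mk⇔ (λ h → v , refl , fact h)
        λ { (_ , refl , fact h) → h
          ; (_ , refl , rule (inj₁ ()) _ _)
          ; (_ , refl , rule (inj₂ (_ , _ , _ , ())) _ _) }
    ; correct₁ = λ A _ ρ _ v → ⇔-refl
    }

  -- A node with `a ≢ b` waits for the call of `X` at `x`. A node with `a ≡ b` is a fact, present
  -- only because a call also demands some derivable node as a premise.
  variableC : (X : Symbol Γ) → Compiled Γ (vec (arity Γ X)) (λ A ρ v → T (ρ X v))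
  variableC {Γ} X = record
    { node  = (vec 1 ⊗ vec 1) ⊗ vec (arity Γ X)
    ; Fact  = λ A ((a , b) , x) → a ≡ b
    ; Rule  = λ _ _ → ⊥
    ; Call  = λ Y A (((a , b) , x) , y , _) → Σ[ eq ∈ Y ≡ X ] (a ≢ b × subst (Vec _ ∘ arity Γ) eq y ≡ x)
    ; Start = λ A (v , ((a , b) , x)) → a ≢ b × v ≡ x
    ; Q₁    = λ _ _ → ⊥
    ; factS = renS proj₁ (λ _ _ → refl) (≡S (vec 1))
    ; ruleS = ⊥S
    ; callS = λ Y → case Y Fin.≟ X of λ where
        (yes refl) → respS (λ A _ → mk⇔ (refl ,_) λ { (refl , h) → h })
          (renS (λ ((ab , x) , y , _) → ab) (λ _ _ → refl) (¬S (≡S (vec 1))) ×S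
           renS (λ ((ab , x) , y , _) → y , x) (λ _ _ → refl) (≡S (vec (arity Γ X))))
        (no Y≢X)   → respS (λ A _ → mk⇔ (λ ()) (Y≢X ∘ proj₁)) ⊥S
    ; startS = renS (λ (v , (ab , x)) → ab) (λ _ _ → refl) (¬S (≡S (vec 1))) ×S
               renS (λ (v , (ab , x)) → v , x) (λ _ _ → refl) (≡S (vec (arity Γ X)))
    ; Q₁S   = ⊥S
    ; total    = λ A (ab , a≢b) v → (ab , v) , a≢b , refl
    ; correct  = λ A ((a , b) , a≢b) ρ v → mk⇔
        (λ t → ((a , b) , v) , (a≢b , refl) ,
          rule (inj₂ (X , v , t , refl , a≢b , refl)) (fact {x = (a , a) , v} refl)
               (fact {x = (a , a) , v} refl))
        λ { (_ , (a≢b , refl) , fact a≡b) → contradiction a≡b a≢b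
          ; (_ , (a≢b , refl) , rule (inj₁ ()) _ _)
          ; (_ , (a≢b , refl) , rule (inj₂ (_ , _ , t , refl , _ , refl)) _ _) → t }
    ; correct₁ = λ A _ ρ ρ-empty v → mk⇔ (ρ-empty X v) λ ()
    }

  -- Existential quantification costs no rules: the choice of `w` is absorbed into the choice of the
  -- start node. If `W` is the graph of a function this is substitution, and if it forgets a
  -- component it is a quantifier.
  imageC : {Q : RQuery Γ s} {W : SQuery σ (t ⊗ s)} → DefS (t ⊗ s) W → (∀ A v → ∃[ w ] W A (v , w)) →
           Compiled Γ s Q → Compiled Γ t (λ A ρ v → ∃[ w ] (W A (v , w) × Q A ρ w))
  imageC {s = s} {t = t} {Q} {W} wS w-total c = record
    { node = node ; Fact = Fact ; Rule = Rule ; Call = Call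
    ; Start = λ A (v , u) → ∃[ w ] (W A (v , w) × Start A (w , u))
    ; Q₁    = λ A v → ∃[ w ] (W A (v , w) × Q₁ A w)
    ; factS = factS ; ruleS = ruleS ; callS = callS
    ; startS = ∃S s (renS (λ (w , v , u) → v , w) (λ _ _ → refl) wS ×S
                     renS (λ (w , v , u) → w , u) (λ _ _ → refl) startS)
    ; Q₁S   = ∃S s (renS (λ (w , v) → v , w) (λ _ _ → refl) wS ×S renS proj₁ (λ _ _ → refl) Q₁S)
    ; total = λ A many v → let w , v-w = w-total A v ; u , st = total A many w in u , w , v-w , st
    ; correct = λ A many ρ v → mk⇔
        (λ (w , v-w , q) → let u , st , h = to (correct A many ρ w) q in u , (w , v-w , st) , h)
        (λ (u , (w , v-w , st) , h) → w , v-w , from (correct A many ρ w) (u , st , h))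
    ; correct₁ = λ A one ρ ρ-empty v → ∃-⇔ λ w → ×-⇔ ⇔-refl (correct₁ A one ρ ρ-empty w)
    }
    where open Compiled c

  mapC : {Q : RQuery Γ s} (f : ∀ {U} → ⟦ t ⟧ U → ⟦ s ⟧ U) →
         (∀ {U W} (g : U → W) x → f (smap t g x) ≡ smap s g (f x)) →
         Compiled Γ s Q → Compiled Γ t (λ A ρ v → Q A ρ (f v))
  mapC {s = s} {t = t} f natural c = respC
    (λ A ρ v → mk⇔ (λ { (_ , refl , q) → q }) (λ q → _ , refl , q))
    (imageC {W = λ A (v , w) → f v ≡ w}
      (renS (λ (v , w) → f v , w) (λ g (v , w) → cong (_, _) (natural g v)) (≡S s))
      (λ A v → f v , refl) c)

  inhabitant : {U : Set} → U → ∀ s → ⟦ s ⟧ U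
  inhabitant a (vec n) = replicate n a
  inhabitant a (s ⊗ t) = inhabitant a s , inhabitant a t
  inhabitant a (s ^ k) = replicate k (inhabitant a s)

  ∃C : ∀ t {Q : RQuery Γ (t ⊗ s)} → Compiled Γ (t ⊗ s) Q → Compiled Γ s (λ A ρ v → ∃[ y ] Q A ρ (y , v))
  ∃C {s = s} t c = respC
    (λ A ρ v → mk⇔ (λ { ((y , _) , refl , q) → y , q }) (λ (y , q) → (y , v) , refl , q))
    (imageC {s = t ⊗ s} {W = λ A (v , (y , v′)) → v ≡ v′}
      (renS (λ (v , (y , v′)) → v , v′) (λ _ _ → refl) (≡S s))
      (λ A v → (inhabitant (point A) t , v) , refl) c)

  -- Nodes are pairs of nodes of the two parts, and a rule changes one component.
  -- So no tags are needed to tell the two parts apart.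
  module Product {Q Q′ : RQuery Γ s} (c : Compiled Γ s Q) (d : Compiled Γ s Q′) where
    open Compiled c
    open Compiled d using () renaming
      ( node to node′ ; Fact to Fact′ ; Rule to Rule′ ; Call to Call′ ; Start to Start′
      ; Q₁ to Q₁′; factS to factS′ ; ruleS to ruleS′ ; callS to callS′ ; startS to startS′
      ; Q₁S to Q₁S′ ; Step to Step′ ; Holds to Holds′ ; total to total′ ; correct to correct′
      ; correct₁ to correct₁′ )

    ProductRule : SQuery σ ((node ⊗ node′) ⊗ ((node ⊗ node′) ⊗ (node ⊗ node′)))
    ProductRule A ((u , u′) , (w , w′) , (z , z′)) =
      (Rule A (u , w , z) × u′ ≡ w′ × u′ ≡ z′) ⊎ (Rule′ A (u′ , w′ , z′) × u ≡ w × u ≡ z)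

    productRuleS : DefS ((node ⊗ node′) ⊗ ((node ⊗ node′) ⊗ (node ⊗ node′))) ProductRule
    productRuleS =
      (renS (λ ((u , u′) , (w , w′) , (z , z′)) → u , w , z) (λ _ _ → refl) ruleS ×S
       renS (λ ((u , u′) , (w , w′) , (z , z′)) → u′ , w′) (λ _ _ → refl) (≡S node′) ×S
       renS (λ ((u , u′) , (w , w′) , (z , z′)) → u′ , z′) (λ _ _ → refl) (≡S node′))
      ⊎S
      (renS (λ ((u , u′) , (w , w′) , (z , z′)) → u′ , w′ , z′) (λ _ _ → refl) ruleS′ ×S
       renS (λ ((u , u′) , (w , w′) , (z , z′)) → u , w) (λ _ _ → refl) (≡S node) ×S
       renS (λ ((u , u′) , (w , w′) , (z , z′)) → u , z) (λ _ _ → refl) (≡S node))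

    ProductCall : (X : Symbol Γ) → SQuery σ ((node ⊗ node′) ⊗ (vec (arity Γ X) ⊗ (node ⊗ node′)))
    ProductCall X A ((u , u′) , x , (w , w′)) =
      (Call X A (u , x , w) × u′ ≡ w′) ⊎ (Call′ X A (u′ , x , w′) × u ≡ w)

    productCallS : ∀ X → DefS ((node ⊗ node′) ⊗ (vec (arity Γ X) ⊗ (node ⊗ node′))) (ProductCall X)
    productCallS X =
      (renS (λ ((u , u′) , x , (w , w′)) → u , x , w) (λ _ _ → refl) (callS X) ×S
       renS (λ ((u , u′) , x , (w , w′)) → u′ , w′) (λ _ _ → refl) (≡S node′))
      ⊎S
      (renS (λ ((u , u′) , x , (w , w′)) → u′ , x , w′) (λ _ _ → refl) (callS′ X) ×S
       renS (λ ((u , u′) , x , (w , w′)) → u , w) (λ _ _ → refl) (≡S node))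

    ProductStart : SQuery σ (s ⊗ (node ⊗ node′))
    ProductStart A (v , (u , u′)) = Start A (v , u) × Start′ A (v , u′)

    productStartS : DefS (s ⊗ (node ⊗ node′)) ProductStart
    productStartS =
      renS (λ (v , (u , u′)) → v , u) (λ _ _ → refl) startS ×S
      renS (λ (v , (u , u′)) → v , u′) (λ _ _ → refl) startS′

    productTotal : ∀ A → Many A → ∀ v → ∃[ u ] ProductStart A (v , u)
    productTotal A many v =
      let u , st = total A many v ; u′ , st′ = total′ A many v in (u , u′) , st , st′

    module _ (A : Structure σ) (ρ : Relations Γ ∣ A ∣ₛ)
             {F : ⟦ node ⟧ ∣ A ∣ₛ × ⟦ node′ ⟧ ∣ A ∣ₛ → Set} where

      ProductHolds : ⟦ node ⟧ ∣ A ∣ₛ × ⟦ node′ ⟧ ∣ A ∣ₛ → Set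
      ProductHolds = Horn F λ u w w′ →
        ProductRule A (u , w , w′) ⊎ ∃[ X ] ∃[ x ] (T (ρ X x) × ProductCall X A (u , x , w))

      leftwards : ∀ {u u′} → (∀ {u} → Fact A u → ProductHolds (u , u′)) →
                  Holds A ρ u → ProductHolds (u , u′)
      leftwards facts (fact h) = facts h
      leftwards facts (rule (inj₁ r) p q) =
        rule (inj₁ (inj₁ (r , refl , refl))) (leftwards facts p) (leftwards facts q)
      leftwards facts (rule (inj₂ (X , x , t , call)) p q) =
        rule (inj₂ (X , x , t , inj₁ (call , refl))) (leftwards facts p) (leftwards facts q)

      rightwards : ∀ {u u′} → (∀ {u′} → Fact′ A u′ → ProductHolds (u , u′)) →
                   Holds′ A ρ u′ → ProductHolds (u , u′)
      rightwards facts (fact h) = facts h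
      rightwards facts (rule (inj₁ r) p q) =
        rule (inj₁ (inj₂ (r , refl , refl))) (rightwards facts p) (rightwards facts q)
      rightwards facts (rule (inj₂ (X , x , t , call)) p q) =
        rule (inj₂ (X , x , t , inj₂ (call , refl))) (rightwards facts p) (rightwards facts q)

    infixr 3 _×C_
    infixr 2 _⊎C_

    _×C_ : Compiled Γ s (λ A ρ v → Q A ρ v × Q′ A ρ v)
    _×C_ = record
      { node  = node ⊗ node′
      ; Fact  = λ A (u , u′) → Fact A u × Fact′ A u′
      ; Rule  = ProductRule ; Call = ProductCall ; Start = ProductStart
      ; Q₁    = λ A v → Q₁ A v × Q₁′ A v
      ; factS = renS proj₁ (λ _ _ → refl) factS ×S renS proj₂ (λ _ _ → refl) factS′
      ; ruleS = productRuleS ; callS = productCallS ; startS = productStartS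
      ; Q₁S   = Q₁S ×S Q₁S′
      ; total = productTotal
      ; correct = λ A many ρ v → mk⇔
          (λ (q , q′) →
            let u , st , h = to (correct A many ρ v) q ; u′ , st′ , h′ = to (correct′ A many ρ v) q′
            in (u , u′) , (st , st′) ,
               -- The first derivation is replayed with the second component held at `u′`; at each
               -- of its leaves the second derivation is replayed with the first component held
               -- fixed.
               leftwards A ρ (λ f → rightwards A ρ (λ f′ → fact (f , f′)) h′) h)
          (λ ((u , u′) , (st , st′) , h) →
            from (correct A many ρ v) (u , st , proj₁ (both A ρ h)) ,
            from (correct′ A many ρ v) (u′ , st′ , proj₂ (both A ρ h)))
      ; correct₁ = λ A one ρ ρ-empty v →
          ×-⇔ (correct₁ A one ρ ρ-empty v) (correct₁′ A one ρ ρ-empty v)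
      }
      where
      -- The component that a rule leaves alone is the same in the conclusion and in the premises,
      -- so its derivation is inherited from the first premise.
      both : ∀ A ρ {u u′} → ProductHolds A ρ {λ (u , u′) → Fact A u × Fact′ A u′} (u , u′) →
             Holds A ρ u × Holds′ A ρ u′
      both A ρ (fact (f , f′)) = fact f , fact f′
      both A ρ (rule (inj₁ (inj₁ (r , refl , refl))) p q) =
        rule (inj₁ r) (proj₁ (both A ρ p)) (proj₁ (both A ρ q)) , proj₂ (both A ρ p)
      both A ρ (rule (inj₁ (inj₂ (r , refl , refl))) p q) =
        proj₁ (both A ρ p) , rule (inj₁ r) (proj₂ (both A ρ p)) (proj₂ (both A ρ q))
      both A ρ (rule (inj₂ (X , x , t , inj₁ (call , refl))) p _) =
        rule (inj₂ (X , x , t , call)) (proj₁ (both A ρ p)) (proj₁ (both A ρ p)) , proj₂ (both A ρ p)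
      both A ρ (rule (inj₂ (X , x , t , inj₂ (call , refl))) p _) =
        proj₁ (both A ρ p) , rule (inj₂ (X , x , t , call)) (proj₂ (both A ρ p)) (proj₂ (both A ρ p))

    _⊎C_ : Compiled Γ s (λ A ρ v → Q A ρ v ⊎ Q′ A ρ v)
    _⊎C_ = record
      { node  = node ⊗ node′
      ; Fact  = λ A (u , u′) → Fact A u ⊎ Fact′ A u′
      ; Rule  = ProductRule ; Call = ProductCall ; Start = ProductStart
      ; Q₁    = λ A v → Q₁ A v ⊎ Q₁′ A v
      ; factS = renS proj₁ (λ _ _ → refl) factS ⊎S renS proj₂ (λ _ _ → refl) factS′
      ; ruleS = productRuleS ; callS = productCallS ; startS = productStartS
      ; Q₁S   = Q₁S ⊎S Q₁S′
      ; total = productTotal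
      ; correct = λ A many ρ v → mk⇔
          (λ where
            -- The other disjunct may fail, yet its component of the start node must be filled; this
            -- is what totality of `Start` is for.
            (inj₁ q) → let u , st , h = to (correct A many ρ v) q ; u′ , st′ = total′ A many v
                       in (u , u′) , (st , st′) , leftwards A ρ (fact ∘ inj₁) h
            (inj₂ q) → let u , st = total A many v ; u′ , st′ , h = to (correct′ A many ρ v) q
                       in (u , u′) , (st , st′) , rightwards A ρ (fact ∘ inj₂) h)
          (λ ((u , u′) , (st , st′) , h) → case one-of A ρ h of λ where
            (inj₁ l) → inj₁ (from (correct A many ρ v) (u , st , l))
            (inj₂ l) → inj₂ (from (correct′ A many ρ v) (u′ , st′ , l)))
      ; correct₁ = λ A one ρ ρ-empty v →
          ⊎-⇔ (correct₁ A one ρ ρ-empty v) (correct₁′ A one ρ ρ-empty v)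
      }
      where
      -- Suppose that a rule acts on one component. If some premise holds because of the other
      -- component, which does not change, so does the conclusion. Otherwise all premises hold
      -- because of the active component, and the rule applies there.
      one-of : ∀ A ρ {u u′} → ProductHolds A ρ {λ (u , u′) → Fact A u ⊎ Fact′ A u′} (u , u′) →
               Holds A ρ u ⊎ Holds′ A ρ u′
      one-of A ρ (fact (inj₁ f)) = inj₁ (fact f)
      one-of A ρ (fact (inj₂ f)) = inj₂ (fact f)
      one-of A ρ (rule (inj₁ (inj₁ (r , refl , refl))) p q) with one-of A ρ p | one-of A ρ q
      ... | inj₁ h | inj₁ k = inj₁ (rule (inj₁ r) h k)
      ... | inj₂ h | _      = inj₂ h
      ... | inj₁ _ | inj₂ k = inj₂ k
      one-of A ρ (rule (inj₁ (inj₂ (r , refl , refl))) p q) with one-of A ρ p | one-of A ρ q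
      ... | inj₂ h | inj₂ k = inj₂ (rule (inj₁ r) h k)
      ... | inj₁ h | _      = inj₁ h
      ... | inj₂ _ | inj₁ k = inj₁ k
      one-of A ρ (rule (inj₂ (X , x , t , inj₁ (call , refl))) p _) with one-of A ρ p
      ... | inj₁ h = inj₁ (rule (inj₂ (X , x , t , call)) h h)
      ... | inj₂ h = inj₂ h
      one-of A ρ (rule (inj₂ (X , x , t , inj₂ (call , refl))) p _) with one-of A ρ p
      ... | inj₁ h = inj₁ h
      ... | inj₂ h = inj₂ (rule (inj₂ (X , x , t , call)) h h)

  open Product public using (_×C_; _⊎C_)

  -- The call u ← X x , w of the bound variable X becomes the rule u ← w′ , w for
  -- every start node w′ of the body at x.  All nodes carry the parameters of the
  -- fixed point.
  lfpC : {Q : RQuery (r ∷ Γ) (vec r ⊗ t)} → Compiled (r ∷ Γ) (vec r ⊗ t) Q →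
         Compiled Γ (vec r ⊗ t) (λ A ρ (a , p) → lfpOf (λ X x → Q A (extend X ρ) (x , p)) a)
  lfpC {r} {Γ} {t} {Q} c = record
    { node  = node ⊗ t
    ; Fact  = λ A (u , p) → Fact A u
    ; Rule  = LfpRule
    ; Call  = LfpCall
    ; Start = LfpStart
    ; Q₁    = Q₁
    ; factS = renS proj₁ (λ _ _ → refl) factS
    ; ruleS =
        renS (λ ((u , p) , (w , q) , (w′ , q′)) → p , q) (λ _ _ → refl) (≡S t) ×S
        renS (λ ((u , p) , (w , q) , (w′ , q′)) → p , q′) (λ _ _ → refl) (≡S t) ×S
        (renS (λ ((u , p) , (w , q) , (w′ , q′)) → u , w , w′) (λ _ _ → refl) ruleS ⊎S
         ∃S (vec r)
           (renS (λ (x , (u , p) , (w , q) , (w′ , q′)) → u , x , w′) (λ _ _ → refl) (callS zero) ×S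
            renS (λ (x , (u , p) , (w , q) , (w′ , q′)) → (x , p) , w) (λ _ _ → refl) startS))
    ; callS = λ X →
        renS (λ ((u , p) , x , (w , q)) → p , q) (λ _ _ → refl) (≡S t) ×S
        renS (λ ((u , p) , x , (w , q)) → u , x , w) (λ _ _ → refl) (callS (suc X))
    ; startS =
        renS (λ ((a , p) , (u , q)) → p , q) (λ _ _ → refl) (≡S t) ×S
        renS (λ ((a , p) , (u , q)) → (a , p) , u) (λ _ _ → refl) startS
    ; Q₁S   = Q₁S
    ; total = λ A many (a , p) → let u , st = total A many (a , p) in (u , p) , refl , st
    ; correct = λ A many ρ (a , p) → mk⇔
        (λ h → toWitness (h (λ x → ⌊ Reached? A ρ (x , p) ⌋)
                 λ x q → fromWitness (closed A many ρ p x q)))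
        (λ { ((u , _) , (refl , st) , h) X X-closed →
               X-closed a (from (correct A many (extend X ρ) (a , p))
                 (u , st , unfold A many ρ p X X-closed h)) })
    -- Over one element there is a single tuple, so a relation that misses it is empty, and
    -- `correct₁` of the body applies. Hence closing the empty relation once under the body decides
    -- the fixed point.
    ; correct₁ = λ A one ρ ρ-empty (a , p) → mk⇔
        (λ h → toWitness (h (λ _ → ⌊ decS Q₁S A (a , p) ⌋) λ x q → fromWitness
          (case decS Q₁S A (a , p) of λ where
            (yes q₁) → q₁
            (no ¬q₁) → subst (λ x → Q₁ A (x , p)) (one-unique A one x a)
              (to (correct₁ A one (extend _ ρ)
                    (λ { zero x → ¬q₁ ∘ toWitness ; (suc X) → ρ-empty X }) (x , p)) q))))
        (λ q₁ X X-closed → case T? (X a) of λ where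
          (yes Xa) → Xa
          (no ¬Xa) → X-closed a (from (correct₁ A one (extend X ρ)
            (λ { zero x → ¬Xa ∘ subst (T ∘ X) (one-unique A one x a) ; (suc X) → ρ-empty X }) (a , p)) q₁))
    }
    where
    open Compiled c

    LfpRule : SQuery σ ((node ⊗ t) ⊗ ((node ⊗ t) ⊗ (node ⊗ t)))
    LfpRule A ((u , p) , (w , q) , (w′ , q′)) = p ≡ q × p ≡ q′ ×
      (Rule A (u , w , w′) ⊎ ∃[ x ] (Call zero A (u , x , w′) × Start A ((x , p) , w)))

    LfpCall : (X : Symbol Γ) → SQuery σ ((node ⊗ t) ⊗ (vec (arity Γ X) ⊗ (node ⊗ t)))
    LfpCall X A ((u , p) , x , (w , q)) = p ≡ q × Call (suc X) A (u , x , w)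

    LfpStart : SQuery σ ((vec r ⊗ t) ⊗ (node ⊗ t))
    LfpStart A ((a , p) , (u , q)) = p ≡ q × Start A ((a , p) , u)

    module _ (A : Structure σ) where

      LfpHolds : Relations Γ ∣ A ∣ₛ → ⟦ node ⊗ t ⟧ ∣ A ∣ₛ → Set
      LfpHolds ρ = Horn (λ (u , p) → Fact A u) λ u w w′ →
        LfpRule A (u , w , w′) ⊎ ∃[ X ] ∃[ x ] (T (ρ X x) × LfpCall X A (u , x , w))

      Reached : Relations Γ ∣ A ∣ₛ → ⟦ vec r ⊗ t ⟧ ∣ A ∣ₛ → Set
      Reached ρ a = ∃[ u ] (LfpStart A (a , u) × LfpHolds ρ u)

      -- Needed to plug the reached tuples into the fixed point as a Boolean relation.
      Reached? : ∀ ρ a → Dec (Reached ρ a)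
      Reached? ρ (a , p) = ∃? (⟦⟧-finite Fin-finite (node ⊗ t)) λ (u , q) →
        (Finite._≟_ (⟦⟧-finite Fin-finite t) p q ×-dec decS startS A _) ×-dec
        Horn? (⟦⟧-finite Fin-finite (node ⊗ t)) (λ (u , p) → decS factS A u)
          (λ (u , p) (w , q) (w′ , q′) →
            (Finite._≟_ (⟦⟧-finite Fin-finite t) p q ×-dec
             Finite._≟_ (⟦⟧-finite Fin-finite t) p q′ ×-dec
             (decS ruleS A _ ⊎-dec ∃? (Vec-finite Fin-finite r) λ x →
               decS (callS zero) A _ ×-dec decS startS A _))
            ⊎-dec ∃? Fin-finite λ X → ∃? (Vec-finite Fin-finite _) λ x → T? (ρ X x) ×-dec
              Finite._≟_ (⟦⟧-finite Fin-finite t) p q ×-dec decS (callS (suc X)) A _)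
          (u , q)

      module _ (many : Many A) (ρ : Relations Γ ∣ A ∣ₛ) (p : ⟦ t ⟧ ∣ A ∣ₛ) where

        -- A call of the bound variable at `x` is replaced by a derivation of a start node at `x`,
        -- which exists because `x` is reached.
        fold : ∀ X → (∀ x → T (X x) → Reached ρ (x , p)) →
               ∀ {u} → Holds A (extend X ρ) u → LfpHolds ρ (u , p)
        fold X X⊆ (fact f) = fact f
        fold X X⊆ (rule (inj₁ r) h k) = rule (inj₁ (refl , refl , inj₁ r)) (fold X X⊆ h) (fold X X⊆ k)
        fold X X⊆ (rule (inj₂ (zero , x , x∈X , call)) h k) with X⊆ x x∈X
        ... | (w , _) , (refl , st) , l = rule (inj₁ (refl , refl , inj₂ (x , call , st))) l (fold X X⊆ h)
        fold X X⊆ (rule (inj₂ (suc Y , y , y∈Y , call)) h k) =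
          rule (inj₂ (Y , y , y∈Y , refl , call)) (fold X X⊆ h) (fold X X⊆ k)

        closed : ∀ x → Q A (extend (λ x → ⌊ Reached? ρ (x , p) ⌋) ρ) (x , p) → Reached ρ (x , p)
        closed x q with to (correct A many _ (x , p)) q
        ... | u , st , h = (u , p) , (refl , st) , fold _ (λ _ → toWitness) h

        -- By induction, the derivation of a start node at `x` becomes one that calls `X`.
        -- Correctness of the body then gives `Q` at `x`, and closedness puts `x` into `X`, so the
        -- rule can be read as a call again.
        unfold : ∀ X → (∀ x → Q A (extend X ρ) (x , p) → T (X x)) →
                 ∀ {u} → LfpHolds ρ (u , p) → Holds A (extend X ρ) u
        unfold X X-closed (fact f) = fact f
        unfold X X-closed (rule (inj₁ (refl , refl , inj₁ r)) h k) =
          rule (inj₁ r) (unfold X X-closed h) (unfold X X-closed k)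
        unfold X X-closed (rule (inj₁ (refl , refl , inj₂ (x , call , st))) h k) =
          rule (inj₂ (zero , x , X-closed x (from (correct A many _ (x , p))
                                  (_ , st , unfold X X-closed h)) , call))
               (unfold X X-closed k) (unfold X X-closed k)
        unfold X X-closed (rule (inj₂ (Y , y , y∈Y , refl , call)) h k) =
          rule (inj₂ (suc Y , y , y∈Y , call)) (unfold X X-closed h) (unfold X X-closed h)

  lookup≡S : (x y : Fin n) → DefS (vec n) (λ A v → lookup v x ≡ lookup v y)
  lookup≡S x y = valuesS (x ∷ y ∷ []) (vecS ≡-def)

  satLFP-C : (φ : PosLFP σ Γ n) → Existential φ → Compiled Γ (vec n) (λ A ρ v → satLFP A φ ρ v)
  satLFP-C (atom R xs)  ex = literalC (valuesS xs (vecS (atom-def R)))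
  satLFP-C (¬atom R xs) ex = literalC (¬S (valuesS xs (vecS (atom-def R))))
  satLFP-C (x ≐ y)      ex = literalC (lookup≡S x y)
  satLFP-C (x ≐̸ y)      ex = literalC (¬S (lookup≡S x y))
  satLFP-C (fpvar X xs) ex = mapC (λ v → values v xs) (values-natural xs) (variableC X)
  satLFP-C (φ ∧ ψ) (ex , ex′) = satLFP-C φ ex ×C satLFP-C ψ ex′
  satLFP-C (φ ∨ ψ) (ex , ex′) = satLFP-C φ ex ⊎C satLFP-C ψ ex′
  satLFP-C {n = n} (∃∙ φ) ex = respC
    (λ A ρ v → mk⇔ (λ { (a ∷ [] , h) → a , h }) (λ (a , h) → a ∷ [] , h))
    (∃C (vec 1) (mapC {t = vec 1 ⊗ vec n} (λ (a , v) → a ++ v) (λ g (a , v) → sym (Vec.map-++ g a v))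
      (satLFP-C φ ex)))
  satLFP-C {n = n} (lfp r φ xs) ex =
    mapC (λ v → values v xs , v) (λ g v → cong (_, map g v) (values-natural xs g v))
      (lfpC (mapC {t = vec r ⊗ vec n} (λ (a , v) → a ++ v) (λ g (a , v) → sym (Vec.map-++ g a v))
        (satLFP-C φ ex)))

  signed : Sign → Set → Set
  signed pos X = X
  signed neg X = ¬ X

  module _ (I : (S : Symbol τ) → SQuery σ (vec (arity τ S))) (IS : ∀ S → DefS (vec (arity τ S)) (I S)) where

    satQF? : ∀ {s} A (θ : QF σ τ r n s) X v → Dec (satQF A θ (λ S → I S A) X v)
    satQF? A (atom R xs) X v = T? _
    satQF? A (x ≐ y)     X v = _ Fin.≟ _
    satQF? A (add S xs)  X v = decS (IS S) A (values v xs)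
    satQF? A (rec xs)    X v = T? _
    satQF? A (¬∙ θ)      X v = ¬? (satQF? A θ X v)
    satQF? A (θ ∧ η)     X v = satQF? A θ X v ×-dec satQF? A η X v
    satQF? A (θ ∨ η)     X v = satQF? A θ X v ⊎-dec satQF? A η X v

    -- Negations are pushed inwards on the fly: a formula of sign `neg` is compiled as its
    -- complement. The recursion variable has no constructor at that sign, so only definable
    -- literals are ever complemented.
    satQF-C : ∀ s (θ : QF σ τ r n s) → Compiled (r ∷ []) (vec n)
              (λ A ρ v → signed s (satQF A θ (λ S → I S A) (ρ zero) v))
    satQF-C pos (atom R xs) = literalC (valuesS xs (vecS (atom-def R)))
    satQF-C neg (atom R xs) = literalC (¬S (valuesS xs (vecS (atom-def R))))
    satQF-C pos (x ≐ y)     = literalC (lookup≡S x y)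
    satQF-C neg (x ≐ y)     = literalC (¬S (lookup≡S x y))
    satQF-C pos (add S xs)  = literalC (valuesS xs (IS S))
    satQF-C neg (add S xs)  = literalC (¬S (valuesS xs (IS S)))
    satQF-C pos (rec xs)    = mapC (λ v → values v xs) (values-natural xs) (variableC zero)
    satQF-C pos (¬∙ θ)      = satQF-C neg θ
    satQF-C neg (¬∙ θ)      = respC
      (λ A ρ v → mk⇔ (λ h ¬h → ¬h h) (Dec.decidable-stable (satQF? A θ _ v))) (satQF-C pos θ)
    satQF-C pos (θ ∧ η)     = satQF-C pos θ ×C satQF-C pos η
    satQF-C neg (θ ∧ η)     = respC
      (λ A ρ v → mk⇔ (λ { (inj₁ ¬h) (h , _) → ¬h h ; (inj₂ ¬k) (_ , k) → ¬k k })
        (λ ¬hk → case satQF? A θ _ v of λ where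
          (yes h) → inj₂ λ k → ¬hk (h , k)
          (no ¬h) → inj₁ ¬h))
      (satQF-C neg θ ⊎C satQF-C neg η)
    satQF-C pos (θ ∨ η)     = satQF-C pos θ ⊎C satQF-C pos η
    satQF-C neg (θ ∨ η)     = respC
      (λ A ρ v → mk⇔ (λ { (¬h , _) (inj₁ h) → ¬h h ; (_ , ¬k) (inj₂ k) → ¬k k })
        (λ ¬hk → ¬hk ∘ inj₁ , ¬hk ∘ inj₂))
      (satQF-C neg θ ×C satQF-C neg η)

  -- The substituted formulas of the previous stratum are definable by induction, so they enter the
  -- compilation as literals of either sign. This is how stratified negation is absorbed by closure
  -- under complement.
  satEFP-S : ∀ {ℓ} (φ : EFP σ ℓ n) → DefS (vec n) (λ A v → satEFP A φ v)
  satEFP-S (base φ ex) = executeC (satLFP-C φ ex) _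
  satEFP-S (φ ∧ ψ)     = satEFP-S φ ×S satEFP-S ψ
  satEFP-S (φ ∨ ψ)     = satEFP-S φ ⊎S satEFP-S ψ
  satEFP-S (∃∙ φ)      = ∃₁S (satEFP-S φ)
  satEFP-S {n} (lfp r m τ θ ψ xs) =
    renS (λ v → values v xs , []) (λ g v → cong (_, []) (values-natural xs g v))
      (executeC
        (lfpC {t = vec 0} (mapC {t = vec r ⊗ vec 0} proj₁ (λ _ _ → refl)
          (∃C (vec m) (mapC {t = vec m ⊗ vec r} (λ (b , a) → a ++ b) (λ g (b , a) → sym (Vec.map-++ g a b))
            (satQF-C _ (satEFP-S ∘ ψ) pos θ)))))
        λ _ _ ())

-- Formulas encoded by structures up to a congruence

∈⇔lookup : {p : Subset n} {x : Fin n} → x ∈ p ⇔ T (lookup p x)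
∈⇔lookup {p = p} {x} = mk⇔
  (λ x∈p → subst T (sym (Vec.[]=⇒lookup x∈p)) tt)
  (λ t → Vec.lookup⇒[]= x p (T⇒≡true t))
  where
  T⇒≡true : ∀ {b} → T b → b ≡ true
  T⇒≡true {true} _ = refl

∈-tabulate : {f : Fin n → Bool} {x : Fin n} → x ∈ tabulate f ⇔ T (f x)
∈-tabulate {f = f} {x} = ⇔-trans ∈⇔lookup (≡⇒⇔ (cong T (Vec.lookup∘tabulate f x)))

module CNFPreStructure (B : PreStructure CNFVoc) where
  open PreStructure B

  IsClause IsVariable : Carrier → Set
  IsClause   x = holds C (x ∷ [])
  IsVariable x = holds V (x ∷ [])

  Positive Negative : Carrier → Carrier → Set
  Positive v c = holds P (v ∷ c ∷ [])
  Negative v c = holds N (v ∷ c ∷ [])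

  record WellFormed : Set where
    field
      sort : ∀ x → (IsClause x × ¬ IsVariable x) ⊎ (IsVariable x × ¬ IsClause x)
      Positive-sorts : ∀ v c → Positive v c → IsVariable v × IsClause c
      Negative-sorts : ∀ v c → Negative v c → IsVariable v × IsClause c

  -- Bypasses the quotient: the clauses and variables of `ψ` index systems of representatives of the
  -- congruence classes, and literals are compared on these representatives.
  record Represents (ψ : CNF) : Set where
    field
      clauseRep : Fin (#clauses ψ) → Carrier
      varRep    : Fin (#vars ψ) → Carrier
      clauseRep-clause   : ∀ i → IsClause (clauseRep i)
      varRep-variable    : ∀ j → IsVariable (varRep j)
      clauseRep-onto     : ∀ x → IsClause x → ∃[ i ] (x ∼ clauseRep i)
      varRep-onto        : ∀ x → IsVariable x → ∃[ j ] (x ∼ varRep j)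
      clauseRep-injective : ∀ {i i′} → clauseRep i ∼ clauseRep i′ → i ≡ i′
      varRep-injective    : ∀ {j j′} → varRep j ∼ varRep j′ → j ≡ j′
      Positive⇔ : ∀ {i j} → Positive (varRep j) (clauseRep i) ⇔ j ∈ positive (clauseAt ψ i)
      Negative⇔ : ∀ {i j} → Negative (varRep j) (clauseRep i) ⇔ j ∈ negative (clauseAt ψ i)

  Res-represents : QuotientIn (k -Res) B →
                   IsCongruence B × WellFormed × Σ[ ψ ∈ CNF ] (Represents ψ × Derivable k ψ □)
  Res-represents {k} (congruence , D , iso , ψ , encodes , derivable) =
    congruence , wellFormed , ψ , represents , derivable
    where
    open QuotientIso iso renaming (to to quotient; cong to quotient-cong)
    open Encodes encodes
    open ≡-Reasoning

    Element : Set
    Element = Fin (#clauses ψ) ⊎ Fin (#vars ψ)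

    code : Carrier → Element
    code x = Inverse.from universe (quotient x)

    rep : Element → Carrier
    rep e = proj₁ (proj₂ bijective (Inverse.to universe e))

    code-cong : ∀ {x y} → x ∼ y → code x ≡ code y
    code-cong x∼y = cong (Inverse.from universe) (quotient-cong x∼y)

    code-injective : ∀ {x y} → code x ≡ code y → x ∼ y
    code-injective {x} {y} eq = proj₁ bijective (begin
      quotient x                  ≡⟨ Inverse.inverseˡ universe refl ⟨
      Inverse.to universe (code x) ≡⟨ cong (Inverse.to universe) eq ⟩
      Inverse.to universe (code y) ≡⟨ Inverse.inverseˡ universe refl ⟩
      quotient y                  ∎)

    code-rep : ∀ e → code (rep e) ≡ e
    code-rep e = Inverse.inverseʳ universe
      (proj₂ (proj₂ bijective (Inverse.to universe e)) (IsEquivalence.refl (IsCongruence.isEquivalence congruence)))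

    holds⇔ : ∀ S us → holds S us ⇔ T (encoding ψ S (map code us))
    holds⇔ S us = ⇔-trans (preserves S us) (≡⇒⇔ (cong T (begin
      rel D S (map quotient us)
        ≡⟨ cong (rel D S) (Vec.map-cong (λ x → sym (Inverse.inverseˡ universe refl)) us) ⟩
      rel D S (map (Inverse.to universe ∘ code) us)
        ≡⟨ cong (rel D S) (Vec.map-∘ (Inverse.to universe) code us) ⟩
      rel D S (map (Inverse.to universe) (map code us))
        ≡⟨ relations S (map code us) ⟩
      encoding ψ S (map code us) ∎)))

    wellFormed : WellFormed
    wellFormed = record
      { sort = sort
      ; Positive-sorts = λ v c h →
          positive-sorts (code v) (code c) (to (holds⇔ P _) h) (holds⇔ V (v ∷ [])) (holds⇔ C (c ∷ []))
      ; Negative-sorts = λ v c h →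
          negative-sorts (code v) (code c) (to (holds⇔ N _) h) (holds⇔ V (v ∷ [])) (holds⇔ C (c ∷ []))
      }
      where
      sort : ∀ x → (IsClause x × ¬ IsVariable x) ⊎ (IsVariable x × ¬ IsClause x)
      sort x with code x | holds⇔ C (x ∷ []) | holds⇔ V (x ∷ [])
      ... | inj₁ _ | c | v = inj₁ (from c tt , to v)
      ... | inj₂ _ | c | v = inj₂ (from v tt , to c)

      positive-sorts : ∀ d e {X Y : Set} → T (encoding ψ P (d ∷ e ∷ [])) →
        X ⇔ T (encoding ψ V (d ∷ [])) → Y ⇔ T (encoding ψ C (e ∷ [])) → X × Y
      positive-sorts (inj₂ _) (inj₁ _) _ x y = from x tt , from y tt
      positive-sorts (inj₁ _) (inj₁ _) ()
      positive-sorts (inj₁ _) (inj₂ _) ()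
      positive-sorts (inj₂ _) (inj₂ _) ()

      negative-sorts : ∀ d e {X Y : Set} → T (encoding ψ N (d ∷ e ∷ [])) →
        X ⇔ T (encoding ψ V (d ∷ [])) → Y ⇔ T (encoding ψ C (e ∷ [])) → X × Y
      negative-sorts (inj₂ _) (inj₁ _) _ x y = from x tt , from y tt
      negative-sorts (inj₁ _) (inj₁ _) ()
      negative-sorts (inj₁ _) (inj₂ _) ()
      negative-sorts (inj₂ _) (inj₂ _) ()

    rep-holds⇔ : ∀ S es → holds S (map rep es) ⇔ T (encoding ψ S es)
    rep-holds⇔ S es = ⇔-trans (holds⇔ S (map rep es)) (≡⇒⇔ (cong (T ∘ encoding ψ S) (begin
      map code (map rep es) ≡⟨ Vec.map-∘ code rep es ⟨
      map (code ∘ rep) es   ≡⟨ Vec.map-cong code-rep es ⟩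
      map id es             ≡⟨ Vec.map-id es ⟩
      es                    ∎)))

    clause-code : ∀ x → IsClause x → ∃[ i ] (code x ≡ inj₁ i)
    clause-code x h with code x | to (holds⇔ C (x ∷ [])) h
    ... | inj₁ i | _ = i , refl
    ... | inj₂ _ | ()

    var-code : ∀ x → IsVariable x → ∃[ j ] (code x ≡ inj₂ j)
    var-code x h with code x | to (holds⇔ V (x ∷ [])) h
    ... | inj₂ j | _ = j , refl
    ... | inj₁ _ | ()

    rep-injective : ∀ {d e} → rep d ∼ rep e → d ≡ e
    rep-injective {d} {e} r = begin
      d            ≡⟨ code-rep d ⟨
      code (rep d) ≡⟨ code-cong r ⟩
      code (rep e) ≡⟨ code-rep e ⟩
      e            ∎

    represents : Represents ψ
    represents = record
      { clauseRep = rep ∘ inj₁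
      ; varRep    = rep ∘ inj₂
      ; clauseRep-clause = λ i → from (rep-holds⇔ C (inj₁ i ∷ [])) tt
      ; varRep-variable  = λ j → from (rep-holds⇔ V (inj₂ j ∷ [])) tt
      ; clauseRep-onto   = λ x h → let i , eq = clause-code x h
                                   in i , code-injective (trans eq (sym (code-rep _)))
      ; varRep-onto      = λ x h → let j , eq = var-code x h
                                   in j , code-injective (trans eq (sym (code-rep _)))
      ; clauseRep-injective = λ r → inj₁-injective (rep-injective r)
      ; varRep-injective    = λ r → inj₂-injective (rep-injective r)
      ; Positive⇔ = ⇔-trans (rep-holds⇔ P (_ ∷ _ ∷ [])) (⇔-sym ∈⇔lookup)
      ; Negative⇔ = ⇔-trans (rep-holds⇔ N (_ ∷ _ ∷ [])) (⇔-sym ∈⇔lookup)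
      }

  module _ (congruence : IsCongruence B) where
    open IsCongruence congruence
    module ∼ = IsEquivalence isEquivalence

    represents-Res : WellFormed → ∀ {ψ} → Represents ψ → Derivable k ψ □ → QuotientIn (k -Res) B
    represents-Res {k} wellFormed {ψ} represents derivable =
      congruence , D , iso , ψ , encodes , derivable
      where
      open WellFormed wellFormed
      open Represents represents
      open ≡-Reasoning

      c : ℕ
      c = #clauses ψ

      Element : Set
      Element = Fin c ⊎ Fin (#vars ψ)

      -- Universes are nonempty, so the quotient needs an element; a derivation provides one, as it
      -- rests on some input clause.
      someClause : ∀ {d} → Derivable k ψ d → Fin c
      someClause (axiom i _)         = i
      someClause (resolve _ _ _ p _ _) = someClause p

      nonZero : ∀ {m} → Fin m → NonZero (m + #vars ψ)
      nonZero zero    = _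
      nonZero (suc _) = _

      D : Structure CNFVoc
      D = record
        { size = c + #vars ψ
        ; nonZero = nonZero (someClause derivable)
        ; rel = λ R es → encoding ψ R (map (Fin.splitAt c) es)
        }

      rep : Element → Carrier
      rep (inj₁ i) = clauseRep i
      rep (inj₂ j) = varRep j

      classify : ∀ x → ∃[ e ] (x ∼ rep e)
      classify x with sort x
      ... | inj₁ (h , _) = let i , r = clauseRep-onto x h in inj₁ i , r
      ... | inj₂ (h , _) = let j , r = varRep-onto x h in inj₂ j , r

      code : Carrier → Element
      code = proj₁ ∘ classify

      clause≁variable : ∀ {i j} → ¬ (clauseRep i ∼ varRep j)
      clause≁variable {i} {j} r with sort (clauseRep i)
      ... | inj₁ (_ , ¬h) = ¬h (compatible V (∼.sym r ∷ []) (varRep-variable j))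
      ... | inj₂ (_ , ¬h) = ¬h (clauseRep-clause i)

      rep-injective : ∀ d e → rep d ∼ rep e → d ≡ e
      rep-injective (inj₁ _) (inj₁ _) r = cong inj₁ (clauseRep-injective r)
      rep-injective (inj₁ _) (inj₂ _) r = contradiction r clause≁variable
      rep-injective (inj₂ _) (inj₁ _) r = contradiction (∼.sym r) clause≁variable
      rep-injective (inj₂ _) (inj₂ _) r = cong inj₂ (varRep-injective r)

      not-variable : ∀ {i} → ¬ IsVariable (clauseRep i)
      not-variable {i} h with sort (clauseRep i)
      ... | inj₁ (_ , ¬h) = ¬h h
      ... | inj₂ (_ , ¬c) = ¬c (clauseRep-clause i)

      not-clause : ∀ {j} → ¬ IsClause (varRep j)
      not-clause {j} h with sort (varRep j)
      ... | inj₁ (_ , ¬v) = ¬v (varRep-variable j)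
      ... | inj₂ (_ , ¬h) = ¬h h

      rep-holds : ∀ S es → holds S (map rep es) ⇔ T (encoding ψ S es)
      rep-holds C (inj₁ i ∷ []) = mk⇔ _ (λ _ → clauseRep-clause i)
      rep-holds C (inj₂ j ∷ []) = mk⇔ not-clause λ ()
      rep-holds V (inj₁ i ∷ []) = mk⇔ not-variable λ ()
      rep-holds V (inj₂ j ∷ []) = mk⇔ _ (λ _ → varRep-variable j)
      rep-holds P (inj₂ j ∷ inj₁ i ∷ []) = ⇔-trans Positive⇔ ∈⇔lookup
      rep-holds P (inj₁ _ ∷ inj₁ _ ∷ []) = mk⇔ (not-variable ∘ proj₁ ∘ Positive-sorts _ _) λ ()
      rep-holds P (inj₁ _ ∷ inj₂ _ ∷ []) = mk⇔ (not-variable ∘ proj₁ ∘ Positive-sorts _ _) λ ()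
      rep-holds P (inj₂ _ ∷ inj₂ _ ∷ []) = mk⇔ (not-clause ∘ proj₂ ∘ Positive-sorts _ _) λ ()
      rep-holds N (inj₂ j ∷ inj₁ i ∷ []) = ⇔-trans Negative⇔ ∈⇔lookup
      rep-holds N (inj₁ _ ∷ inj₁ _ ∷ []) = mk⇔ (not-variable ∘ proj₁ ∘ Negative-sorts _ _) λ ()
      rep-holds N (inj₁ _ ∷ inj₂ _ ∷ []) = mk⇔ (not-variable ∘ proj₁ ∘ Negative-sorts _ _) λ ()
      rep-holds N (inj₂ _ ∷ inj₂ _ ∷ []) = mk⇔ (not-clause ∘ proj₂ ∘ Negative-sorts _ _) λ ()

      map-rep-code : ∀ {n} (us : Vec Carrier n) → Pointwise _∼_ us (map rep (map code us))
      map-rep-code []       = []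
      map-rep-code (x ∷ us) = proj₂ (classify x) ∷ map-rep-code us

      encode : Element → Fin (c + #vars ψ)
      encode = Fin.join c (#vars ψ)

      split-map-encode : ∀ {n} (es : Vec Element n) → map (Fin.splitAt c) (map encode es) ≡ es
      split-map-encode es = begin
        map (Fin.splitAt c) (map encode es) ≡⟨ Vec.map-∘ (Fin.splitAt c) encode es ⟨
        map (Fin.splitAt c ∘ encode) es     ≡⟨ Vec.map-cong (Fin.splitAt-join c (#vars ψ)) es ⟩
        map id es                           ≡⟨ Vec.map-id es ⟩
        es                                  ∎

      code-unique : ∀ x e → x ∼ rep e → code x ≡ e
      code-unique x e r = rep-injective (code x) e (∼.trans (∼.sym (proj₂ (classify x))) r)

      iso : QuotientIso B D
      iso = record
        { to = encode ∘ code
        ; cong = λ {x} {y} x∼y → cong encode (code-unique x (code y) (∼.trans x∼y (proj₂ (classify y))))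
        ; bijective =
            (λ {x} {y} eq → ∼.trans (proj₂ (classify x)) (subst (λ e → rep e ∼ y)
              (sym (encode-injective {code x} {code y} eq)) (∼.sym (proj₂ (classify y))))) ,
            (λ d → rep (Fin.splitAt c d) , λ {z} r →
              trans (cong encode (code-unique z (Fin.splitAt c d) r)) (Fin.join-splitAt c (#vars ψ) d))
        ; preserves = λ S us → ⇔-trans
            (mk⇔ (compatible S (map-rep-code us)) (compatible S (Pointwise.sym ∼.sym (map-rep-code us))))
            (⇔-trans (rep-holds S (map code us)) (≡⇒⇔ (cong (T ∘ encoding ψ S) (begin
              map code us                                  ≡⟨ split-map-encode (map code us) ⟨
              map (Fin.splitAt c) (map encode (map code us)) ≡⟨ cong (map (Fin.splitAt c)) (Vec.map-∘ encode code us) ⟨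
              map (Fin.splitAt c) (map (encode ∘ code) us) ∎))))
        }
        where
        encode-injective : ∀ {d e} → encode d ≡ encode e → d ≡ e
        encode-injective {d} {e} eq = begin
          d                          ≡⟨ Fin.splitAt-join c (#vars ψ) d ⟨
          Fin.splitAt c (encode d)   ≡⟨ cong (Fin.splitAt c) eq ⟩
          Fin.splitAt c (encode e)   ≡⟨ Fin.splitAt-join c (#vars ψ) e ⟩
          e                          ∎

      encodes : Encodes D ψ
      encodes = record
        { universe = mk↔ₛ′ encode (Fin.splitAt c) (Fin.join-splitAt c (#vars ψ)) (Fin.splitAt-join c (#vars ψ))
        ; relations = λ R es → cong (encoding ψ R) (split-map-encode es)
        }

    module _ (_∼?_ : ∀ x y → Dec (x ∼ y)) where

      record Representatives (Q : Carrier → Set) (L : List Carrier) : Set where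
        field
          {count}     : ℕ
          member      : Fin count → Carrier
          satisfies   : ∀ i → Q (member i)
          covers      : ∀ x → Q x → Any (x ∼_) L → ∃[ i ] (x ∼ member i)
          inequivalent : ∀ {i j} → member i ∼ member j → i ≡ j

      -- Greedy thinning: an element of the list is kept if it satisfies `Q` and is equivalent to
      -- none of those kept so far.
      representatives : {Q : Carrier → Set} → (∀ x → Dec (Q x)) → (∀ {x y} → x ∼ y → Q x → Q y) →
                        ∀ L → Representatives Q L
      representatives Q? resp [] = record
        { count = 0 ; member = λ () ; satisfies = λ () ; covers = λ _ _ () ; inequivalent = λ { {()} } }
      representatives {Q} Q? resp (x ∷ L)
        with representatives Q? resp L
      ... | R with Q? x | Fin.any? (λ i → x ∼? Representatives.member R i)
      ... | no ¬q | _ = record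
        { Representatives R
        ; covers = λ { y q (here y∼x) → contradiction (resp y∼x q) ¬q
                     ; y q (there y∈L) → Representatives.covers R y q y∈L } }
      ... | yes q | yes (i , x∼i) = record
        { Representatives R
        ; covers = λ { y _ (here y∼x) → i , ∼.trans y∼x x∼i
                     ; y q (there y∈L) → Representatives.covers R y q y∈L } }
      ... | yes q | no new = record
        { member = λ { zero → x ; (suc i) → member i }
        ; satisfies = λ { zero → q ; (suc i) → satisfies i }
        ; covers = λ { y _ (here y∼x) → zero , y∼x
                     ; y q (there y∈L) → let i , r = covers y q y∈L in suc i , r }
        ; inequivalent = λ { {zero} {zero} _ → refl
                           ; {zero} {suc j} r → contradiction (j , r) new
                           ; {suc i} {zero} r → contradiction (i , ∼.sym r) new
                           ; {suc i} {suc j} r → cong suc (inequivalent r) }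
        }
        where open Representatives R

      represent : (∀ S us → Dec (holds S us)) → (L : List Carrier) → (∀ x → Any (x ∼_) L) → ∃ Represents
      represent holds? L covered = ψ , record
        { clauseRep = 𝒞.member
        ; varRep    = 𝒱.member
        ; clauseRep-clause    = 𝒞.satisfies
        ; varRep-variable     = 𝒱.satisfies
        ; clauseRep-onto      = λ x h → 𝒞.covers x h (covered x)
        ; varRep-onto         = λ x h → 𝒱.covers x h (covered x)
        ; clauseRep-injective = 𝒞.inequivalent
        ; varRep-injective    = 𝒱.inequivalent
        ; Positive⇔ = ⇔-trans (mk⇔ fromWitness toWitness) (⇔-sym ∈-tabulate)
        ; Negative⇔ = ⇔-trans (mk⇔ fromWitness toWitness) (⇔-sym ∈-tabulate)
        }
        where
        module 𝒞 = Representatives (representatives (λ x → holds? C (x ∷ [])) (λ r → compatible C (r ∷ [])) L)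
        module 𝒱 = Representatives (representatives (λ x → holds? V (x ∷ [])) (λ r → compatible V (r ∷ [])) L)
        ψ : CNF
        ψ = record
          { #vars = 𝒱.count
          ; #clauses = 𝒞.count
          ; clauseAt = λ i → clause
              (tabulate λ j → ⌊ holds? P (𝒱.member j ∷ 𝒞.member i ∷ []) ⌋)
              (tabulate λ j → ⌊ holds? N (𝒱.member j ∷ 𝒞.member i ∷ []) ⌋)
          }

-- Subsets and resolvents in terms of membership

∈─⇒∉ : ∀ {x} (p q : Subset n) → x ∈ p ─ q → ¬ x ∈ q
∈─⇒∉ (_ ∷ p) (true  ∷ q) (there x∈p─q) (there x∈q) = ∈─⇒∉ p q x∈p─q x∈q
∈─⇒∉ (_ ∷ p) (false ∷ q) (there x∈p─q) (there x∈q) = ∈─⇒∉ p q x∈p─q x∈q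

∈-⇔ : {p : Subset n} {x y : Fin n} → x ∈ p - y ⇔ (x ∈ p × x ≢ y)
∈-⇔ {p = p} {x} {y} = mk⇔
  (λ h → p─q⊆p p ⁅ y ⁆ h , λ { refl → ∈─⇒∉ p ⁅ y ⁆ h (x∈⁅x⁆ y) })
  (λ (x∈p , x≢y) → x∈p∧x≢y⇒x∈p-y x∈p x≢y)

subset-ext : {p q : Subset n} → (∀ x → x ∈ p ⇔ x ∈ q) → p ≡ q
subset-ext e = ⊆-antisym (λ {x} → to (e x)) (λ {x} → from (e x))

∣⁅x⁆∪p∣≤1+∣p∣ : ∀ (x : Fin n) p → ∣ ⁅ x ⁆ ∪ p ∣ ≤ suc ∣ p ∣
∣⁅x⁆∪p∣≤1+∣p∣ zero    (true  ∷ p) = s≤s (ℕ.m≤n⇒m≤1+n (ℕ.≤-reflexive (cong ∣_∣ (∪-identityˡ p))))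
∣⁅x⁆∪p∣≤1+∣p∣ zero    (false ∷ p) = s≤s (ℕ.≤-reflexive (cong ∣_∣ (∪-identityˡ p)))
∣⁅x⁆∪p∣≤1+∣p∣ (suc x) (true  ∷ p) = s≤s (∣⁅x⁆∪p∣≤1+∣p∣ x p)
∣⁅x⁆∪p∣≤1+∣p∣ (suc x) (false ∷ p) = ∣⁅x⁆∪p∣≤1+∣p∣ x p

clause-ext : {c d : Clause n} → (∀ j → j ∈ positive c ⇔ j ∈ positive d) →
             (∀ j → j ∈ negative c ⇔ j ∈ negative d) → c ≡ d
clause-ext e f = cong₂ clause (subset-ext e) (subset-ext f)

∈-resolvent⁺ : (x : Fin n) (c d : Clause n) {j : Fin n} →
               j ∈ positive (resolvent x c d) ⇔ ((j ∈ positive c × j ≢ x) ⊎ j ∈ positive d)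
∈-resolvent⁺ x c d = ⇔-trans ∪⇔⊎ (⊎-⇔ ∈-⇔ ⇔-refl)

∈-resolvent⁻ : (x : Fin n) (c d : Clause n) {j : Fin n} →
               j ∈ negative (resolvent x c d) ⇔ (j ∈ negative c ⊎ (j ∈ negative d × j ≢ x))
∈-resolvent⁻ x c d = ⇔-trans ∪⇔⊎ (⊎-⇔ ⇔-refl ∈-⇔)

derivable-width : ∀ {ψ c} → Derivable k ψ c → width c ≤ k
derivable-width (axiom _ w)           = w
derivable-width (resolve _ _ _ _ _ w) = w

-- Resolution with bounded clauses as a Horn closure

module Interpreted {U : Set} (δ : U → Set) (_≈_ : U → U → Set)
                   (holds : (S : Symbol CNFVoc) → Vec U (arity CNFVoc S) → Set) where

  B : PreStructure CNFVoc
  B = record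
    { Carrier = Σ U δ
    ; _∼_     = λ (b , _) (b′ , _) → b ≈ b′
    ; holds   = λ S bs → holds S (map proj₁ bs)
    }

  open CNFPreStructure B public using (WellFormed; Represents; Res-represents; represents-Res; represent)

  Variable : U → Set
  Variable x = δ x × holds V (x ∷ [])

  -- Here and below the conditions on the interpreted structure are stated over all of `U`, with `δ`
  -- as an explicit hypothesis, because in this form they are visibly first-order queries.
  Equivalence≈ : Set
  Equivalence≈ = (∀ x → δ x → x ≈ x) ×
                 (∀ x y → δ x → δ y → x ≈ y → y ≈ x) ×
                 (∀ x y z → δ x → δ y → δ z → x ≈ y → y ≈ z → x ≈ z)

  Compatible₁ : (U → Set) → Set
  Compatible₁ Q = ∀ x y → δ x → δ y → x ≈ y → Q x → Q y

  Compatible₂ : (U → U → Set) → Set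
  Compatible₂ Q = ∀ x y x′ y′ → δ x → δ y → δ x′ → δ y′ → x ≈ x′ → y ≈ y′ → Q x y → Q x′ y′

  Congruence : Set
  Congruence = Equivalence≈ ×
    Compatible₁ (λ x → holds C (x ∷ [])) × Compatible₁ (λ x → holds V (x ∷ [])) ×
    Compatible₂ (λ x y → holds P (x ∷ y ∷ [])) × Compatible₂ (λ x y → holds N (x ∷ y ∷ []))

  isCongruence : Congruence ⇔ IsCongruence B
  isCongruence = mk⇔
    (λ ((r , s , t) , cC , cV , cP , cN) → record
      { isEquivalence = record
        { refl  = λ { {x , dx} → r x dx }
        ; sym   = λ { {x , dx} {y , dy} → s x y dx dy }
        ; trans = λ { {x , dx} {y , dy} {z , dz} → t x y z dx dy dz } }
      ; compatible = λ
        { C {(x , dx) ∷ []} {(y , dy) ∷ []} (e ∷ []) → cC x y dx dy e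
        ; V {(x , dx) ∷ []} {(y , dy) ∷ []} (e ∷ []) → cV x y dx dy e
        ; P {(x , dx) ∷ (y , dy) ∷ []} {(x′ , dx′) ∷ (y′ , dy′) ∷ []} (e ∷ f ∷ []) →
            cP x y x′ y′ dx dy dx′ dy′ e f
        ; N {(x , dx) ∷ (y , dy) ∷ []} {(x′ , dx′) ∷ (y′ , dy′) ∷ []} (e ∷ f ∷ []) →
            cN x y x′ y′ dx dy dx′ dy′ e f }
      })
    toCongruence
    where
    toCongruence : IsCongruence B → Congruence
    toCongruence c =
      ((λ x dx → IsEquivalence.refl isEquivalence {x , dx}) ,
       (λ x y dx dy → IsEquivalence.sym isEquivalence {x , dx} {y , dy}) ,
       (λ x y z dx dy dz → IsEquivalence.trans isEquivalence {x , dx} {y , dy} {z , dz})) ,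
      (λ x y dx dy e → compatible C {(x , dx) ∷ []} {(y , dy) ∷ []} (e ∷ [])) ,
      (λ x y dx dy e → compatible V {(x , dx) ∷ []} {(y , dy) ∷ []} (e ∷ [])) ,
      (λ x y x′ y′ dx dy dx′ dy′ e f →
        compatible P {(x , dx) ∷ (y , dy) ∷ []} {(x′ , dx′) ∷ (y′ , dy′) ∷ []} (e ∷ f ∷ [])) ,
      (λ x y x′ y′ dx dy dx′ dy′ e f →
        compatible N {(x , dx) ∷ (y , dy) ∷ []} {(x′ , dx′) ∷ (y′ , dy′) ∷ []} (e ∷ f ∷ []))
      where open IsCongruence c

  Sorted : Set
  Sorted =
    (∀ x → δ x → (holds C (x ∷ []) × ¬ holds V (x ∷ [])) ⊎ (holds V (x ∷ []) × ¬ holds C (x ∷ []))) ×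
    (∀ v c → δ v → δ c → holds P (v ∷ c ∷ []) → holds V (v ∷ []) × holds C (c ∷ [])) ×
    (∀ v c → δ v → δ c → holds N (v ∷ c ∷ []) → holds V (v ∷ []) × holds C (c ∷ []))

  wellFormed : Sorted ⇔ WellFormed
  wellFormed = mk⇔
    (λ (s , ps , ns) → record
      { sort = λ (x , dx) → s x dx
      ; Positive-sorts = λ (v , dv) (c , dc) → ps v c dv dc
      ; Negative-sorts = λ (v , dv) (c , dc) → ns v c dv dc })
    (λ w →
      (λ x dx → CNFPreStructure.WellFormed.sort w (x , dx)) ,
      (λ v c dv dc → CNFPreStructure.WellFormed.Positive-sorts w (v , dv) (c , dc)) ,
      (λ v c dv dc → CNFPreStructure.WellFormed.Negative-sorts w (v , dv) (c , dc)))

  represented : Finite U → (∀ x → Dec (δ x)) → (∀ x y → Dec (x ≈ y)) → (∀ S us → Dec (holds S us)) →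
                IsCongruence B → ∃ Represents
  represented 𝒰 δ? _≈?_ holds? congruence =
    represent congruence (λ (x , _) (y , _) → x ≈? y) (λ S us → holds? S (map proj₁ us))
      (proj₁ cover) (λ (x , dx) → proj₂ cover x dx (Finite.complete 𝒰 x))
    where
    open IsEquivalence (IsCongruence.isEquivalence congruence) using () renaming (refl to ∼-refl)
    -- Proofs of `δ x` need not be unique, so the carrier is enumerated only up to `≈`, with one
    -- proof for each element of `U` that has any.
    covering : (L : List U) →
               Σ[ M ∈ List (Σ U δ) ] (∀ x → δ x → x ∈ˡ L → Any (λ (y , _) → x ≈ y) M)
    covering [] = [] , λ _ _ ()
    covering (x ∷ L) with covering L | δ? x
    ... | M , covers | no ¬dx = M , λ { y dy (here refl) → contradiction dy ¬dx
                                      ; y dy (there y∈L) → covers y dy y∈L }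
    ... | M , covers | yes dx = (x , dx) ∷ M , λ { y dy (here refl) → here (∼-refl {x , dx})
                                                 ; y dy (there y∈L) → there (covers y dy y∈L) }
    cover = covering (Finite.elements 𝒰)

  -- A clause of size at most k is coded by k slots.  A slot (a , b) contributes
  -- the literal a if a is a variable, otherwise the literal ¬b if b is a
  -- variable, and otherwise nothing.
  PositiveIn NegativeIn : Vec (U × U) m → U → Set
  PositiveIn u x = ∃[ i ] (Variable (proj₁ (lookup u i)) × proj₁ (lookup u i) ≈ x)
  NegativeIn u x =
    ∃[ i ] (¬ Variable (proj₁ (lookup u i)) × Variable (proj₂ (lookup u i)) × proj₂ (lookup u i) ≈ x)

  -- The size bound is implicit here and in `Resolvent`: the literals must be exactly those of `u`,
  -- and m slots hold at most m literals.
  Axiom : Vec (U × U) m → Set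
  Axiom u = ∃[ c ] ((δ c × holds C (c ∷ [])) × (∀ x → Variable x →
    (holds P (x ∷ c ∷ []) ⇔ PositiveIn u x) × (holds N (x ∷ c ∷ []) ⇔ NegativeIn u x)))

  Resolvent : (u w w′ : Vec (U × U) m) → Set
  Resolvent u w w′ = ∃[ x ] (Variable x × PositiveIn w x × NegativeIn w′ x × (∀ y → Variable y →
    (PositiveIn u y ⇔ ((PositiveIn w y × ¬ (y ≈ x)) ⊎ PositiveIn w′ y)) ×
    (NegativeIn u y ⇔ (NegativeIn w y ⊎ (NegativeIn w′ y × ¬ (y ≈ x))))))

  Empty : Vec (U × U) m → Set
  Empty u = ∀ y → Variable y → ¬ PositiveIn u y × ¬ NegativeIn u y

  Refutable : ℕ → Set
  Refutable k = Σ[ u ∈ Vec (U × U) k ] (Empty u × Horn Axiom Resolvent u)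

  module _ (congruence : IsCongruence B) (wf : WellFormed) (Variable? : ∀ x → Dec (Variable x))
           {ψ : CNF} (represents : Represents ψ) where
    open CNFPreStructure.Represents represents
    open CNFPreStructure.WellFormed wf
    open IsCongruence congruence
    private module ∼ = IsEquivalence isEquivalence

    index : ∀ {x} → Variable x → Fin (#vars ψ)
    index (dx , v) = proj₁ (varRep-onto (_ , dx) v)

    index-∼ : ∀ {x} (v : Variable x) → x ≈ proj₁ (varRep (index v))
    index-∼ (dx , v) = proj₂ (varRep-onto (_ , dx) v)

    var : Fin (#vars ψ) → U
    var j = proj₁ (varRep j)

    var-variable : ∀ j → Variable (var j)
    var-variable j = proj₂ (varRep j) , varRep-variable j

    ≈-sym : ∀ {x y} → δ x → δ y → x ≈ y → y ≈ x
    ≈-sym dx dy = ∼.sym {_ , dx} {_ , dy}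

    ≈-trans : ∀ {x y z} → δ x → δ y → δ z → x ≈ y → y ≈ z → x ≈ z
    ≈-trans dx dy dz = ∼.trans {_ , dx} {_ , dy} {_ , dz}

    index-≈ : ∀ {x j} (v : Variable x) → index v ≡ j ⇔ (x ≈ var j)
    index-≈ {x} {j} v = mk⇔ (λ { refl → index-∼ v }) λ x≈j → varRep-injective
      (≈-trans (proj₂ (varRep (index v))) (proj₁ v) (proj₂ (varRep j))
        (≈-sym (proj₁ v) (proj₂ (varRep (index v))) (index-∼ v)) x≈j)

    addSlot : U × U → Clause (#vars ψ) → Clause (#vars ψ)
    addSlot (a , b) c with Variable? a | Variable? b
    ... | yes v | _     = clause (⁅ index v ⁆ ∪ positive c) (negative c)
    ... | no _  | yes v = clause (positive c) (⁅ index v ⁆ ∪ negative c)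
    ... | no _  | no _  = c

    toClause : Vec (U × U) m → Clause (#vars ψ)
    toClause []      = □
    toClause (s ∷ u) = addSlot s (toClause u)

    toClause-width : (u : Vec (U × U) m) → width (toClause u) ≤ m
    toClause-width {zero} [] = ℕ.≤-reflexive (cong₂ _+_ (∣⊥∣≡0 (#vars ψ)) (∣⊥∣≡0 (#vars ψ)))
    toClause-width {suc m} ((a , b) ∷ u) with Variable? a | Variable? b
    ... | yes v | _     = ℕ.≤-trans (ℕ.+-monoˡ-≤ _ (∣⁅x⁆∪p∣≤1+∣p∣ (index v) _)) (s≤s (toClause-width u))
    ... | no _  | yes v = ℕ.≤-trans (ℕ.+-monoʳ-≤ ∣ positive (toClause u) ∣ (∣⁅x⁆∪p∣≤1+∣p∣ (index v) _))
      (ℕ.≤-trans (ℕ.≤-reflexive (ℕ.+-suc _ _)) (s≤s (toClause-width u)))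
    ... | no _  | no _  = ℕ.m≤n⇒m≤1+n (toClause-width u)

    ∈-insert : ∀ {x j} (v : Variable x) {p : Subset (#vars ψ)} →
               j ∈ ⁅ index v ⁆ ∪ p ⇔ ((x ≈ var j) ⊎ j ∈ p)
    ∈-insert v = ⇔-trans ∪⇔⊎ (⊎-⇔ (⇔-trans x∈⁅y⁆⇔x≡y (⇔-trans (mk⇔ sym sym) (index-≈ v))) ⇔-refl)

    toClause⁺ : (u : Vec (U × U) m) → ∀ j → j ∈ positive (toClause u) ⇔ PositiveIn u (var j)
    toClause⁺ [] j = mk⇔ (λ j∈∅ → contradiction j∈∅ ∉⊥) λ { (() , _) }
    toClause⁺ ((a , b) ∷ u) j with Variable? a | Variable? b
    ... | yes v | _     = ⇔-trans (∈-insert v) (mk⇔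
      (λ { (inj₁ a≈j) → zero , v , a≈j ; (inj₂ j∈u) → let i , h = to (toClause⁺ u j) j∈u in suc i , h })
      (λ { (zero , _ , a≈j) → inj₁ a≈j ; (suc i , h) → inj₂ (from (toClause⁺ u j) (i , h)) }))
    ... | no ¬v | yes _ = ⇔-trans (toClause⁺ u j) (mk⇔ (λ (i , h) → suc i , h)
      λ { (zero , v , _) → contradiction v ¬v ; (suc i , h) → i , h })
    ... | no ¬v | no _  = ⇔-trans (toClause⁺ u j) (mk⇔ (λ (i , h) → suc i , h)
      λ { (zero , v , _) → contradiction v ¬v ; (suc i , h) → i , h })

    toClause⁻ : (u : Vec (U × U) m) → ∀ j → j ∈ negative (toClause u) ⇔ NegativeIn u (var j)
    toClause⁻ [] j = mk⇔ (λ j∈∅ → contradiction j∈∅ ∉⊥) λ { (() , _) }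
    toClause⁻ ((a , b) ∷ u) j with Variable? a | Variable? b
    ... | no ¬a | yes v = ⇔-trans (∈-insert v) (mk⇔
      (λ { (inj₁ b≈j) → zero , ¬a , v , b≈j ; (inj₂ j∈u) → let i , h = to (toClause⁻ u j) j∈u in suc i , h })
      (λ { (zero , _ , _ , b≈j) → inj₁ b≈j ; (suc i , h) → inj₂ (from (toClause⁻ u j) (i , h)) }))
    ... | yes v | _     = ⇔-trans (toClause⁻ u j) (mk⇔ (λ (i , h) → suc i , h)
      λ { (zero , ¬v , _) → contradiction v ¬v ; (suc i , h) → i , h })
    ... | no _  | no ¬b = ⇔-trans (toClause⁻ u j) (mk⇔ (λ (i , h) → suc i , h)
      λ { (zero , _ , v , _) → contradiction v ¬b ; (suc i , h) → i , h })

    PositiveIn-resp : (u : Vec (U × U) m) → ∀ {x y} → δ x → δ y → x ≈ y → PositiveIn u x ⇔ PositiveIn u y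
    PositiveIn-resp u dx dy x≈y = ∃-⇔ λ i → mk⇔
      (λ (v , a≈x) → v , ≈-trans (proj₁ v) dx dy a≈x x≈y)
      (λ (v , a≈y) → v , ≈-trans (proj₁ v) dy dx a≈y (≈-sym dx dy x≈y))

    NegativeIn-resp : (u : Vec (U × U) m) → ∀ {x y} → δ x → δ y → x ≈ y → NegativeIn u x ⇔ NegativeIn u y
    NegativeIn-resp u dx dy x≈y = ∃-⇔ λ i → mk⇔
      (λ (¬v , v , b≈x) → ¬v , v , ≈-trans (proj₁ v) dx dy b≈x x≈y)
      (λ (¬v , v , b≈y) → ¬v , v , ≈-trans (proj₁ v) dy dx b≈y (≈-sym dx dy x≈y))

    -- `toClause⁺` speaks of the chosen representatives only, while `Axiom` and `Resolvent` quantify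
    -- over all elements that are variables. Invariance under `≈` bridges the difference.
    index⁺ : (u : Vec (U × U) m) → ∀ {x} (v : Variable x) → PositiveIn u x ⇔ index v ∈ positive (toClause u)
    index⁺ u v = ⇔-trans (PositiveIn-resp u (proj₁ v) (proj₂ (varRep (index v))) (index-∼ v))
                         (⇔-sym (toClause⁺ u (index v)))

    index⁻ : (u : Vec (U × U) m) → ∀ {x} (v : Variable x) → NegativeIn u x ⇔ index v ∈ negative (toClause u)
    index⁻ u v = ⇔-trans (NegativeIn-resp u (proj₁ v) (proj₂ (varRep (index v))) (index-∼ v))
                         (⇔-sym (toClause⁻ u (index v)))

    index-≢ : ∀ {x y} (v : Variable x) (w : Variable y) → index v ≢ index w ⇔ (¬ (x ≈ y))
    index-≢ {x} {y} v w = ¬-⇔ (⇔-trans (index-≈ v) (mk⇔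
      (λ e → ≈-trans (proj₁ v) dj (proj₁ w) e (≈-sym (proj₁ w) dj (index-∼ w)))
      (λ e → ≈-trans (proj₁ v) (proj₁ w) dj e (index-∼ w))))
      where dj = proj₂ (varRep (index w))

    index-var : ∀ j → index (var-variable j) ≡ j
    index-var j = from (index-≈ (var-variable j)) (∼.refl {varRep j})

    axiom⇔ : (u : Vec (U × U) m) → Axiom u ⇔ ∃ (λ i → toClause u ≡ clauseAt ψ i)
    axiom⇔ u = mk⇔
      (λ (c , (dc , isC) , literals) →
        let i , c∼i = clauseRep-onto (c , dc) isC in
        i , clause-ext
          (λ j → ⇔-trans (toClause⁺ u j) (⇔-trans (⇔-sym (proj₁ (literals _ (var-variable j))))
                   (⇔-trans (related P (proj₁ (same j {c , dc} {clauseRep i} c∼i)) (proj₂ (same j {c , dc} {clauseRep i} c∼i))) Positive⇔)))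
          (λ j → ⇔-trans (toClause⁻ u j) (⇔-trans (⇔-sym (proj₂ (literals _ (var-variable j))))
                   (⇔-trans (related N (proj₁ (same j {c , dc} {clauseRep i} c∼i)) (proj₂ (same j {c , dc} {clauseRep i} c∼i))) Negative⇔))))
      (λ (i , eq) → proj₁ (clauseRep i) , (proj₂ (clauseRep i) , clauseRep-clause i) , λ x v →
        ⇔-trans (related P (proj₁ (shift v i)) (proj₂ (shift v i))) (⇔-trans Positive⇔ (⇔-trans
          (≡⇒⇔ (cong (λ c → index v ∈ positive c) (sym eq))) (⇔-sym (index⁺ u v)))) ,
        ⇔-trans (related N (proj₁ (shift v i)) (proj₂ (shift v i))) (⇔-trans Negative⇔ (⇔-trans
          (≡⇒⇔ (cong (λ c → index v ∈ negative c) (sym eq))) (⇔-sym (index⁻ u v)))))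
      where
      related : ∀ S {us vs} → Pointwise (PreStructure._∼_ B) us vs → Pointwise (PreStructure._∼_ B) vs us →
                PreStructure.holds B S us ⇔ PreStructure.holds B S vs
      related S r r′ = mk⇔ (compatible S r) (compatible S r′)

      related₂ : ∀ {u v u′ v′} → PreStructure._∼_ B u u′ → PreStructure._∼_ B v v′ →
                 Pointwise (PreStructure._∼_ B) (u ∷ v ∷ []) (u′ ∷ v′ ∷ []) ×
                 Pointwise (PreStructure._∼_ B) (u′ ∷ v′ ∷ []) (u ∷ v ∷ [])
      related₂ {u} {v} {u′} {v′} r r′ = r ∷ r′ ∷ [] , ∼.sym {u} {u′} r ∷ ∼.sym {v} {v′} r′ ∷ []

      same : ∀ j {c c′} → PreStructure._∼_ B c c′ → _
      same j {c} {c′} r = related₂ {varRep j} {c} {varRep j} {c′} (∼.refl {varRep j}) r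

      shift : ∀ {x} (v : Variable x) i → _
      shift {x} v i = related₂ {x , proj₁ v} {clauseRep i} {varRep (index v)} {clauseRep i}
                               (index-∼ v) (∼.refl {clauseRep i})

    resolvent⇔ : (u w w′ : Vec (U × U) m) → Resolvent u w w′ ⇔
      (∃[ j ] (j ∈ positive (toClause w) × j ∈ negative (toClause w′) ×
               toClause u ≡ resolvent j (toClause w) (toClause w′)))
    resolvent⇔ u w w′ = mk⇔
      (λ (x , v , x∈w , x∈w′ , literals) → index v , to (index⁺ w v) x∈w , to (index⁻ w′ v) x∈w′ ,
        clause-ext
          (λ j → ⇔-trans (toClause⁺ u j) (⇔-trans (proj₁ (literals _ (var-variable j)))
            (⇔-trans (⊎-⇔ (×-⇔ (⇔-sym (toClause⁺ w j)) (≉⇔ v j)) (⇔-sym (toClause⁺ w′ j)))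
              (⇔-sym (∈-resolvent⁺ (index v) (toClause w) (toClause w′))))))
          (λ j → ⇔-trans (toClause⁻ u j) (⇔-trans (proj₂ (literals _ (var-variable j)))
            (⇔-trans (⊎-⇔ (⇔-sym (toClause⁻ w j)) (×-⇔ (⇔-sym (toClause⁻ w′ j)) (≉⇔ v j)))
              (⇔-sym (∈-resolvent⁻ (index v) (toClause w) (toClause w′)))))))
      (λ (j , j∈w , j∈w′ , eq) → var j , var-variable j , to (toClause⁺ w j) j∈w , to (toClause⁻ w′ j) j∈w′ ,
        λ y v →
          ⇔-trans (index⁺ u v) (⇔-trans (≡⇒⇔ (cong (λ c → index v ∈ positive c) eq))
            (⇔-trans (∈-resolvent⁺ j (toClause w) (toClause w′))
              (⊎-⇔ (×-⇔ (⇔-sym (index⁺ w v)) (≢⇔ v j)) (⇔-sym (index⁺ w′ v))))) ,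
          ⇔-trans (index⁻ u v) (⇔-trans (≡⇒⇔ (cong (λ c → index v ∈ negative c) eq))
            (⇔-trans (∈-resolvent⁻ j (toClause w) (toClause w′))
              (⊎-⇔ (⇔-sym (index⁻ w v)) (×-⇔ (⇔-sym (index⁻ w′ v)) (≢⇔ v j))))))
      where
      ≢⇔ : ∀ {y} (v : Variable y) j → index v ≢ j ⇔ (¬ (y ≈ var j))
      ≢⇔ v j = ¬-⇔ (index-≈ v)

      ≉⇔ : ∀ {x} (v : Variable x) j → (¬ (var j ≈ x)) ⇔ (j ≢ index v)
      ≉⇔ v j = ⇔-trans (⇔-sym (index-≢ (var-variable j) v))
                       (≡⇒⇔ (cong (_≢ index v) (index-var j)))

    module _ {a : U} (¬a : ¬ Variable a) where

      realise : ∀ m (c : Clause (#vars ψ)) → width c ≤ m → Σ[ u ∈ Vec (U × U) m ] (toClause u ≡ c)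
      realise m (clause p q) w with nonempty? p | nonempty? q
      realise zero (clause p q) w | yes (j , j∈p) | _ =
        contradiction (ℕ.≤-trans (x∈p⇒∣p-x∣<∣p∣ j∈p) (ℕ.≤-trans (ℕ.m≤m+n _ _) w)) λ ()
      realise zero (clause p q) w | no _ | yes (j , j∈q) =
        contradiction (ℕ.≤-trans (x∈p⇒∣p-x∣<∣p∣ j∈q) (ℕ.≤-trans (ℕ.m≤n+m _ ∣ p ∣) w)) λ ()
      realise zero (clause p q) w | no ¬p | no ¬q =
        [] , cong₂ clause (sym (Empty-unique ¬p)) (sym (Empty-unique ¬q))
      realise (suc m) (clause p q) w | yes (j , j∈p) | _
        with realise m (clause (p - j) q)
               (ℕ.≤-pred (ℕ.≤-trans (ℕ.+-monoˡ-≤ ∣ q ∣ (x∈p⇒∣p-x∣<∣p∣ j∈p)) w))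
      ... | u , eq = (var j , a) ∷ u , added
        where
        added : addSlot (var j , a) (toClause u) ≡ clause p q
        added with Variable? (var j)
        ... | yes v = clause-ext
          (λ j′ → ⇔-trans (∈-insert v) (mk⇔
            (λ { (inj₁ j≈j′) → subst (_∈ p) (varRep-injective j≈j′) j∈p
               ; (inj₂ j′∈u) → proj₁ (to ∈-⇔ (subst (λ c → j′ ∈ positive c) eq j′∈u)) })
            (λ j′∈p → case j Fin.≟ j′ of λ where
              (yes refl) → inj₁ (∼.refl {varRep j})
              (no j≢j′)  → inj₂ (subst (λ c → j′ ∈ positive c) (sym eq) (from ∈-⇔ (j′∈p , j≢j′ ∘ sym))))))
          (λ j′ → ≡⇒⇔ (cong (λ c → j′ ∈ negative c) eq))
        ... | no ¬v = contradiction (var-variable j) ¬v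
      realise (suc m) (clause p q) w | no ¬p | yes (j , j∈q)
        with realise m (clause p (q - j))
               (ℕ.≤-pred (ℕ.≤-trans (ℕ.≤-trans (ℕ.≤-reflexive (sym (ℕ.+-suc ∣ p ∣ _)))
                 (ℕ.+-monoʳ-≤ ∣ p ∣ (x∈p⇒∣p-x∣<∣p∣ j∈q))) w))
      ... | u , eq = (a , var j) ∷ u , added
        where
        added : addSlot (a , var j) (toClause u) ≡ clause p q
        added with Variable? a | Variable? (var j)
        ... | yes v | _ = contradiction v ¬a
        ... | no _ | no ¬v = contradiction (var-variable j) ¬v
        ... | no _ | yes v = clause-ext
          (λ j′ → ≡⇒⇔ (cong (λ c → j′ ∈ positive c) eq))
          (λ j′ → ⇔-trans (∈-insert v) (mk⇔
            (λ { (inj₁ j≈j′) → subst (_∈ q) (varRep-injective j≈j′) j∈q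
               ; (inj₂ j′∈u) → proj₁ (to ∈-⇔ (subst (λ c → j′ ∈ negative c) eq j′∈u)) })
            (λ j′∈q → case j Fin.≟ j′ of λ where
              (yes refl) → inj₁ (∼.refl {varRep j})
              (no j≢j′)  → inj₂ (subst (λ c → j′ ∈ negative c) (sym eq) (from ∈-⇔ (j′∈q , j≢j′ ∘ sym))))))
      realise (suc m) (clause p q) w | no ¬p | no ¬q
        with realise m (clause p q) (ℕ.≤-trans (ℕ.≤-reflexive (cong₂ _+_
               (trans (cong ∣_∣ (Empty-unique ¬p)) (∣⊥∣≡0 (#vars ψ)))
               (trans (cong ∣_∣ (Empty-unique ¬q)) (∣⊥∣≡0 (#vars ψ))))) z≤n)
      ... | u , eq = (a , a) ∷ u , trans added eq
        where
        added : addSlot (a , a) (toClause u) ≡ toClause u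
        added with Variable? a
        ... | yes v = contradiction v ¬a
        ... | no _  = refl

      -- A clause has many codes. Proving the claim for all of them leaves the codes of the premises
      -- of a resolution step free to be chosen.
      complete : ∀ {c} → Derivable k ψ c → (u : Vec (U × U) k) → toClause u ≡ c → Horn Axiom Resolvent u
      complete (axiom i _) u eq = fact (from (axiom⇔ u) (i , eq))
      complete (resolve {c} {d} x x∈c x∈d p q _) u eq
        with realise _ c (derivable-width p) | realise _ d (derivable-width q)
      ... | w , refl | w′ , refl =
        rule (from (resolvent⇔ u w w′) (x , x∈c , x∈d , eq)) (complete p w refl) (complete q w′ refl)

    sound : ∀ {u : Vec (U × U) k} → Horn Axiom Resolvent u → Derivable k ψ (toClause u)
    sound {k} {u} (fact h) with to (axiom⇔ u) h
    ... | i , eq = subst (Derivable k ψ) (sym eq)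
      (axiom i (subst (λ c → width c ≤ k) eq (toClause-width u)))
    sound {k} {u} (rule {y = w} {w′} r p q) with to (resolvent⇔ u w w′) r
    ... | j , j∈w , j∈w′ , eq = subst (Derivable k ψ) (sym eq)
      (resolve j j∈w j∈w′ (sound p) (sound q) (subst (λ c → width c ≤ k) eq (toClause-width u)))

    nonvariable : ∀ {c} → Derivable k ψ c → ∃[ a ] (¬ Variable a)
    nonvariable (resolve _ _ _ p _ _) = nonvariable p
    nonvariable (axiom i _) with sort (clauseRep i)
    ... | inj₁ (_ , ¬v) = proj₁ (clauseRep i) , ¬v ∘ proj₂
    ... | inj₂ (_ , ¬c) = contradiction (clauseRep-clause i) ¬c

    refutable⇔ : Refutable k ⇔ Derivable k ψ □
    refutable⇔ {k} = mk⇔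
      (λ (u , empty , h) → subst (Derivable k ψ) (clause-ext
        (λ j → mk⇔ (λ j∈u → contradiction (to (toClause⁺ u j) j∈u) (proj₁ (empty _ (var-variable j))))
                   (λ j∈∅ → contradiction j∈∅ ∉⊥))
        (λ j → mk⇔ (λ j∈u → contradiction (to (toClause⁻ u j) j∈u) (proj₂ (empty _ (var-variable j))))
                   (λ j∈∅ → contradiction j∈∅ ∉⊥)))
        (sound h))
      (λ p → let a , ¬a = nonvariable p ; u , eq = realise ¬a k □ (derivable-width p) in
        u , (λ y v → (λ y∈u → ∉⊥ (subst (λ c → index v ∈ positive c) eq (to (index⁺ u v) y∈u))) ,
                     (λ y∈u → ∉⊥ (subst (λ c → index v ∈ negative c) eq (to (index⁻ u v) y∈u)))) ,
        complete ¬a p u eq)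

  Res⇔ : Finite U → (∀ x → Dec (δ x)) → (∀ x y → Dec (x ≈ y)) → (∀ S us → Dec (holds S us)) →
         QuotientIn (k -Res) B ⇔ (Congruence × Sorted × Refutable k)
  Res⇔ 𝒰 δ? _≈?_ holds? = mk⇔
    (λ h → let congruence , wf , ψ , represents , p = Res-represents h in
      from isCongruence congruence , from wellFormed wf ,
      from (refutable⇔ congruence wf Variable? represents) p)
    (λ (congruence , wf , h) →
      let congruence′ = to isCongruence congruence
          ψ , represents = represented 𝒰 δ? _≈?_ holds? congruence′
      in represents-Res congruence′ (to wellFormed wf) represents
           (to (refutable⇔ congruence′ (to wellFormed wf) Variable? represents) h))
    where
    Variable? : ∀ x → Dec (Variable x)
    Variable? x = δ? x ×-dec holds? V (x ∷ [])

-- Definability of the resolution quantifier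

module ResolutionDefinability {σ : Vocabulary} (L : Logic σ) (k : ℕ) where
  open Logic L

  module _ {d n : ℕ} {δ : SQuery σ (vec d ⊗ vec n)} {≈ : SQuery σ (vec d ⊗ (vec d ⊗ vec n))}
           {holds : (S : Symbol CNFVoc) → SQuery σ (vec d ^ arity CNFVoc S ⊗ vec n)}
           (δS : DefS (vec d ⊗ vec n) δ) (≈S : DefS (vec d ⊗ (vec d ⊗ vec n)) ≈)
           (holdsS : ∀ S → DefS (vec d ^ arity CNFVoc S ⊗ vec n) (holds S)) where

    private
      Node : Shape
      Node = (vec d ⊗ vec d) ^ k

      module I (A : Structure σ) (v : Vec ∣ A ∣ₛ n) =
        Interpreted (λ b → δ A (b , v)) (λ b b′ → ≈ A (b , b′ , v)) (λ S us → holds S A (us , v))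

    clauseS : DefS (vec d ⊗ vec n) (λ A (x , v) → holds C A (x ∷ [] , v))
    clauseS = renS (λ (x , v) → x ∷ [] , v) (λ _ _ → refl) (holdsS C)

    variableS : DefS (vec d ⊗ vec n) (λ A (x , v) → holds V A (x ∷ [] , v))
    variableS = renS (λ (x , v) → x ∷ [] , v) (λ _ _ → refl) (holdsS V)

    positiveS : DefS (vec d ⊗ (vec d ⊗ vec n)) (λ A (x , c , v) → holds P A (x ∷ c ∷ [] , v))
    positiveS = renS (λ (x , c , v) → x ∷ c ∷ [] , v) (λ _ _ → refl) (holdsS P)

    negativeS : DefS (vec d ⊗ (vec d ⊗ vec n)) (λ A (x , c , v) → holds N A (x ∷ c ∷ [] , v))
    negativeS = renS (λ (x , c , v) → x ∷ c ∷ [] , v) (λ _ _ → refl) (holdsS N)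

    compatible₁S : {Q : SQuery σ (vec d ⊗ vec n)} → DefS (vec d ⊗ vec n) Q →
                   DefS (vec n) (λ A v → I.Compatible₁ A v (λ x → Q A (x , v)))
    compatible₁S q = ∀S (vec d) (∀S (vec d)
      (renS (λ (y , x , v) → x , v) (λ _ _ → refl) δS →S
       renS (λ (y , x , v) → y , v) (λ _ _ → refl) δS →S
       renS (λ (y , x , v) → x , y , v) (λ _ _ → refl) ≈S →S
       renS (λ (y , x , v) → x , v) (λ _ _ → refl) q →S
       renS (λ (y , x , v) → y , v) (λ _ _ → refl) q))

    compatible₂S : {Q : SQuery σ (vec d ⊗ (vec d ⊗ vec n))} → DefS (vec d ⊗ (vec d ⊗ vec n)) Q →
                   DefS (vec n) (λ A v → I.Compatible₂ A v (λ x y → Q A (x , y , v)))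
    compatible₂S q = ∀S (vec d) (∀S (vec d) (∀S (vec d) (∀S (vec d)
      (renS (λ (y′ , x′ , y , x , v) → x , v) (λ _ _ → refl) δS →S
       renS (λ (y′ , x′ , y , x , v) → y , v) (λ _ _ → refl) δS →S
       renS (λ (y′ , x′ , y , x , v) → x′ , v) (λ _ _ → refl) δS →S
       renS (λ (y′ , x′ , y , x , v) → y′ , v) (λ _ _ → refl) δS →S
       renS (λ (y′ , x′ , y , x , v) → x , x′ , v) (λ _ _ → refl) ≈S →S
       renS (λ (y′ , x′ , y , x , v) → y , y′ , v) (λ _ _ → refl) ≈S →S
       renS (λ (y′ , x′ , y , x , v) → x , y , v) (λ _ _ → refl) q →S
       renS (λ (y′ , x′ , y , x , v) → x′ , y′ , v) (λ _ _ → refl) q))))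

    congruenceS : DefS (vec n) (λ A v → I.Congruence A v)
    congruenceS =
      (∀S (vec d) (δS →S renS (λ (x , v) → x , x , v) (λ _ _ → refl) ≈S) ×S
       ∀S (vec d) (∀S (vec d)
         (renS (λ (y , x , v) → x , v) (λ _ _ → refl) δS →S
          renS (λ (y , x , v) → y , v) (λ _ _ → refl) δS →S
          renS (λ (y , x , v) → x , y , v) (λ _ _ → refl) ≈S →S
          ≈S)) ×S
       ∀S (vec d) (∀S (vec d) (∀S (vec d)
         (renS (λ (z , y , x , v) → x , v) (λ _ _ → refl) δS →S
          renS (λ (z , y , x , v) → y , v) (λ _ _ → refl) δS →S
          renS (λ (z , y , x , v) → z , v) (λ _ _ → refl) δS →S
          renS (λ (z , y , x , v) → x , y , v) (λ _ _ → refl) ≈S →S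
          renS (λ (z , y , x , v) → y , z , v) (λ _ _ → refl) ≈S →S
          renS (λ (z , y , x , v) → x , z , v) (λ _ _ → refl) ≈S)))) ×S
      compatible₁S clauseS ×S compatible₁S variableS ×S
      compatible₂S positiveS ×S compatible₂S negativeS

    sortedS : DefS (vec n) (λ A v → I.Sorted A v)
    sortedS =
      ∀S (vec d) (δS →S ((clauseS ×S ¬S variableS) ⊎S (variableS ×S ¬S clauseS))) ×S
      ∀S (vec d) (∀S (vec d) (literalSorts positiveS)) ×S
      ∀S (vec d) (∀S (vec d) (literalSorts negativeS))
      where
      literalSorts : {Q : SQuery σ (vec d ⊗ (vec d ⊗ vec n))} → DefS (vec d ⊗ (vec d ⊗ vec n)) Q →
        DefS (vec d ⊗ (vec d ⊗ vec n)) (λ A (c , x , v) → δ A (x , v) → δ A (c , v) → Q A (x , c , v) →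
          holds V A (x ∷ [] , v) × holds C A (c ∷ [] , v))
      literalSorts q =
        renS (λ (c , x , v) → x , v) (λ _ _ → refl) δS →S
        renS (λ (c , x , v) → c , v) (λ _ _ → refl) δS →S
        renS (λ (c , x , v) → x , c , v) (λ _ _ → refl) q →S
        renS (λ (c , x , v) → x , v) (λ _ _ → refl) variableS ×S
        renS (λ (c , x , v) → c , v) (λ _ _ → refl) clauseS

    VariableS : DefS (vec d ⊗ vec n) (λ A (x , v) → I.Variable A v x)
    VariableS = δS ×S variableS

    slot-natural : ∀ i {U W : Set} (g : U → W) (u : ⟦ Node ⟧ U) →
                   lookup (smap Node g u) i ≡ smap (vec d ⊗ vec d) g (lookup u i)
    slot-natural i g u = Vec.lookup-map i (smap (vec d ⊗ vec d) g) u

    PositiveInS : DefS (vec d ⊗ (Node ⊗ vec n)) (λ A (x , u , v) → I.PositiveIn A v u x)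
    PositiveInS = ∃FinS k λ i →
      renS (λ (x , u , v) → proj₁ (lookup u i) , v)
           (λ g (x , u , v) → cong (λ s → proj₁ s , map g v) (slot-natural i g u)) VariableS ×S
      renS (λ (x , u , v) → proj₁ (lookup u i) , x , v)
           (λ g (x , u , v) → cong (λ s → proj₁ s , map g x , map g v) (slot-natural i g u)) ≈S

    NegativeInS : DefS (vec d ⊗ (Node ⊗ vec n)) (λ A (x , u , v) → I.NegativeIn A v u x)
    NegativeInS = ∃FinS k λ i →
      renS (λ (x , u , v) → proj₁ (lookup u i) , v)
           (λ g (x , u , v) → cong (λ s → proj₁ s , map g v) (slot-natural i g u)) (¬S VariableS) ×S
      renS (λ (x , u , v) → proj₂ (lookup u i) , v)
           (λ g (x , u , v) → cong (λ s → proj₂ s , map g v) (slot-natural i g u)) VariableS ×S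
      renS (λ (x , u , v) → proj₂ (lookup u i) , x , v)
           (λ g (x , u , v) → cong (λ s → proj₂ s , map g x , map g v) (slot-natural i g u)) ≈S

    AxiomS : DefS (Node ⊗ vec n) (λ A (u , v) → I.Axiom A v u)
    AxiomS = ∃S (vec d)
      ((renS (λ (c , u , v) → c , v) (λ _ _ → refl) δS ×S
        renS (λ (c , u , v) → c , v) (λ _ _ → refl) clauseS) ×S
       ∀S (vec d)
         (renS (λ (x , c , u , v) → x , v) (λ _ _ → refl) VariableS →S
          ⇔S (renS (λ (x , c , u , v) → x , c , v) (λ _ _ → refl) positiveS)
             (renS (λ (x , c , u , v) → x , u , v) (λ _ _ → refl) PositiveInS) ×S
          ⇔S (renS (λ (x , c , u , v) → x , c , v) (λ _ _ → refl) negativeS)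
             (renS (λ (x , c , u , v) → x , u , v) (λ _ _ → refl) NegativeInS)))

    ResolventS : DefS ((Node ⊗ (Node ⊗ Node)) ⊗ vec n) (λ A ((u , w , w′) , v) → I.Resolvent A v u w w′)
    ResolventS = ∃S (vec d)
      (renS (λ (x , (u , w , w′) , v) → x , v) (λ _ _ → refl) VariableS ×S
       renS (λ (x , (u , w , w′) , v) → x , w , v) (λ _ _ → refl) PositiveInS ×S
       renS (λ (x , (u , w , w′) , v) → x , w′ , v) (λ _ _ → refl) NegativeInS ×S
       ∀S (vec d)
         (renS (λ (y , x , (u , w , w′) , v) → y , v) (λ _ _ → refl) VariableS →S
          ⇔S (renS (λ (y , x , (u , w , w′) , v) → y , u , v) (λ _ _ → refl) PositiveInS)
             ((renS (λ (y , x , (u , w , w′) , v) → y , w , v) (λ _ _ → refl) PositiveInS ×S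
               renS (λ (y , x , (u , w , w′) , v) → y , x , v) (λ _ _ → refl) (¬S ≈S)) ⊎S
              renS (λ (y , x , (u , w , w′) , v) → y , w′ , v) (λ _ _ → refl) PositiveInS) ×S
          ⇔S (renS (λ (y , x , (u , w , w′) , v) → y , u , v) (λ _ _ → refl) NegativeInS)
             (renS (λ (y , x , (u , w , w′) , v) → y , w , v) (λ _ _ → refl) NegativeInS ⊎S
              (renS (λ (y , x , (u , w , w′) , v) → y , w′ , v) (λ _ _ → refl) NegativeInS ×S
               renS (λ (y , x , (u , w , w′) , v) → y , x , v) (λ _ _ → refl) (¬S ≈S)))))

    RefutableS : DefS (vec n) (λ A v → I.Refutable A v k)
    RefutableS = ∃S Node
      (∀S (vec d)
         (renS (λ (y , u , v) → y , v) (λ _ _ → refl) VariableS →S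
          (¬S PositiveInS ×S ¬S NegativeInS)) ×S
       HornS-with Node (vec n) AxiomS ResolventS)

    QuotientS : DefS (vec n) (λ A v → QuotientIn (k -Res) (I.B A v))
    QuotientS = respS
      (λ A v → ⇔-sym (I.Res⇔ A v (Vec-finite Fin-finite d) (λ b → decS δS A (b , v))
        (λ b b′ → decS ≈S A (b , b′ , v)) (λ S us → decS (holdsS S) A (us , v))))
      (congruenceS ×S sortedS ×S RefutableS)

  satFOQ-S : (φ : FOQ CNFVoc σ n) → DefS (vec n) (λ A v → satFOQ (k -Res) A φ v)
  satFOQ-S (atom R xs) = valuesS xs (vecS (atom-def R))
  satFOQ-S (x ≐ y)     = valuesS (x ∷ y ∷ []) (vecS ≡-def)
  satFOQ-S (¬∙ φ)      = ¬S (satFOQ-S φ)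
  satFOQ-S (φ ∧ ψ)     = satFOQ-S φ ×S satFOQ-S ψ
  satFOQ-S (φ ∨ ψ)     = satFOQ-S φ ⊎S satFOQ-S ψ
  satFOQ-S (∃∙ φ)      = ∃₁S (satFOQ-S φ)
  satFOQ-S (∀∙ φ)      = ∀₁S (satFOQ-S φ)
  satFOQ-S {n} (𝒬 (interpretation d δ ≈ φ)) = QuotientS
    (renS {s = vec d ⊗ vec n} (λ (b , v) → b ++ v)
      (λ g (b , v) → sym (Vec.map-++ g b v)) (satFOQ-S δ))
    (renS {s = vec d ⊗ (vec d ⊗ vec n)} (λ (b , b′ , v) → b ++ (b′ ++ v))
      (λ g (b , b′ , v) → sym (trans (Vec.map-++ g b _) (cong (map g b ++_) (Vec.map-++ g b′ v)))) (satFOQ-S ≈))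
    (λ S → renS {s = vec d ^ arity CNFVoc S ⊗ vec n} (λ (us , v) → concat us ++ v)
      (λ g (us , v) → sym (trans (Vec.map-++ g (concat us) v) (cong (_++ map g v) (Vec.map-concat g us))))
      (satFOQ-S (φ S)))

-- Interpretations by equivalent formulas

module _ {U : Set} {δ δ′ : U → Set} {_≈_ _≈′_ : U → U → Set}
         {holds holds′ : (S : Symbol CNFVoc) → Vec U (arity CNFVoc S) → Set}
         (δ⇔ : ∀ b → δ b ⇔ δ′ b) (≈⇔ : ∀ b b′ → (b ≈ b′) ⇔ (b ≈′ b′))
         (holds⇔ : ∀ S us → holds S us ⇔ holds′ S us) where

  -- Equivalent domain formulas have different proofs and so give different carriers. Converting the
  -- proofs leaves the underlying elements alone, hence the same structure `D` is the quotient of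
  -- both.
  quotientIn-resp : {𝒦 : Structure CNFVoc → Set} →
    QuotientIn 𝒦 (Interpreted.B δ _≈_ holds) → QuotientIn 𝒦 (Interpreted.B δ′ _≈′_ holds′)
  quotientIn-resp (congruence , D , iso , D∈𝒦) = record
    { isEquivalence = record
      { refl  = λ {x} → to (≈⇔ _ _) (∼.refl {convert x})
      ; sym   = λ {x} {y} r → to (≈⇔ _ _) (∼.sym {convert x} {convert y} (from (≈⇔ _ _) r))
      ; trans = λ {x} {y} {z} r r′ → to (≈⇔ _ _)
          (∼.trans {convert x} {convert y} {convert z} (from (≈⇔ _ _) r) (from (≈⇔ _ _) r′))
      }
    ; compatible = λ S rs h → to (converted S _) (compatible S (pointwise rs) (from (converted S _) h))
    } , D , record
    { to        = λ x → QuotientIso.to iso (convert x)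
    ; cong      = λ {x} {y} r → QuotientIso.cong iso {convert x} {convert y} (from (≈⇔ _ _) r)
    ; bijective =
        (λ {x} {y} eq → to (≈⇔ _ _) (proj₁ (QuotientIso.bijective iso) {convert x} {convert y} eq)) ,
        (λ d → let (b , db) , h = proj₂ (QuotientIso.bijective iso) d
               in (b , to (δ⇔ b) db) , λ {z} r → h {convert z} (from (≈⇔ _ _) r))
    ; preserves = λ S us → ⇔-trans (⇔-sym (converted S us)) (⇔-trans
        (QuotientIso.preserves iso S (map convert us))
        (≡⇒⇔ (cong (T ∘ rel D S) (sym (Vec.map-∘ (QuotientIso.to iso) convert us)))))
    } , D∈𝒦
    where
    open IsCongruence congruence
    module ∼ = IsEquivalence isEquivalence

    convert : Σ U δ′ → Σ U δ
    convert (b , db) = b , from (δ⇔ b) db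

    converted : ∀ S us → holds S (map proj₁ (map convert us)) ⇔ holds′ S (map proj₁ us)
    converted S us = ⇔-trans (≡⇒⇔ (cong (holds S) (sym (Vec.map-∘ proj₁ convert us)))) (holds⇔ S _)

    pointwise : ∀ {n} {us vs : Vec (Σ U δ′) n} →
                Pointwise (λ (b , _) (b′ , _) → b ≈′ b′) us vs →
                Pointwise (λ (b , _) (b′ , _) → b ≈ b′) (map convert us) (map convert vs)
    pointwise []       = []
    pointwise (r ∷ rs) = from (≈⇔ _ _) r ∷ pointwise rs

-- Horn closures by refutation of Horn formulas

-- The Horn formula with clauses {x} for F x, {x , ¬y , ¬z} for R x y z, and {¬a}
-- is refutable if and only if a is derivable.  Its variables and clauses are
-- coded by elements e of U, whose kinds are given by isVar, hasPos and hasNeg.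
module HornCNF {U X : Set} (F : X → Set) (R : X → X → X → Set) (a : X)
               (isVar hasPos hasNeg : U → Set) (head left right : U → X) where

  Valid : U → Set
  Valid e = (hasPos e × hasNeg e × R (head e) (left e) (right e)) ⊎
            ((hasPos e × ¬ hasNeg e × F (head e)) ⊎
             (¬ hasPos e × hasNeg e × left e ≡ a × right e ≡ a))

  δ : U → Set
  δ e = isVar e ⊎ Valid e

  -- An element coding a variable means only its `head`, so the remaining components have to be
  -- forgotten. Clauses may stay distinct even if they have the same literals, as repeated clauses
  -- do no harm.
  _≈_ : U → U → Set
  e ≈ e′ = e ≡ e′ ⊎ (isVar e × isVar e′ × head e ≡ head e′)

  holds : (S : Symbol CNFVoc) → Vec U (arity CNFVoc S) → Set
  holds C (e ∷ [])     = ¬ isVar e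
  holds V (e ∷ [])     = isVar e
  holds P (v ∷ c ∷ []) = isVar v × ¬ isVar c × hasPos c × head c ≡ head v
  holds N (v ∷ c ∷ []) = isVar v × ¬ isVar c × hasNeg c × (left c ≡ head v ⊎ right c ≡ head v)

  open Interpreted δ _≈_ holds
    using (B; Congruence; Sorted; isCongruence; wellFormed; Represents; represented; represents-Res; Res-represents)

  congruence : Congruence
  congruence =
    ( (λ x _ → inj₁ refl)
    , (λ { x y _ _ (inj₁ refl) → inj₁ refl ; x y _ _ (inj₂ (v , w , eq)) → inj₂ (w , v , sym eq) })
    , (λ { x y z _ _ _ (inj₁ refl) r → r
         ; x y z _ _ _ (inj₂ h) (inj₁ refl) → inj₂ h
         ; x y z _ _ _ (inj₂ (v , w , eq)) (inj₂ (_ , w′ , eq′)) → inj₂ (v , w′ , trans eq eq′) })) ,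
    (λ { x y _ _ (inj₁ refl) h → h ; x y _ _ (inj₂ (v , _)) h → contradiction v h }) ,
    (λ { x y _ _ (inj₁ refl) h → h ; x y _ _ (inj₂ (_ , w , _)) _ → w }) ,
    (λ { x y _ _ _ _ _ _ (inj₁ refl) (inj₁ refl) h → h
       ; x y _ _ _ _ _ _ _ (inj₂ (v , _)) (_ , ¬v , _) → contradiction v ¬v
       ; x y _ _ _ _ _ _ (inj₂ (_ , w , eq)) (inj₁ refl) (_ , ¬v , p , eq′) → w , ¬v , p , trans eq′ eq }) ,
    (λ { x y _ _ _ _ _ _ (inj₁ refl) (inj₁ refl) h → h
       ; x y _ _ _ _ _ _ _ (inj₂ (v , _)) (_ , ¬v , _) → contradiction v ¬v
       ; x y _ _ _ _ _ _ (inj₂ (_ , w , eq)) (inj₁ refl) (_ , ¬v , n , inj₁ eq′) →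
           w , ¬v , n , inj₁ (trans eq′ eq)
       ; x y _ _ _ _ _ _ (inj₂ (_ , w , eq)) (inj₁ refl) (_ , ¬v , n , inj₂ eq′) →
           w , ¬v , n , inj₂ (trans eq′ eq) })

  sorted : (∀ e → Dec (isVar e)) → Sorted
  sorted isVar? =
    (λ e _ → case isVar? e of λ where
      (yes v) → inj₂ (v , λ ¬v → ¬v v)
      (no ¬v) → inj₁ (¬v , ¬v)) ,
    (λ v c _ _ (h , ¬v , _) → h , ¬v) ,
    (λ v c _ _ (h , ¬v , _) → h , ¬v)

  -- The richness of the coding: every combination of kinds and components occurs. It is supplied
  -- below from two distinct elements.
  module _ (make : ∀ b₀ b₁ b₂ x y z → ∃[ e ] ((isVar e ⇔ T b₀) × (hasPos e ⇔ T b₁) × (hasNeg e ⇔ T b₂) ×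
                                              head e ≡ x × left e ≡ y × right e ≡ z)) where

    module _ {ψ : CNF} (represents : Represents ψ) where
      open CNFPreStructure.Represents represents

      value : Fin (#vars ψ) → X
      value j = head (proj₁ (varRep j))

      value-injective : ∀ {i j} → value i ≡ value j → i ≡ j
      value-injective eq = varRep-injective (inj₂ (varRep-variable _ , varRep-variable _ , eq))

      value-onto : ∀ x → ∃[ j ] (value j ≡ x)
      value-onto x with make true true true x x x
      ... | e , v , _ , _ , refl , _ with varRep-onto (e , inj₁ (from v tt)) (from v tt)
      ... | j , inj₁ eq           = j , cong head (sym eq)
      ... | j , inj₂ (_ , _ , eq) = j , sym eq

      varOf : X → Fin (#vars ψ)
      varOf = proj₁ ∘ value-onto

      varOf-value : ∀ {x j} → x ≡ value j ⇔ j ≡ varOf x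
      varOf-value {x} = mk⇔
        (λ eq → value-injective (trans (sym eq) (sym (proj₂ (value-onto x)))))
        (λ { refl → sym (proj₂ (value-onto x)) })

      clauseElement : Fin (#clauses ψ) → U
      clauseElement i = proj₁ (clauseRep i)

      clause-onto : ∀ e → δ e → ¬ isVar e → ∃[ i ] (e ≡ clauseElement i)
      clause-onto e de ¬v with clauseRep-onto (e , de) ¬v
      ... | i , inj₁ eq      = i , eq
      ... | i , inj₂ (v , _) = contradiction v ¬v

      ∈-positive : ∀ i j → j ∈ positive (clauseAt ψ i) ⇔
                           (hasPos (clauseElement i) × j ≡ varOf (head (clauseElement i)))
      ∈-positive i j = ⇔-trans (⇔-sym Positive⇔) (mk⇔
        (λ (_ , _ , p , eq) → p , to varOf-value eq)
        (λ (p , eq) → varRep-variable j , clauseRep-clause i , p , from varOf-value eq))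

      ∈-negative : ∀ i j → j ∈ negative (clauseAt ψ i) ⇔
        (hasNeg (clauseElement i) × (j ≡ varOf (left (clauseElement i)) ⊎ j ≡ varOf (right (clauseElement i))))
      ∈-negative i j = ⇔-trans (⇔-sym Negative⇔) (mk⇔
        (λ (_ , _ , n , eq) → n , to (⊎-⇔ varOf-value varOf-value) eq)
        (λ (n , eq) → varRep-variable j , clauseRep-clause i , n , from (⊎-⇔ varOf-value varOf-value) eq))

      -- Every derivable clause is true if exactly the elements of the Horn
      -- closure are true, unless a is one of them.
      sound : ∀ {k c} → Derivable k ψ c → (∀ j → j ∈ negative c → Horn F R (value j)) →
              Horn F R a ⊎ ∃ λ j → j ∈ positive c × Horn F R (value j)
      sound (axiom i _) negatives with proj₂ (clauseRep i)
      ... | inj₁ v = contradiction v (clauseRep-clause i)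
      ... | inj₂ (inj₁ (p , n , r)) = inj₂ (varOf _ , from (∈-positive i _) (p , refl) ,
        subst (Horn F R) (from varOf-value refl) (rule r
          (subst (Horn F R) (sym (from varOf-value refl)) (negatives _ (from (∈-negative i _) (n , inj₁ refl))))
          (subst (Horn F R) (sym (from varOf-value refl)) (negatives _ (from (∈-negative i _) (n , inj₂ refl))))))
      ... | inj₂ (inj₂ (inj₁ (p , _ , f))) = inj₂ (varOf _ , from (∈-positive i _) (p , refl) ,
        subst (Horn F R) (from varOf-value refl) (fact f))
      ... | inj₂ (inj₂ (inj₂ (_ , n , left≡a , _))) =
        inj₁ (subst (Horn F R) (trans (sym (from varOf-value refl)) left≡a) (negatives _ (from (∈-negative i _) (n , inj₁ refl))))
      sound (resolve {c} {d} x x∈c x∈d p q _) negatives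
        with sound p (λ j j∈c → negatives j (from (∈-resolvent⁻ x c d) (inj₁ j∈c)))
      ... | inj₁ h = inj₁ h
      ... | inj₂ (j , j∈c , h) with j Fin.≟ x
      ... | no j≢x = inj₂ (j , from (∈-resolvent⁺ x c d) (inj₁ (j∈c , j≢x)) , h)
      -- The resolved variable was found true in the first parent, so it satisfies the negative
      -- literal that the resolvent lacks, and the induction hypothesis applies to the second
      -- parent.
      ... | yes refl
        with sound q (λ i i∈d → case i Fin.≟ x of λ where
               (yes refl) → h
               (no i≢x)   → negatives i (from (∈-resolvent⁻ x c d) (inj₂ (i∈d , i≢x))))
      ... | inj₁ h′ = inj₁ h′
      ... | inj₂ (i , i∈d , h′) = inj₂ (i , from (∈-resolvent⁺ x c d) (inj₂ i∈d) , h′)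

      module _ {k : ℕ} (3≤k : 3 ≤ k) where

        unit : Fin (#vars ψ) → Clause (#vars ψ)
        unit j = clause ⁅ j ⁆ ∅

        -- Unit resolution never enlarges a clause. The case `j ∉ q` occurs when the two premises of
        -- a rule coincide: the first cut then removes both of them.
        cut : ∀ j {p q} → Derivable k ψ (unit j) → Derivable k ψ (clause p q) →
              Derivable k ψ (clause p (q - j))
        cut j {p} {q} u d with j ∈? q
        ... | no j∉q = subst (Derivable k ψ) (clause-ext (λ _ → ⇔-refl) λ i →
                mk⇔ (λ i∈q → from ∈-⇔ (i∈q , λ { refl → j∉q i∈q })) (proj₁ ∘ to ∈-⇔)) d
        ... | yes j∈q = subst (Derivable k ψ) resolvent≡ (resolve j (x∈⁅x⁆ j) j∈q u d
                (subst (λ c → width c ≤ k) (sym resolvent≡)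
                  (ℕ.≤-trans (ℕ.+-monoʳ-≤ ∣ p ∣ (∣p─q∣≤∣p∣ q ⁅ j ⁆)) (derivable-width d))))
          where
          resolvent≡ : resolvent j (unit j) (clause p q) ≡ clause p (q - j)
          resolvent≡ = clause-ext
            (λ i → ⇔-trans (∈-resolvent⁺ j (unit j) (clause p q)) (mk⇔
              (λ { (inj₁ (i∈j , i≢j)) → contradiction (x∈⁅y⁆⇒x≡y j i∈j) i≢j ; (inj₂ i∈p) → i∈p }) inj₂))
            (λ i → ⇔-trans (∈-resolvent⁻ j (unit j) (clause p q)) (mk⇔
              (λ { (inj₁ i∈∅) → contradiction i∈∅ ∉⊥ ; (inj₂ h) → from ∈-⇔ h }) (inj₂ ∘ to ∈-⇔)))

        cut₂ : ∀ {x y p} → Derivable k ψ (unit x) → Derivable k ψ (unit y) →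
               Derivable k ψ (clause p (⁅ x ⁆ ∪ ⁅ y ⁆)) → Derivable k ψ (clause p ∅)
        cut₂ {x} {y} u v d = subst (Derivable k ψ) (clause-ext (λ _ → ⇔-refl) λ i → mk⇔
            (λ i∈ → let i∈′ , i≢y = to ∈-⇔ i∈ ; i∈″ , i≢x = to ∈-⇔ i∈′ in
              contradiction (to ∪⇔⊎ i∈″) λ { (inj₁ i∈x) → i≢x (x∈⁅y⁆⇒x≡y x i∈x)
                                            ; (inj₂ i∈y) → i≢y (x∈⁅y⁆⇒x≡y y i∈y) })
            (λ i∈∅ → contradiction i∈∅ ∉⊥))
          (cut y v (cut x u d))

        ∣pair∣ : ∀ (x y : Fin (#vars ψ)) → ∣ ⁅ x ⁆ ∪ ⁅ y ⁆ ∣ ≤ 2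
        ∣pair∣ x y = ℕ.≤-trans (∣⁅x⁆∪p∣≤1+∣p∣ x ⁅ y ⁆) (s≤s (ℕ.≤-reflexive (∣⁅x⁆∣≡1 y)))

        -- The bound 3 enters here: an input clause has at most one positive literal and two
        -- negative ones, and the cuts only shrink it.
        input : ∀ {c} i → clauseAt ψ i ≡ c → width c ≤ 3 → Derivable k ψ c
        input i refl w = axiom i (ℕ.≤-trans w 3≤k)

        -- Forward chaining: a rule clause is reduced to its head by the unit clauses of its two
        -- premises.
        derive : ∀ {x} → Horn F R x → Derivable k ψ (unit (varOf x))
        derive (fact {x} f) with make false true false x x x
        ... | e , v , p , n , refl , _ , _
          with clause-onto e (inj₂ (inj₂ (inj₁ (from p tt , to n , f)))) (to v)
        ... | i , refl = input i
          (clause-ext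
            (λ j → ⇔-trans (∈-positive i j) (mk⇔ (from x∈⁅y⁆⇔x≡y ∘ proj₂) (λ h → from p tt , to x∈⁅y⁆⇔x≡y h)))
            (λ j → ⇔-trans (∈-negative i j) (mk⇔ (⊥-elim ∘ to n ∘ proj₁) (λ j∈∅ → contradiction j∈∅ ∉⊥))))
          (ℕ.≤-trans (ℕ.≤-reflexive (cong₂ _+_ (∣⁅x⁆∣≡1 (varOf (head e))) (∣⊥∣≡0 (#vars ψ)))) (s≤s z≤n))
        derive (rule {x} {y} {z} r g h) with make false true true x y z
        ... | e , v , p , n , refl , refl , refl
          with clause-onto e (inj₂ (inj₁ (from p tt , from n tt , r))) (to v)
        ... | i , refl = cut₂ (derive g) (derive h) (input i
          (clause-ext
            (λ j → ⇔-trans (∈-positive i j) (mk⇔ (from x∈⁅y⁆⇔x≡y ∘ proj₂) (λ h → from p tt , to x∈⁅y⁆⇔x≡y h)))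
            (λ j → ⇔-trans (∈-negative i j) (⇔-trans
              (mk⇔ proj₂ (from n tt ,_))
              (⇔-trans (⊎-⇔ (⇔-sym x∈⁅y⁆⇔x≡y) (⇔-sym x∈⁅y⁆⇔x≡y)) (⇔-sym ∪⇔⊎)))))
          (ℕ.+-mono-≤ (ℕ.≤-reflexive (∣⁅x⁆∣≡1 (varOf (head e)))) (∣pair∣ (varOf (left e)) (varOf (right e)))))

        refute : Horn F R a → Derivable k ψ □
        refute h with make false false true a a a
        ... | e , v , p , n , _ , left≡a , right≡a
          with clause-onto e (inj₂ (inj₂ (inj₂ (to p , from n tt , left≡a , right≡a)))) (to v)
        ... | i , refl = cut₂ (subst (Derivable k ψ ∘ unit ∘ varOf) (sym left≡a) (derive h))
                              (subst (Derivable k ψ ∘ unit ∘ varOf) (sym right≡a) (derive h)) (input i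
          (clause-ext
            (λ j → ⇔-trans (∈-positive i j) (mk⇔ (⊥-elim ∘ to p ∘ proj₁) (λ j∈∅ → contradiction j∈∅ ∉⊥)))
            (λ j → ⇔-trans (∈-negative i j) (⇔-trans
              (mk⇔ proj₂ (from n tt ,_))
              (⇔-trans (⊎-⇔ (⇔-sym x∈⁅y⁆⇔x≡y) (⇔-sym x∈⁅y⁆⇔x≡y)) (⇔-sym ∪⇔⊎)))))
          (ℕ.+-mono-≤ {y = 1} (ℕ.≤-trans (ℕ.≤-reflexive (∣⊥∣≡0 (#vars ψ))) z≤n)
                      (∣pair∣ (varOf (left e)) (varOf (right e)))))

    Horn-Res⇔ : ∀ {k} → 3 ≤ k → Finite U → (∀ e → Dec (isVar e)) → (∀ e → Dec (δ e)) →
                (∀ e e′ → Dec (e ≈ e′)) → (∀ S us → Dec (holds S us)) →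
                Horn F R a ⇔ QuotientIn (k -Res) B
    Horn-Res⇔ 3≤k 𝒰 isVar? δ? _≈?_ holds? = mk⇔
      (λ h → let congruence′ = to isCongruence congruence
                 ψ , represents = represented 𝒰 δ? _≈?_ holds? congruence′
             in represents-Res congruence′ (to wellFormed (sorted isVar?)) represents
                  (refute represents 3≤k h))
      (λ q → let _ , _ , ψ , represents , d = Res-represents q
             in case sound represents d (λ j j∈∅ → contradiction j∈∅ ∉⊥) of λ where
               (inj₁ h) → h
               (inj₂ (j , j∈∅ , _)) → contradiction j∈∅ ∉⊥)

-- Closure properties of FO(k-Res)

module FOQ-Definability (σ : Vocabulary) (k : ℕ) (3≤k : 3 ≤ k) where

  -- A formula is supplied for every instantiation `xs` of the variables. This builds substitution
  -- into definability, and renaming under quantifiers and inside interpretations never has to be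
  -- defined on formulas.
  record FOQ-Def (Q : Query σ n) : Set where
    constructor foq-def
    field
      decidable : Decidable Q
      formula   : ∀ {m} (xs : Vec (Fin m) n) →
                  Σ[ φ ∈ FOQ CNFVoc σ m ] (∀ A v → Q A (values v xs) ⇔ satFOQ (k -Res) A φ v)

  values-bind : {U : Set} (a : U) (v : Vec U m) (xs : Vec (Fin m) n) →
                values (a ∷ v) (zero ∷ map suc xs) ≡ a ∷ values v xs
  values-bind a v xs = cong (a ∷_) (sym (Vec.map-∘ (lookup (a ∷ v)) suc xs))

  FOQ-foLogic : FOLogic σ
  FOQ-foLogic = record
    { Def = FOQ-Def
    ; dec = FOQ-Def.decidable
    ; resp = λ { e (foq-def Q? φ) → foq-def (λ A v → Dec.map (e A v) (Q? A v)) λ xs →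
        proj₁ (φ xs) , λ A v → ⇔-trans (⇔-sym (e A _)) (proj₂ (φ xs) A v) }
    ; atom-def = λ R → foq-def (λ A v → T? _) λ xs → atom R xs , λ A v → ⇔-refl
    ; ≡-def = foq-def (λ A v → _ Fin.≟ _) λ { (x ∷ y ∷ []) → (x ≐ y) , λ A v → ⇔-refl }
    ; values-def = λ { {Q = Q} ys (foq-def Q? φ) → foq-def (λ A v → Q? A _) λ xs →
        proj₁ (φ (values xs ys)) , λ A v →
          ⇔-trans (≡⇒⇔ (cong (Q A) (values-natural ys (lookup v) xs))) (proj₂ (φ (values xs ys)) A v) }
    ; ¬-def = λ { (foq-def Q? φ) → foq-def (λ A v → ¬? (Q? A v)) λ xs →
        (¬∙ proj₁ (φ xs)) , λ A v → ¬-⇔ (proj₂ (φ xs) A v) }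
    ; ×-def = λ { (foq-def Q? φ) (foq-def Q′? ψ) → foq-def (λ A v → Q? A v ×-dec Q′? A v) λ xs →
        (proj₁ (φ xs) ∧ proj₁ (ψ xs)) , λ A v → ×-⇔ (proj₂ (φ xs) A v) (proj₂ (ψ xs) A v) }
    ; ⊎-def = λ { (foq-def Q? φ) (foq-def Q′? ψ) → foq-def (λ A v → Q? A v ⊎-dec Q′? A v) λ xs →
        (proj₁ (φ xs) ∨ proj₁ (ψ xs)) , λ A v → ⊎-⇔ (proj₂ (φ xs) A v) (proj₂ (ψ xs) A v) }
    ; ∃-def = λ { {Q = Q} (foq-def Q? φ) → foq-def (λ A v → ∃? Fin-finite λ a → Q? A _) λ xs →
        (∃∙ proj₁ (φ (zero ∷ map suc xs))) , λ A v → ∃-⇔ λ a →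
          ⇔-trans (≡⇒⇔ (cong (Q A) (sym (values-bind a v xs)))) (proj₂ (φ (zero ∷ map suc xs)) A (a ∷ v)) }
    }

  open FOLogic FOQ-foLogic

  abstract
    formulaS : ∀ s {Q : SQuery σ s} → DefS s Q →
               Σ[ φ ∈ FOQ CNFVoc σ ∥ s ∥ ] (∀ A x → Q A x ⇔ satFOQ (k -Res) A φ (flatten s x))
    formulaS s {Q} (shaped (foq-def _ φ)) = proj₁ (φ (allFin _)) , λ A x → ⇔-trans
      (≡⇒⇔ (cong (Q A) (sym (trans (cong (unflatten s) (values-allFin (flatten s x))) (unflatten-flatten s x)))))
      (proj₂ (φ (allFin _)) A (flatten s x))

  module _ {r : ℕ} {F : Query σ r} {R : Query σ (r + (r + r))}
           (F-def : FOQ-Def F) (R-def : FOQ-Def R) where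

    private
      -- A flag is a pair of elements and is set when they are equal. The three flags of an element
      -- give its kind and the three tuples its head and premises, so elements form the domain of a
      -- `d`-dimensional interpretation with the goal `a` as parameter.
      Flag Element : Shape
      Flag    = vec 1 ⊗ vec 1
      Element = (Flag ⊗ (Flag ⊗ Flag)) ⊗ (vec r ⊗ (vec r ⊗ vec r))

      d : ℕ
      d = ∥ Element ∥

      view : {U : Set} → Vec U d → ⟦ Element ⟧ U
      view = unflatten Element

      set : {U : Set} → ⟦ Flag ⟧ U → Set
      set (p , q) = p ≡ q

      isVar hasPos hasNeg : {U : Set} → Vec U d → Set
      isVar  e = let (f , _) , _ = view e in set f
      hasPos e = let (_ , f , _) , _ = view e in set f
      hasNeg e = let (_ , _ , f) , _ = view e in set f

      head left right : {U : Set} → Vec U d → Vec U r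
      head  e = let _ , x , _ = view e in x
      left  e = let _ , _ , y , _ = view e in y
      right e = let _ , _ , _ , z = view e in z

      module H (A : Structure σ) (a : Vec ∣ A ∣ₛ r) =
        HornCNF (F A) (λ x y z → R A (x ++ (y ++ z))) a isVar hasPos hasNeg head left right

      viewS : ∀ {s} {Q : SQuery σ (Element ⊗ s)} → DefS (Element ⊗ s) Q →
              DefS (vec d ⊗ s) (λ A (e , x) → Q A (view e , x))
      viewS {s} = renS (λ (e , x) → view e , x) (λ g (e , x) → cong (_, smap s g x) (sym (smap-unflatten Element g e)))

      view₂S : ∀ {s} {Q : SQuery σ (Element ⊗ (Element ⊗ s))} → DefS (Element ⊗ (Element ⊗ s)) Q →
               DefS (vec d ⊗ (vec d ⊗ s)) (λ A (e , e′ , x) → Q A (view e , view e′ , x))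
      view₂S {s} = renS (λ (e , e′ , x) → view e , view e′ , x) (λ g (e , e′ , x) →
        cong₂ (λ y z → y , z , smap s g x) (sym (smap-unflatten Element g e)) (sym (smap-unflatten Element g e′)))

      flagS : DefS Flag (λ A f → set f)
      flagS = ≡S (vec 1)

      δS : DefS (vec d ⊗ vec r) (λ A (e , a) → H.δ A a e)
      δS = viewS
        (renS (λ (((f , _) , _) , _) → f) (λ _ _ → refl) flagS ⊎S
         ((hasPosS ×S hasNegS ×S
           renS (λ ((_ , xyz) , _) → xyz) (λ _ _ → refl) (flatS {s = vec r ⊗ (vec r ⊗ vec r)} R-def)) ⊎S
          ((hasPosS ×S ¬S hasNegS ×S renS (λ ((_ , x , _) , _) → x) (λ _ _ → refl) (vecS F-def)) ⊎S
           (¬S hasPosS ×S hasNegS ×S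
            renS (λ ((_ , _ , y , _) , a) → y , a) (λ _ _ → refl) (≡S (vec r)) ×S
            renS (λ ((_ , _ , _ , z) , a) → z , a) (λ _ _ → refl) (≡S (vec r))))))
        where
        hasPosS : DefS (Element ⊗ vec r) (λ A (((_ , f , _) , _) , _) → set f)
        hasPosS = renS (λ (((_ , f , _) , _) , _) → f) (λ _ _ → refl) flagS
        hasNegS : DefS (Element ⊗ vec r) (λ A (((_ , _ , f) , _) , _) → set f)
        hasNegS = renS (λ (((_ , _ , f) , _) , _) → f) (λ _ _ → refl) flagS

      ≈S : DefS (vec d ⊗ (vec d ⊗ vec r)) (λ A (e , e′ , a) → H._≈_ A a e e′)
      ≈S = renS (λ (e , e′ , a) → e , e′) (λ _ _ → refl) (≡S (vec d)) ⊎S view₂S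
        (renS (λ (((f , _) , _) , _) → f) (λ _ _ → refl) flagS ×S
         renS (λ (_ , ((f , _) , _) , _) → f) (λ _ _ → refl) flagS ×S
         renS (λ ((_ , x , _) , (_ , x′ , _) , _) → x , x′) (λ _ _ → refl) (≡S (vec r)))

      unaryS : {Q : SQuery σ (Element ⊗ vec r)} → DefS (Element ⊗ vec r) Q →
               DefS (vec d ^ 1 ⊗ vec r) (λ A (es , a) → Q A (view (lookup es zero) , a))
      unaryS q = renS {t = vec d ⊗ vec r} (λ (es , a) → lookup es zero , a)
        (λ g (es , a) → cong (_, map g a) (Vec.lookup-map zero (map g) es)) (viewS q)

      binaryS : {Q : SQuery σ (Element ⊗ (Element ⊗ vec r))} → DefS (Element ⊗ (Element ⊗ vec r)) Q →
                DefS (vec d ^ 2 ⊗ vec r)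
                  (λ A (es , a) → Q A (view (lookup es zero) , view (lookup es (suc zero)) , a))
      binaryS q = renS {t = vec d ⊗ (vec d ⊗ vec r)} (λ (es , a) → lookup es zero , lookup es (suc zero) , a)
        (λ g (es , a) → cong₂ (λ e e′ → e , e′ , map g a)
          (Vec.lookup-map zero (map g) es) (Vec.lookup-map (suc zero) (map g) es)) (view₂S q)

      holdsS : ∀ S → DefS (vec d ^ arity CNFVoc S ⊗ vec r) (λ A (es , a) → H.holds A a S es)
      holdsS C = respS (λ { A (e ∷ [] , a) → ⇔-refl }) (unaryS
        (renS (λ (((f , _) , _) , _) → f) (λ _ _ → refl) (¬S flagS)))
      holdsS V = respS (λ { A (e ∷ [] , a) → ⇔-refl }) (unaryS
        (renS (λ (((f , _) , _) , _) → f) (λ _ _ → refl) flagS))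
      holdsS P = respS (λ { A (e ∷ e′ ∷ [] , a) → ⇔-refl }) (binaryS
        (renS (λ (((f , _) , _) , _) → f) (λ _ _ → refl) flagS ×S
         renS (λ (_ , ((f , _) , _) , _) → f) (λ _ _ → refl) (¬S flagS) ×S
         renS (λ (_ , ((_ , f , _) , _) , _) → f) (λ _ _ → refl) flagS ×S
         renS (λ ((_ , x , _) , (_ , x′ , _) , _) → x′ , x) (λ _ _ → refl) (≡S (vec r))))
      holdsS N = respS (λ { A (e ∷ e′ ∷ [] , a) → ⇔-refl }) (binaryS
        (renS (λ (((f , _) , _) , _) → f) (λ _ _ → refl) flagS ×S
         renS (λ (_ , ((f , _) , _) , _) → f) (λ _ _ → refl) (¬S flagS) ×S
         renS (λ (_ , ((_ , _ , f) , _) , _) → f) (λ _ _ → refl) flagS ×S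
         (renS (λ ((_ , x , _) , (_ , _ , y , _) , _) → y , x) (λ _ _ → refl) (≡S (vec r)) ⊎S
          renS (λ ((_ , x , _) , (_ , _ , _ , z) , _) → z , x) (λ _ _ → refl) (≡S (vec r)))))

      isVar? : ∀ A (e : Vec ∣ A ∣ₛ d) → Dec (isVar e)
      isVar? A e = let (f , _) , _ = view e in decS flagS A f

      module _ (A : Structure σ) (many : Many A) where

        flag : Bool → ⟦ Flag ⟧ ∣ A ∣ₛ
        flag true  = proj₁ (proj₁ many) , proj₁ (proj₁ many)
        flag false = proj₁ many

        flag⇔ : ∀ b → set (flag b) ⇔ T b
        flag⇔ true  = mk⇔ _ (λ _ → refl)
        flag⇔ false = mk⇔ (proj₂ many) λ ()

        make : ∀ b₀ b₁ b₂ (x y z : Vec ∣ A ∣ₛ r) →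
               ∃[ e ] ((isVar e ⇔ T b₀) × (hasPos e ⇔ T b₁) × (hasNeg e ⇔ T b₂) ×
                       head e ≡ x × left e ≡ y × right e ≡ z)
        make b₀ b₁ b₂ x y z = flatten Element e , subst
          (λ ((f₀ , f₁ , f₂) , x′ , y′ , z′) → (set f₀ ⇔ T b₀) × (set f₁ ⇔ T b₁) × (set f₂ ⇔ T b₂) ×
                                               x′ ≡ x × y′ ≡ y × z′ ≡ z)
          (sym (unflatten-flatten Element e))
          (flag⇔ b₀ , flag⇔ b₁ , flag⇔ b₂ , refl , refl , refl)
          where
          e : ⟦ Element ⟧ ∣ A ∣ₛ
          e = (flag b₀ , flag b₁ , flag b₂) , x , y , z

        Horn⇔Quotient : ∀ a → Horn (F A) (λ x y z → R A (x ++ (y ++ z))) a ⇔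
          QuotientIn (k -Res) (Interpreted.B (H.δ A a) (H._≈_ A a) (H.holds A a))
        Horn⇔Quotient a = H.Horn-Res⇔ A a make 3≤k (Vec-finite Fin-finite d) (isVar? A)
          (λ e → decS δS A (e , a)) (λ e e′ → decS ≈S A (e , e′ , a)) (λ S es → decS (holdsS S) A (es , a))

      Horn-one : ∀ A → ¬ Many A → ∀ {x a} → Horn (F A) (λ x y z → R A (x ++ (y ++ z))) x → F A a
      Horn-one A one (fact f)     = subst (F A) (one-unique A one _ _) f
      Horn-one A one (rule _ p _) = Horn-one A one p

      smallS : DefS (vec r) (λ A a → ¬ Many A × F A a)
      smallS = ¬S ManyS ×S vecS F-def

    module _ {m : ℕ} (xs : Vec (Fin m) r) where

      private
        small : Σ[ φ ∈ FOQ CNFVoc σ m ] (∀ A v → (¬ Many A × F A (values v xs)) ⇔ satFOQ (k -Res) A φ v)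
        small = formulaS (vec m) (valuesS xs smallS)

        many : Σ[ φ ∈ FOQ CNFVoc σ m ] (∀ A v → Many A ⇔ satFOQ (k -Res) A φ v)
        many = formulaS (vec m) ManyS

        δφ : Σ[ φ ∈ FOQ CNFVoc σ (d + m) ]
             (∀ A ((b , v) : Vec ∣ A ∣ₛ d × Vec ∣ A ∣ₛ m) →
               H.δ A (values v xs) b ⇔ satFOQ (k -Res) A φ (b ++ v))
        δφ = formulaS (vec d ⊗ vec m) (renS (λ (b , v) → b , values v xs)
          (λ g (b , v) → cong (map g b ,_) (values-natural xs g v)) δS)

        ≈φ : Σ[ φ ∈ FOQ CNFVoc σ (d + (d + m)) ]
             (∀ A ((b , b′ , v) : Vec ∣ A ∣ₛ d × Vec ∣ A ∣ₛ d × Vec ∣ A ∣ₛ m) →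
               H._≈_ A (values v xs) b b′ ⇔ satFOQ (k -Res) A φ (b ++ (b′ ++ v)))
        ≈φ = formulaS (vec d ⊗ (vec d ⊗ vec m)) (renS (λ (b , b′ , v) → b , b′ , values v xs)
          (λ g (b , b′ , v) → cong (λ w → map g b , map g b′ , w) (values-natural xs g v)) ≈S)

        holdsφ : ∀ S → Σ[ φ ∈ FOQ CNFVoc σ (arity CNFVoc S * d + m) ]
                 (∀ A ((us , v) : Vec (Vec ∣ A ∣ₛ d) (arity CNFVoc S) × Vec ∣ A ∣ₛ m) →
                   H.holds A (values v xs) S us ⇔ satFOQ (k -Res) A φ (concat (map id us) ++ v))
        holdsφ S = formulaS (vec d ^ arity CNFVoc S ⊗ vec m) (renS (λ (us , v) → us , values v xs)
          (λ g (us , v) → cong (map (map g) us ,_) (values-natural xs g v)) (holdsS S))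

        holds⇔ : ∀ A v S us → H.holds A (values v xs) S us ⇔
                              satFOQ (k -Res) A (proj₁ (holdsφ S)) (concat us ++ v)
        holds⇔ A v S us = ⇔-trans (proj₂ (holdsφ S) A (us , v)) (≡⇒⇔
          (cong (λ w → satFOQ (k -Res) A (proj₁ (holdsφ S)) (concat w ++ v)) (Vec.map-id us)))

        refutation : FOQ CNFVoc σ m
        refutation = 𝒬 (interpretation d (proj₁ δφ) (proj₁ ≈φ) (λ S → proj₁ (holdsφ S)))

        module Defined (A : Structure σ) (v : Vec ∣ A ∣ₛ m) where
          δ′ : Vec ∣ A ∣ₛ d → Set
          δ′ b = satFOQ (k -Res) A (proj₁ δφ) (b ++ v)

          _≈′_ : Vec ∣ A ∣ₛ d → Vec ∣ A ∣ₛ d → Set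
          b ≈′ b′ = satFOQ (k -Res) A (proj₁ ≈φ) (b ++ (b′ ++ v))

          holds′ : (S : Symbol CNFVoc) → Vec (Vec ∣ A ∣ₛ d) (arity CNFVoc S) → Set
          holds′ S us = satFOQ (k -Res) A (proj₁ (holdsφ S)) (concat us ++ v)

        refutation⇔ : ∀ A v →
          QuotientIn (k -Res) (Interpreted.B (H.δ A (values v xs)) (H._≈_ A (values v xs)) (H.holds A (values v xs)))
          ⇔ satFOQ (k -Res) A refutation v
        refutation⇔ A v = mk⇔
          (quotientIn-resp {δ = H.δ A (values v xs)} {δ′ = δ′} {_≈_ = H._≈_ A (values v xs)} {_≈′_ = _≈′_}
            {holds = H.holds A (values v xs)} {holds′ = holds′}
            (λ b → proj₂ δφ A (b , v)) (λ b b′ → proj₂ ≈φ A (b , b′ , v)) (holds⇔ A v) {𝒦 = k -Res})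
          (quotientIn-resp {δ = δ′} {δ′ = H.δ A (values v xs)} {_≈_ = _≈′_} {_≈′_ = H._≈_ A (values v xs)}
            {holds = holds′} {holds′ = H.holds A (values v xs)}
            (λ b → ⇔-sym (proj₂ δφ A (b , v)))
            (λ b b′ → ⇔-sym (proj₂ ≈φ A (b , b′ , v))) (λ S us → ⇔-sym (holds⇔ A v S us)) {𝒦 = k -Res})
          where open Defined A v

        module _ (A : Structure σ) (v : Vec ∣ A ∣ₛ m) where

          Derived Formula : Set
          Derived = Horn (F A) (λ x y z → R A (x ++ (y ++ z))) (values v xs)
          Formula = satFOQ (k -Res) A (proj₁ small) v ⊎
                    (satFOQ (k -Res) A (proj₁ many) v × satFOQ (k -Res) A refutation v)

          ⇒Formula : Dec (Many A) → Derived → Formula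
          ⇒Formula (yes M)  h = inj₂ (to (proj₂ many A v) M ,
            to (refutation⇔ A v) (to (Horn⇔Quotient A M (values v xs)) h))
          ⇒Formula (no one) h = inj₁ (to (proj₂ small A v) (one , Horn-one A one h))

          ⇐Formula : Formula → Derived
          ⇐Formula (inj₁ h)       = fact (proj₂ (from (proj₂ small A v) h))
          ⇐Formula (inj₂ (M , q)) =
            from (Horn⇔Quotient A (from (proj₂ many A v) M) (values v xs)) (from (refutation⇔ A v) q)

      Horn-formula : Σ[ φ ∈ FOQ CNFVoc σ m ] (∀ A v →
        Horn (F A) (λ x y z → R A (x ++ (y ++ z))) (values v xs) ⇔ satFOQ (k -Res) A φ v)
      Horn-formula = (proj₁ small ∨ (proj₁ many ∧ refutation)) ,
        λ A v → mk⇔ (⇒Formula A v (decS {s = vec m} ManyS A v)) (⇐Formula A v)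

  FOQ-logic : Logic σ
  FOQ-logic = record
    { foLogic  = FOQ-foLogic
    ; Horn-def = λ F-def R-def → foq-def
        (λ A → Horn? (Vec-finite Fin-finite _) (FOQ-Def.decidable F-def A)
                     (λ x y z → FOQ-Def.decidable R-def A _))
        (Horn-formula F-def R-def)
    }

-- Each logic interpreted in the queries of the other

theorem3p7 : (k : ℕ) → 3 ≤ k → (σ : Vocabulary) {p : Level} (𝒞 : Class σ p) →
    FOQ-Definable (k -Res) 𝒞 ⇔ EFP-Definable 𝒞
theorem3p7 k 3≤k σ 𝒞 = mk⇔
  (λ (φ , 𝒞⇔φ) →
    let efp-def _ (ψ , φ⇔ψ) = FOLogic.unshaped (satFOQ-S EFP-logic k φ)
    in _ , ψ , λ A → ⇔-trans (𝒞⇔φ A) (φ⇔ψ A []))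
  (λ (_ , φ , 𝒞⇔φ) →
    let ψ , φ⇔ψ = FOQ-Def.formula (FOLogic.unshaped (satEFP-S (FOQ-logic σ k 3≤k) φ)) []
    in ψ , λ A → ⇔-trans (𝒞⇔φ A) (φ⇔ψ A []))
  where
  open ResolutionDefinability
  open Compilation
  open FOQ-Definability
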